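{- Consider the random directed graph $G_n=(V,E)$ of the octahedral small world (OSW) model described in the context. Consider the following greedy routing algorithm for delivering a message from a source $s\in V$ to a target $t\in V$: the vertex $u$ currently holding the message (initially $s$), if $u\ne t$, forwards it to an out-neighbor $v$ of $u$ in $G_n$ maximizing $\frac{v\cdot t}{|v|\,|t|}$ (i.e., minimizing the angle between the vectors $v$ and $t$), where $v\cdot t=\sum_{i=1}^3 v_it_i$ and $|w|=(\sum_{i=1}^3 w_i^2)^{1/2}$. Then the expected number of forwards performed by this algorithm until the message reaches $t$ is $\mathcal{O}(\log^2 n)$, uniformly over all $s,t\in V$.
   Context: Let $n\ge1$ be an integer, $V=\{u\in\mathbb{Z}^3:\sum_{i=1}^3|u_i|=n\}$, $E'=\{\{v,w\}\subset V: v\ne w,\ |v_i-w_i|\le1\ \forall 1\le i\le3\}$ (the undirected $n$-octahedral graph $G'_n=(V,E')$), and let $d_{uv}$ be the shortest-path distance in $G'_n$. For $u\in V$ let $Z_u=\left(\sum_{w\in V\setminus\{u\}}d_{uw}^{ -2}\right)^{ -1}$. The OSW graph $G_n=(V,E)$ is the random directed graph whose edge set $E$ contains (i) both directed edges $(u,v)$ and $(v,u)$ for every $\{u,v\}\in E'$, and (ii) for each $u\in V$, independently, one directed edge $(u,v)$ where $v\in V\setminus\{u\}$ is chosen at random with probability $\Pr(C_{uv})=Z_u d_{uv}^{ -2}$ ($C_{uv}$ denotes the event that $u$ chooses $v$). The out-neighbors of $u$ in $G_n$ are the $v$ with $(u,v)\in E$. -}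

module Defs where

open import Data.Nat as ℕ using (ℕ; zero; suc)
open import Data.Integer as ℤ using (ℤ; +_; -[1+_]; ∣_∣)
open import Data.Rational as ℚ using (ℚ; 0ℚ; 1/_; mkℚ)
open import Data.Product using (_×_; _,_)
open import Data.Product.Properties using (≡-dec)
open import Data.List using (List; []; _∷_; map; filter; concatMap; upTo; length; foldr; _++_)
open import Data.Bool using (if_then_else_)
open import Relation.Nullary using (¬_; Dec; yes; no; does)
open import Relation.Nullary.Decidable using (_×-dec_; ¬?)
open import Relation.Binary.PropositionalEquality using (_≡_)
open import Relation.Binary.Definitions using (DecidableEquality)

Vertex : Set
Vertex = ℤ × ℤ × ℤ

_≟V_ : DecidableEquality Vertex
_≟V_ = ≡-dec ℤ._≟_ (≡-dec ℤ._≟_ ℤ._≟_)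

open import Data.List.Membership.DecPropositional _≟V_ public using (_∈_; _∈?_)

norm1 : Vertex → ℕ
norm1 (x , y , z) = ∣ x ∣ ℕ.+ ∣ y ∣ ℕ.+ ∣ z ∣

range : ℕ → List ℤ
range n = map (λ i → + i ℤ.- + n) (upTo (suc (2 ℕ.* n)))

V : ℕ → List Vertex
V n = filter (λ u → norm1 u ℕ.≟ n)
        (concatMap (λ x → concatMap (λ y → map (λ z → (x , y , z)) (range n)) (range n)) (range n))

Adj : Vertex → Vertex → Set
Adj (a , b , c) (d , e , f) =
  ¬ ((a , b , c) ≡ (d , e , f)) × (∣ a ℤ.- d ∣ ℕ.≤ 1) × (∣ b ℤ.- e ∣ ℕ.≤ 1) × (∣ c ℤ.- f ∣ ℕ.≤ 1)

adj? : (v w : Vertex) → Dec (Adj v w)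
adj? (a , b , c) (d , e , f) =
  ¬? ((a , b , c) ≟V (d , e , f)) ×-dec ((∣ a ℤ.- d ∣ ℕ.≤? 1) ×-dec ((∣ b ℤ.- e ∣ ℕ.≤? 1) ×-dec (∣ c ℤ.- f ∣ ℕ.≤? 1)))

nbrs : ℕ → Vertex → List Vertex
nbrs n u = filter (adj? u) (V n)

ball : ℕ → ℕ → Vertex → List Vertex
ball n zero    u = u ∷ []
ball n (suc k) u = ball n k u ++ concatMap (nbrs n) (ball n k u)

distSearch : ℕ → ℕ → ℕ → Vertex → Vertex → ℕ
distSearch n zero    k u v = k
distSearch n (suc f) k u v = if does (v ∈? ball n k u) then k else distSearch n f (suc k) u v

-- shortest-path distance d_{uv} in G'_n (G'_n is connected, so |V| is enough fuel)
dist : ℕ → Vertex → Vertex → ℕ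
dist n u v = distSearch n (length (V n)) 0 u v

-- 1/k as a rational (only used with k ≥ 1)
recipℕ : ℕ → ℚ
recipℕ zero    = 0ℚ
recipℕ (suc k) = + 1 ℚ./ suc k

-- total inverse on ℚ (only used at nonzero arguments)
inv : ℚ → ℚ
inv p@(mkℚ (+ zero)  _ _) = 0ℚ
inv p@(mkℚ (+ suc _) _ _) = 1/ p
inv p@(mkℚ -[1+ _ ]  _ _) = 1/ p

sumℚ : List ℚ → ℚ
sumℚ = foldr ℚ._+_ 0ℚ

others : ℕ → Vertex → List Vertex
others n u = filter (λ w → ¬? (w ≟V u)) (V n)

invSq : ℕ → Vertex → Vertex → ℚ
invSq n u v = recipℕ (dist n u v ℕ.* dist n u v)

Z : ℕ → Vertex → ℚ
Z n u = inv (sumℚ (map (invSq n u) (others n u)))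

Pr : ℕ → Vertex → Vertex → ℚ
Pr n u v = Z n u ℚ.* invSq n u v

-- A configuration of long-range contacts: u ↦ the vertex chosen by u.
Config : Set
Config = Vertex → Vertex

update : Config → Vertex → Vertex → Config
update c u w x = if does (x ≟V u) then w else c x

-- Expectation of f over independent choices c(u) ~ Pr(C_{u·}) for u in the list.
expectOver : ℕ → List Vertex → (Config → ℚ) → ℚ
expectOver n []       f = f (λ x → x)
expectOver n (u ∷ us) f =
  sumℚ (map (λ w → Pr n u w ℚ.* expectOver n us (λ c → f (update c u w))) (others n u))

Expect : ℕ → (Config → ℚ) → ℚ
Expect n f = expectOver n (V n) f

outNbrs : ℕ → Vertex → Vertex → List Vertex
outNbrs n u w = w ∷ nbrs n u

dot : Vertex → Vertex → ℤ
dot (a , b , c) (d , e , f) = a ℤ.* d ℤ.+ b ℤ.* e ℤ.+ c ℤ.* f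

-- x ↦ x|x|  (strictly monotone on ℤ)
sq± : ℤ → ℤ
sq± x = x ℤ.* (+ ∣ x ∣)

-- CosGE t v v' : (v·t)/(|v||t|) ≥ (v'·t)/(|v'||t|).
-- Since |t| > 0 and x ↦ x|x| is strictly increasing, this is equivalent to
-- (v·t)|v·t| / |v|² ≥ (v'·t)|v'·t| / |v'|², i.e. (clearing the positive
-- denominators |v|², |v'|²) the integer inequality below.
CosGE : Vertex → Vertex → Vertex → Set
CosGE t v v' = sq± (dot v' t) ℤ.* dot v v ℤ.≤ sq± (dot v t) ℤ.* dot v' v'

-- A forwarding rule towards target t: r u w is the vertex to which u forwards
-- when u's long-range contact is w. It is valid if it always picks an
-- out-neighbour of u maximizing the cosine with t (ties broken arbitrarily).
ValidRule : ℕ → Vertex → (Vertex → Vertex → Vertex) → Set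
ValidRule n t r =
  ∀ u w → u ∈ V n → w ∈ others n u →
    (r u w ∈ outNbrs n u w) × (∀ v → v ∈ outNbrs n u w → CosGE t (r u w) v)

-- Number of forwards performed during the first F rounds of greedy routing
-- from u to t in configuration c (= min(T, F), T the delivery time).
forwardsWithin : Vertex → (Vertex → Vertex → Vertex) → Config → ℕ → Vertex → ℕ
forwardsWithin t r c zero    u = 0
forwardsWithin t r c (suc F) u =
  if does (u ≟V t) then 0 else suc (forwardsWithin t r c F (r u (c u)))

{-# OPTIONS --safe #-}
module Submission where

-- Angles to t and l¹ distances to t are comparable: if v is at least as close to t in angle as u,
-- then |v - t|₁ ≤ 6 |u - t|₁.  Every u ≠ t has a neighbour strictly closer in angle, so the angle
-- decreases along the route, no vertex is revisited, and each long-range choice is fresh.  Call u at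
-- scale j if j is least such that some vertex with |x - t|₁ < 2^j is no closer in angle than u; the
-- scale never increases along the route.  At scale j + 1 there are of order 4^j vertices w with
-- |w - t|₁ < 2^j, all at graph distance O(2^j) from u, and jumping to any of them lowers the scale.
-- Since the sum of d(u, w)⁻² over w is O(log n), such a jump has probability at least c / log n.
-- Hence C log n times the scale is a potential whose expected decrease per forward is at least 1,
-- and there are only O(log n) scales.

-- The rule minimizes an angle, while probabilities and counts are governed by distance, and
-- `|u - t|₁` may grow from one forward to the next. Applied along the route, the factor 6 would
-- compound. Defining the scale by the existence of a witness avoids this: when the angle shrinks an
-- old witness remains one, so the factor is paid only once, between the current vertex and its
-- witness.
--
-- Everything stays within integers and rationals. Cosines occur only in cross-multiplied form, and
-- most inequalities are proved by writing the difference of the two sides as a visibly nonnegative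
-- polynomial. The strictly better neighbour arises by transferring one unit between two
-- coordinates; which transfer works depends on whether the angle to t is obtuse, whether the
-- octants agree and whether u lies on an axis. The graph distance enters through two estimates: a
-- multiple of the l¹ distance from above, and two coordinate differences from below.

-- Ordered-ring arithmetic on the integers.

module IntegerOrder where
  import Data.Nat as ℕ
  import Data.Nat.Properties as ℕ
  open import Data.Integer
  open import Data.Integer.Properties
  open import Data.Integer.Tactic.RingSolver
  open import Data.Sum using (_⊎_; inj₁; inj₂)
  open import Relation.Nullary using (¬_)
  open import Relation.Binary.PropositionalEquality

  0≤+ : ∀ {x y} → 0ℤ ≤ x → 0ℤ ≤ y → 0ℤ ≤ x + y
  0≤+ p q = +-mono-≤ p q

  0≤* : ∀ {x y} → 0ℤ ≤ x → 0ℤ ≤ y → 0ℤ ≤ x * y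
  0≤* {+ m} {+ n} _ _ = subst (0ℤ ≤_) (pos-* m n) (+≤+ ℕ.z≤n)

  0≤sq : ∀ x → 0ℤ ≤ x * x
  0≤sq (+ n) = 0≤* {+ n} {+ n} (+≤+ ℕ.z≤n) (+≤+ ℕ.z≤n)
  0≤sq -[1+ n ] = +≤+ ℕ.z≤n

  0≤+n : ∀ {n} → 0ℤ ≤ + n
  0≤+n = +≤+ ℕ.z≤n

  0<+ : ∀ {x y} → 0ℤ < x → 0ℤ ≤ y → 0ℤ < x + y
  0<+ p q = +-mono-<-≤ p q

  0≤+< : ∀ {x y} → 0ℤ ≤ x → 0ℤ < y → 0ℤ < x + y
  0≤+< p q = +-mono-≤-< p q

  0<* : ∀ {x y} → 0ℤ < x → 0ℤ < y → 0ℤ < x * y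
  0<* {+ ℕ.suc m} {+ ℕ.suc n} _ _ = +<+ (ℕ.s≤s ℕ.z≤n)
  0<* {+ ℕ.zero} (+<+ ())
  0<* {+ ℕ.suc m} {+ ℕ.zero} _ (+<+ ())

  ≤⇒0≤ : ∀ {x y} → x ≤ y → 0ℤ ≤ y - x
  ≤⇒0≤ = i≤j⇒0≤j-i

  <⇒0< : ∀ {x y} → x < y → 0ℤ < y - x
  <⇒0< {x} {y} x<y = subst (_< y - x) (+-inverseʳ x) (+-monoˡ-< (- x) x<y)

  -- The form of most integer estimates below: the ring solver confirms that `e` is the difference,
  -- and the sign of `e` is read off from its shape.
  by≤ : ∀ {x y e} → 0ℤ ≤ e → y ≡ x + e → x ≤ y
  by≤ {x} {y} p eq = subst₂ _≤_ (+-identityʳ x) (sym eq) (+-monoʳ-≤ x p)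

  by< : ∀ {x y e} → 0ℤ < e → y ≡ x + e → x < y
  by< {x} {y} p eq = subst₂ _<_ (+-identityʳ x) (sym eq) (+-monoʳ-< x p)

  0<⇒¬≤0 : ∀ {x} → 0ℤ < x → ¬ (x ≤ 0ℤ)
  0<⇒¬≤0 p q = <-irrefl refl (<-≤-trans p q)

  cancel≤ : ∀ {k x y} → 0ℤ < k → k * x ≤ k * y → x ≤ y
  cancel≤ {+ ℕ.suc n} {x} {y} _ le = *-cancelˡ-≤-pos x y (+ ℕ.suc n) le
  cancel≤ {+ ℕ.zero} (+<+ ())

  cancel< : ∀ {k x y} → 0ℤ ≤ k → k * x < k * y → x < y
  cancel< {+ n} _ lt = *-cancelˡ-<-nonNeg (+ n) lt

  *≤ : ∀ {k x y} → 0ℤ ≤ k → x ≤ y → k * x ≤ k * y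
  *≤ {+ n} _ le = *-monoˡ-≤-nonNeg (+ n) le

  *< : ∀ {k x y} → 0ℤ < k → x < y → k * x < k * y
  *< {+ ℕ.suc n} _ lt = *-monoˡ-<-pos (+ ℕ.suc n) lt
  *< {+ ℕ.zero} (+<+ ())

  *≤* : ∀ {a b c d} → 0ℤ ≤ c → 0ℤ ≤ b → a ≤ b → c ≤ d → a * c ≤ b * d
  *≤* {a} {b} {c} {d} 0≤c 0≤b p q =
    ≤-trans (subst₂ _≤_ (*-comm c a) (*-comm c b) (*≤ 0≤c p)) (*≤ 0≤b q)

  sq≤sq : ∀ {x y} → 0ℤ ≤ x → x ≤ y → x * x ≤ y * y
  sq≤sq 0≤x x≤y = *≤* 0≤x (≤-trans 0≤x x≤y) x≤y x≤y

  sq<sq : ∀ {x y} → 0ℤ ≤ x → x < y → x * x < y * y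
  sq<sq {x} {y} 0≤x x<y = by< (0<* (<⇒0< x<y) (≤-<-trans 0≤x (subst (_< y + x) (+-identityˡ x) (+-monoˡ-< x (≤-<-trans 0≤x x<y))))) (lem x y)
    where lem : ∀ x y → y * y ≡ x * x + (y - x) * (y + x)
          lem = solve-∀

  sq≤sq⁻¹ : ∀ {x y} → 0ℤ ≤ x → 0ℤ ≤ y → x * x ≤ y * y → x ≤ y
  sq≤sq⁻¹ 0≤x 0≤y le = ≮⇒≥ (λ lt → <-irrefl refl (<-≤-trans (sq<sq 0≤y lt) le))

  neg-pos : ∀ {x} → x < 0ℤ → 0ℤ < - x
  neg-pos {x} lt = subst (_< - x) refl (neg-mono-< lt)

  0≤-cases : ∀ x → (0ℤ ≤ x) ⊎ (0ℤ < - x)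
  0≤-cases (+ n) = inj₁ (+≤+ ℕ.z≤n)
  0≤-cases -[1+ n ] = inj₂ (+<+ (ℕ.s≤s ℕ.z≤n))

-- Comparison of angles to t with l¹ distances to t.

module Angles where
  open import Defs
  open IntegerOrder
  import Data.Nat as ℕ
  import Data.Nat.Properties as ℕ
  open import Data.Integer hiding (_⊖_)
  open import Data.Integer.Properties renaming (abs-* to ∣∣-*)
  open import Data.Integer.Tactic.RingSolver
  open import Data.Product using (_,_)
  open import Data.Sum using (_⊎_; inj₁; inj₂)
  open import Data.Empty using (⊥-elim)
  open import Relation.Binary.PropositionalEquality

  abs : ℤ → ℤ
  abs x = + ∣ x ∣

  abs² : ∀ x → (abs x) * (abs x) ≡ x * x
  abs² (+ n) = refl
  abs² -[1+ n ] = refl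

  abs-+ : ∀ x y → abs (x + y) ≤ abs x + abs y
  abs-+ x y = +≤+ (∣i+j∣≤∣i∣+∣j∣ x y)

  scale-abs : ∀ {k} → 0ℤ ≤ k → ∀ x → abs (k * x) ≡ k * abs x
  scale-abs {+ m} _ x = trans (cong +_ (∣∣-* (+ m) x)) (pos-* m ∣ x ∣)

  sq±-nonneg : ∀ {x} → 0ℤ ≤ x → sq± x ≡ x * x
  sq±-nonneg {+ n} _ = refl

  sq±-neg : ∀ {x} → 0ℤ < - x → sq± x ≡ - (x * x)
  sq±-neg { -[1+ n ] } _ = refl
  sq±-neg {+ ℕ.zero} (+<+ ())

  _⊖_ : Vertex → Vertex → Vertex
  (a , b , c) ⊖ (x , y , z) = a - x , b - y , c - z

  nrm : Vertex → ℤ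
  nrm v = + norm1 v

  cauchy : ∀ p q r → (p + q + r) * (p + q + r) ≤ + 3 * (p * p + q * q + r * r)
  cauchy p q r = by≤ (0≤+ (0≤+ (0≤sq (p - q)) (0≤sq (q - r))) (0≤sq (p - r))) (lem p q r)
    where lem : ∀ p q r → + 3 * (p * p + q * q + r * r) ≡ (p + q + r) * (p + q + r) + ((p - q) * (p - q) + (q - r) * (q - r) + (p - r) * (p - r))
          lem = solve-∀

  -- Together with `dot≤nrm²` this places |v|² between n²/3 and n² when `norm1 v ≡ n`, so squared
  -- Euclidean lengths of vertices agree up to a factor 3.
  nrm²≤ : ∀ v → (nrm v) * (nrm v) ≤ + 3 * dot v v
  nrm²≤ (a , b , c) = subst (λ s → (nrm (a , b , c)) * (nrm (a , b , c)) ≤ + 3 * s)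
    (cong₂ _+_ (cong₂ _+_ (abs² a) (abs² b)) (abs² c)) (cauchy (abs a) (abs b) (abs c))

  dot≤nrm² : ∀ v → dot v v ≤ (nrm v) * (nrm v)
  dot≤nrm² (a , b , c) = subst (_≤ (nrm (a , b , c)) * (nrm (a , b , c)))
    (cong₂ _+_ (cong₂ _+_ (abs² a) (abs² b)) (abs² c))
    (by≤ (0≤* {+ 2} 0≤+n (0≤+ (0≤+ (0≤* {(abs a)} {(abs b)} 0≤+n 0≤+n) (0≤* {(abs a)} {(abs c)} 0≤+n 0≤+n)) (0≤* {(abs b)} {(abs c)} 0≤+n 0≤+n))) (lem (abs a) (abs b) (abs c)))
    where lem : ∀ p q r → (p + q + r) * (p + q + r) ≡ (p * p + q * q + r * r) + + 2 * (p * q + p * r + q * r)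
          lem = solve-∀

  0≤dot : ∀ v → 0ℤ ≤ dot v v
  0≤dot (a , b , c) = 0≤+ (0≤+ (0≤sq a) (0≤sq b)) (0≤sq c)

  0<dot : ∀ v → 1 ℕ.≤ norm1 v → 0ℤ < dot v v
  0<dot v p = cancel< {+ 3} 0≤+n (<-≤-trans (0<* {(nrm v)} {(nrm v)} (+<+ p) (+<+ p)) (nrm²≤ v))

  nrm-⊖≤ : ∀ v t → (nrm (v ⊖ t)) ≤ (nrm v) + (nrm t)
  nrm-⊖≤ (a , b , c) (x , y , z) = ≤-trans
    (+-mono-≤ (+-mono-≤ (+≤+ (∣i-j∣≤∣i∣+∣j∣ a x)) (+≤+ (∣i-j∣≤∣i∣+∣j∣ b y))) (+≤+ (∣i-j∣≤∣i∣+∣j∣ c z)))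
    (≤-reflexive (lem (abs a) (abs b) (abs c) (abs x) (abs y) (abs z)))
    where lem : ∀ a b c x y z → (a + x) + (b + y) + (c + z) ≡ (a + b + c) + (x + y + z)
          lem = solve-∀

  dot-⊖ : ∀ u t → dot (u ⊖ t) (u ⊖ t) ≡ dot u u + dot t t - + 2 * dot u t
  dot-⊖ (a , b , c) (x , y , z) = lem a b c x y z
    where lem : ∀ a b c x y z → (a - x) * (a - x) + (b - y) * (b - y) + (c - z) * (c - z) ≡
                   (a * a + b * b + c * c) + (x * x + y * y + z * z) - + 2 * (a * x + b * y + c * z)
          lem = solve-∀

  -- e = τ v - δ t is the component of τ v orthogonal to t; comparing the l¹ norms of
  -- τ v, δ t and e bounds |τ - δ| and hence v - t by e.
  sin-lower : ∀ {n} v t → norm1 v ≡ n → norm1 t ≡ n → 1 ℕ.≤ n → 0ℤ ≤ dot v t →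
    dot t t * ((nrm (v ⊖ t)) * (nrm (v ⊖ t))) ≤ + 12 * (dot v v * dot t t - dot v t * dot v t)
  sin-lower {n} v@(a , b , c) t@(x , y , z) nv nt 1≤n 0≤δ = cancel≤ 0<τ (begin
      τ * (τ * (N * N))       ≡⟨ lem₁ τ N ⟩
      (τ * N) * (τ * N)       ≤⟨ sq≤sq (0≤* 0≤τ 0≤+n) τN≤2E ⟩
      (E + E) * (E + E)       ≡⟨ lem₂ E ⟩
      -- The constant 12 arises here: 4 from squaring `τN≤2E`, 3 from returning to the Euclidean
      -- norm.
      + 4 * (E * E)           ≤⟨ *≤ {+ 4} 0≤+n (nrm²≤ (e a x , e b y , e c z)) ⟩
      + 4 * (+ 3 * dot (e a x , e b y , e c z) (e a x , e b y , e c z))  ≡⟨ cong (λ s → + 4 * (+ 3 * s)) (lem₃ a b c x y z τ δ) ⟩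
      + 4 * (+ 3 * (τ * τ * dot v v - + 2 * τ * δ * dot v t + δ * δ * dot t t)) ≡⟨ lem₄ τ δ (dot v v) ⟩
      τ * (+ 12 * (dot v v * τ - δ * δ)) ∎)
    where
    open ≤-Reasoning
    τ = dot t t
    δ = dot v t
    N = (nrm (v ⊖ t))
    0≤τ = 0≤dot t
    0<τ = 0<dot t (subst (1 ℕ.≤_) (sym nt) 1≤n)
    e : ℤ → ℤ → ℤ
    e p q = τ * p - δ * q
    E = (nrm (e a x , e b y , e c z))
    nt′ : nrm t ≡ + n
    nt′ = cong +_ nt
    lem₁ : ∀ τ N → τ * (τ * (N * N)) ≡ (τ * N) * (τ * N)
    lem₁ = solve-∀
    lem₂ : ∀ E → (E + E) * (E + E) ≡ + 4 * (E * E)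
    lem₂ = solve-∀
    lem₃ : ∀ a b c x y z τ δ → (τ * a - δ * x) * (τ * a - δ * x) + (τ * b - δ * y) * (τ * b - δ * y) + (τ * c - δ * z) * (τ * c - δ * z) ≡
      τ * τ * (a * a + b * b + c * c) - + 2 * τ * δ * (a * x + b * y + c * z) + δ * δ * (x * x + y * y + z * z)
    lem₃ = solve-∀
    lem₄ : ∀ τ δ W → + 4 * (+ 3 * (τ * τ * W - + 2 * τ * δ * δ + δ * δ * τ)) ≡ τ * (+ 12 * (W * τ - δ * δ))
    lem₄ = solve-∀
    gather : ∀ k l a b x y z → (k + l * x) + (a + l * y) + (b + l * z) ≡ (k + a + b) + l * (x + y + z)
    gather = solve-∀
    split₁ : ∀ τ δ p q → τ * p ≡ (τ * p - δ * q) + δ * q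
    split₁ = solve-∀
    split₂ : ∀ τ δ p q → δ * q ≡ - (τ * p - δ * q) + τ * p
    split₂ = solve-∀
    split₃ : ∀ τ δ p q → τ * (p - q) ≡ (τ * p - δ * q) + (δ - τ) * q
    split₃ = solve-∀
    neg-abs : ∀ p → abs (- p) ≡ abs p
    neg-abs p = cong +_ (∣-i∣≡∣i∣ p)
    c₁ : ∀ p q → τ * abs p ≤ abs (e p q) + δ * abs q
    c₁ p q = subst₂ (λ l r → l ≤ (abs (e p q)) + r) (trans (cong abs (sym (split₁ τ δ p q))) (scale-abs 0≤τ p)) (scale-abs 0≤δ q) (abs-+ (e p q) (δ * q))
    c₂ : ∀ p q → δ * abs q ≤ abs (e p q) + τ * abs p
    c₂ p q = subst₂ _≤_ (trans (cong abs (sym (split₂ τ δ p q))) (scale-abs 0≤δ q)) (cong₂ _+_ (neg-abs (e p q)) (scale-abs 0≤τ p)) (abs-+ (- e p q) (τ * p))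
    c₃ : ∀ p q → τ * abs (p - q) ≤ abs (e p q) + abs (δ - τ) * abs q
    c₃ p q = subst₂ (λ l r → l ≤ (abs (e p q)) + r) (trans (cong abs (sym (split₃ τ δ p q))) (scale-abs 0≤τ (p - q)))
      (trans (cong +_ (∣∣-* (δ - τ) q)) (pos-* ∣ δ - τ ∣ ∣ q ∣)) (abs-+ (e p q) ((δ - τ) * q))
    distr : ∀ k a b c → k * a + k * b + k * c ≡ k * (a + b + c)
    distr = solve-∀
    sum≤ : ∀ {k l} {f : ℤ → ℤ → ℤ} {h : ℤ → ℤ → ℤ} → (∀ p q → k * abs (f p q) ≤ abs (e p q) + l * abs (h p q)) →
      k * ((abs (f a x)) + (abs (f b y)) + (abs (f c z))) ≤ E + l * ((abs (h a x)) + (abs (h b y)) + (abs (h c z)))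
    sum≤ {k} {l} {f} {h} hyp = subst₂ _≤_ (distr k (abs (f a x)) (abs (f b y)) (abs (f c z)))
       (gather (abs (e a x)) l (abs (e b y)) (abs (e c z)) (abs (h a x)) (abs (h b y)) (abs (h c z)))
       (+-mono-≤ (+-mono-≤ (hyp a x) (hyp b y)) (hyp c z))
    τn≤ : τ * + n ≤ E + δ * + n
    τn≤ = subst₂ (λ l r → τ * l ≤ E + δ * r) (cong +_ nv) nt′ (sum≤ {τ} {δ} {λ p q → p} {λ p q → q} c₁)
    δn≤ : δ * + n ≤ E + τ * + n
    δn≤ = subst₂ (λ l r → δ * l ≤ E + τ * r) nt′ (cong +_ nv) (sum≤ {δ} {τ} {λ p q → q} {λ p q → p} c₂)
    rearr : ∀ k l E m → k * m ≤ E + l * m → (k - l) * m ≤ E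
    rearr k l E m le = subst₂ _≤_ (r₁ k l m) (r₂ E l m) (+-monoˡ-≤ (- (l * m)) le)
      where r₁ : ∀ k l m → k * m + - (l * m) ≡ (k - l) * m
            r₁ = solve-∀
            r₂ : ∀ E l m → E + l * m + - (l * m) ≡ E
            r₂ = solve-∀
    diff≤ : (abs (δ - τ)) * + n ≤ E
    diff≤ with 0≤-cases (δ - τ)
    ... | inj₁ p = subst (λ s → s * + n ≤ E) (sym (0≤i⇒+∣i∣≡i p)) (rearr δ τ E (+ n) δn≤)
    ... | inj₂ p = subst (λ s → s * + n ≤ E) (trans (sym (0≤i⇒+∣i∣≡i (<⇒≤ (subst (0ℤ <_) (neg-diff δ τ) p)))) (trans (cong abs (sym (neg-diff δ τ))) (neg-abs (δ - τ)))) (rearr τ δ E (+ n) τn≤)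
      where neg-diff : ∀ δ τ → - (δ - τ) ≡ τ - δ
            neg-diff = solve-∀
    τN≤2E : τ * N ≤ E + E
    τN≤2E = ≤-trans (subst (λ r → τ * N ≤ E + abs (δ - τ) * r) nt′ (sum≤ {τ} {abs (δ - τ)} {λ p q → p - q} {λ p q → q} c₃)) (+-monoʳ-≤ E diff≤)

  -- Divided by t·t, the left-hand side is the squared Euclidean distance from u to the line through
  -- t, hence at most |u - t|².
  sin-upper : ∀ u t → dot u u * dot t t - dot u t * dot u t ≤ dot t t * ((nrm (u ⊖ t)) * (nrm (u ⊖ t)))
  sin-upper u t = ≤-trans (by≤ (0≤sq (dot t t - dot u t)) (trans (cong (dot t t *_) (dot-⊖ u t)) (lem (dot u u) (dot t t) (dot u t)))) (*≤ (0≤dot t) (dot≤nrm² (u ⊖ t)))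
    where lem : ∀ U τ β → τ * (U + τ - + 2 * β) ≡ (U * τ - β * β) + (τ - β) * (τ - β)
          lem = solve-∀

  -- If u·t ≥ 0, the hypothesis compares squared sines, and 36 = 12 · 3 combines `sin-lower` with
  -- |v|² ≤ 3|u|². If u·t < 0, then u is already far away, since |u - t|² exceeds |u|² + |t|², while
  -- v is within 2n of t in any case.
  cosGE⇒near : ∀ {n} u v t → norm1 u ≡ n → norm1 v ≡ n → norm1 t ≡ n → 1 ℕ.≤ n →
    CosGE t v u → norm1 (v ⊖ t) ℕ.≤ 6 ℕ.* norm1 (u ⊖ t)
  cosGE⇒near {n} u v t nu nv nt 1≤n ge = drop‿+≤+ (subst (Nv ≤_) (sym (pos-* 6 (norm1 (u ⊖ t)))) (sq≤sq⁻¹ 0≤+n (0≤* {+ 6} {Nu} 0≤+n 0≤+n) (main (0≤-cases β))))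
    where
    open ≤-Reasoning
    U = dot u u
    W = dot v v
    τ = dot t t
    β = dot u t
    δ = dot v t
    Nu = (nrm (u ⊖ t))
    Nv = (nrm (v ⊖ t))
    0<U = 0<dot u (subst (1 ℕ.≤_) (sym nu) 1≤n)
    0<τ = 0<dot t (subst (1 ℕ.≤_) (sym nt) 1≤n)
    n² = + n * + n
    n²≤3U : n² ≤ + 3 * U
    n²≤3U = subst (λ m → + m * + m ≤ + 3 * U) nu (nrm²≤ u)
    n²≤3τ : n² ≤ + 3 * τ
    n²≤3τ = subst (λ m → + m * + m ≤ + 3 * τ) nt (nrm²≤ t)
    W≤n² : W ≤ n²
    W≤n² = subst (λ m → W ≤ + m * + m) nv (dot≤nrm² v)
    main : (0ℤ ≤ β) ⊎ (0ℤ < - β) → Nv * Nv ≤ (+ 6 * Nu) * (+ 6 * Nu)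
    main (inj₁ 0≤β) = cancel≤ 0<U (cancel≤ 0<τ (begin
        τ * (U * (Nv * Nv))               ≡⟨ l₁ τ U (Nv * Nv) ⟩
        U * (τ * (Nv * Nv))               ≤⟨ *≤ (<⇒≤ 0<U) (sin-lower v t nv nt 1≤n 0≤δ) ⟩
        U * (+ 12 * (W * τ - δ * δ))      ≡⟨ l₂ U W τ (δ * δ) ⟩
        + 12 * (U * W * τ - δ * δ * U)    ≤⟨ *≤ {+ 12} 0≤+n (+-monoʳ-≤ (U * W * τ) (neg-mono-≤ β²W≤)) ⟩
        + 12 * (U * W * τ - β * β * W)    ≡⟨ l₃ U W τ (β * β) ⟩
        (+ 12 * W) * (U * τ - β * β)      ≤⟨ *≤ (0≤* {+ 12} 0≤+n (0≤dot v)) (sin-upper u t) ⟩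
        (+ 12 * W) * (τ * (Nu * Nu))      ≡⟨ l₄ W τ Nu ⟩
        (τ * + 12 * (Nu * Nu)) * W        ≤⟨ *≤ (0≤* (0≤* (<⇒≤ 0<τ) (0≤+n {12})) (0≤sq Nu)) (≤-trans W≤n² n²≤3U) ⟩
        (τ * + 12 * (Nu * Nu)) * (+ 3 * U) ≡⟨ l₅ τ U Nu ⟩
        τ * (U * ((+ 6 * Nu) * (+ 6 * Nu))) ∎))
      where
      l₁ : ∀ a b c → a * (b * c) ≡ b * (a * c)
      l₁ = solve-∀
      l₂ : ∀ U W τ d → U * (+ 12 * (W * τ - d)) ≡ + 12 * (U * W * τ - d * U)
      l₂ = solve-∀
      l₃ : ∀ U W τ d → + 12 * (U * W * τ - d * W) ≡ (+ 12 * W) * (U * τ - d)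
      l₃ = solve-∀
      l₄ : ∀ W τ N → (+ 12 * W) * (τ * (N * N)) ≡ (τ * + 12 * (N * N)) * W
      l₄ = solve-∀
      l₅ : ∀ τ U N → (τ * + 12 * (N * N)) * (+ 3 * U) ≡ τ * (U * ((+ 6 * N) * (+ 6 * N)))
      l₅ = solve-∀
      ge′ : β * β * W ≤ sq± δ * U
      ge′ = subst (λ s → s * W ≤ sq± δ * U) (sq±-nonneg 0≤β) ge
      0≤δ : 0ℤ ≤ δ
      0≤δ with 0≤-cases δ
      ... | inj₁ p = p
      ... | inj₂ q = ⊥-elim (<-irrefl refl (≤-<-trans (0≤* (0≤sq β) (0≤dot v)) (≤-<-trans (subst (λ s → β * β * W ≤ s * U) (sq±-neg q) ge′)
             (by< {e = (- δ) * (- δ) * U} (0<* (0<* q q) 0<U) (l δ U)))))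
        where l : ∀ δ U → 0ℤ ≡ - (δ * δ) * U + (- δ) * (- δ) * U
              l = solve-∀
      β²W≤ : β * β * W ≤ δ * δ * U
      β²W≤ = subst (λ s → β * β * W ≤ s * U) (sq±-nonneg 0≤δ) ge′
    main (inj₂ 0<-β) = begin
        Nv * Nv              ≤⟨ sq≤sq 0≤+n (subst₂ (λ p q → Nv ≤ + p + + q) nv nt (nrm-⊖≤ v t)) ⟩
        (+ n + + n) * (+ n + + n)  ≡⟨ l₁ (+ n) ⟩
        + 2 * n² + + 2 * n²   ≤⟨ +-mono-≤ (*≤ {+ 2} 0≤+n n²≤3U) (*≤ {+ 2} 0≤+n n²≤3τ) ⟩
        + 2 * (+ 3 * U) + + 2 * (+ 3 * τ) ≤⟨ by≤ (0≤+ (0≤* {+ 30} 0≤+n (0≤+ (<⇒≤ 0<U) (<⇒≤ 0<τ))) (0≤* {+ 72} 0≤+n (<⇒≤ 0<-β))) (l₂ U τ β) ⟩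
        + 36 * (U + τ - + 2 * β) ≡⟨ cong (+ 36 *_) (sym (dot-⊖ u t)) ⟩
        + 36 * dot (u ⊖ t) (u ⊖ t)  ≤⟨ *≤ {+ 36} 0≤+n (dot≤nrm² (u ⊖ t)) ⟩
        + 36 * (Nu * Nu)       ≡⟨ l₃ Nu ⟩
        (+ 6 * Nu) * (+ 6 * Nu) ∎
      where
      l₁ : ∀ n → (n + n) * (n + n) ≡ + 2 * (n * n) + + 2 * (n * n)
      l₁ = solve-∀
      l₂ : ∀ U τ β → + 36 * (U + τ - + 2 * β) ≡ (+ 2 * (+ 3 * U) + + 2 * (+ 3 * τ)) + (+ 30 * (U + τ) + + 72 * (- β))
      l₂ = solve-∀
      l₃ : ∀ N → + 36 * (N * N) ≡ (+ 6 * N) * (+ 6 * N)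
      l₃ = solve-∀

-- Existence of a neighbour strictly closer in angle.

module Improvement where
  open import Defs
  open IntegerOrder
  open Angles
  import Data.Nat as ℕ
  import Data.Nat.Properties as ℕ
  open import Data.Integer hiding (_⊖_)
  open import Data.Integer.Properties renaming (abs-* to ∣∣-*)
  open import Data.Integer.Tactic.RingSolver
  open import Data.Product using (Σ; _×_; _,_; proj₁; proj₂)
  open import Data.Sum using (_⊎_; inj₁; inj₂)
  open import Data.Empty using (⊥-elim)
  open import Relation.Nullary using (¬_)
  open import Relation.Binary using (tri<; tri≈; tri>)
  open import Relation.Binary.PropositionalEquality

  -- The strict counterpart of `CosGE`, equivalent to the failure of `CosGE t u v`.
  Better : Vertex → Vertex → Vertex → Set
  Better t v u = sq± (dot u t) * dot v v < sq± (dot v t) * dot u u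

  -- AM-GM: (W + U)² ≥ 4UW replaces the comparison with √(W/U) by a linear one.
  better-acute : ∀ u v t → 0ℤ < dot u u → 0ℤ ≤ dot u t →
    (dot v v + dot u u) * dot u t < + 2 * (dot v t * dot u u) → Better t v u
  better-acute u v t 0<U 0≤β lt = subst₂ (λ p q → p * W < q * U) (sym (sq±-nonneg 0≤β)) (sym (sq±-nonneg (<⇒≤ 0<δ)))
    (cancel< {+ 4 * U} (<⇒≤ (0<* {+ 4} (+<+ (ℕ.s≤s ℕ.z≤n)) 0<U)) (begin-strict
       + 4 * U * (β * β * W)                ≤⟨ by≤ (0≤sq ((W - U) * β)) (l₁ U W β) ⟩
       ((W + U) * β) * ((W + U) * β)        <⟨ sq<sq 0≤l lt ⟩
       (+ 2 * (δ * U)) * (+ 2 * (δ * U))    ≡⟨ l₂ U δ ⟩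
       + 4 * U * (δ * δ * U) ∎))
    where
    open ≤-Reasoning
    U = dot u u
    W = dot v v
    β = dot u t
    δ = dot v t
    0≤l : 0ℤ ≤ (W + U) * β
    0≤l = 0≤* (0≤+ (0≤dot v) (0≤dot u)) 0≤β
    0<δ : 0ℤ < δ
    0<δ = cancel< {+ 2 * U} (<⇒≤ (0<* {+ 2} (+<+ (ℕ.s≤s ℕ.z≤n)) 0<U)) (subst₂ _<_ (sym (*-zeroʳ (+ 2 * U))) (l U δ) (≤-<-trans 0≤l lt))
      where l : ∀ U δ → + 2 * (δ * U) ≡ + 2 * U * δ
            l = solve-∀
    l₁ : ∀ U W β → ((W + U) * β) * ((W + U) * β) ≡ + 4 * U * (β * β * W) + ((W - U) * β) * ((W - U) * β)
    l₁ = solve-∀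
    l₂ : ∀ U δ → (+ 2 * (δ * U)) * (+ 2 * (δ * U)) ≡ + 4 * U * (δ * δ * U)
    l₂ = solve-∀

  -- The first inequality says that v lies on the t-side of u; past a right angle this suffices,
  -- because the angle to -t is quasi-convex.
  better-obtuse : ∀ u v t → 0ℤ < dot u u → 0ℤ < dot v v → 0ℤ < - dot u t →
    dot u t * dot u v ≤ dot v t * dot u u → dot u v * dot u v < dot u u * dot v v → Better t v u
  better-obtuse u v t 0<U 0<W 0<b le cs with 0≤-cases (dot v t)
  ... | inj₁ 0≤δ = subst₂ (λ p q → p * dot v v < q * dot u u) (sym (sq±-neg 0<b)) (sym (sq±-nonneg 0≤δ))
        (by< (0<+ (0<* (0<* 0<b 0<b) 0<W) (0≤* (0≤sq (dot v t)) (<⇒≤ 0<U))) (l (dot u t) (dot v t) (dot u u) (dot v v)))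
    where l : ∀ β δ U W → δ * δ * U ≡ - (β * β) * W + ((- β) * (- β) * W + δ * δ * U)
          l = solve-∀
  ... | inj₂ 0<g = subst₂ (λ p q → p * W < q * U) (sym (sq±-neg 0<b)) (sym (sq±-neg 0<g))
        (subst₂ _<_ (l₁ β W) (l₁ δ U) (neg-mono-< main))
    where
    open ≤-Reasoning
    U = dot u u
    W = dot v v
    β = dot u t
    δ = dot v t
    b = - β
    g = - δ
    κ = dot u v
    l₁ : ∀ β W → - ((- β) * (- β) * W) ≡ - (β * β) * W
    l₁ = solve-∀
    le′ : g * U ≤ b * κ
    le′ = by≤ (≤⇒0≤ le) (l β δ U κ)
      where l : ∀ β δ U κ → - β * κ ≡ - δ * U + (δ * U - β * κ)
            l = solve-∀
    main : g * g * U < b * b * W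
    main = cancel< (<⇒≤ 0<U) (begin-strict
      U * (g * g * U)     ≡⟨ l₃ U g ⟩
      (g * U) * (g * U)   ≤⟨ sq≤sq (0≤* (<⇒≤ 0<g) (<⇒≤ 0<U)) le′ ⟩
      (b * κ) * (b * κ)   ≡⟨ l₄ b κ ⟩
      b * b * (κ * κ)     <⟨ *< (0<* 0<b 0<b) cs ⟩
      b * b * (U * W)     ≡⟨ l₅ b U W ⟩
      U * (b * b * W) ∎)
      where
      l₃ : ∀ U g → U * (g * g * U) ≡ (g * U) * (g * U)
      l₃ = solve-∀
      l₄ : ∀ b κ → (b * κ) * (b * κ) ≡ b * b * (κ * κ)
      l₄ = solve-∀
      l₅ : ∀ b U W → b * b * (U * W) ≡ U * (b * b * W)
      l₅ = solve-∀

  -- Symmetries of the octahedron.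

  record Isometry (f : Vertex → Vertex) : Set where
    field
      involutive : ∀ u → f (f u) ≡ u
      norm-pres  : ∀ u → norm1 (f u) ≡ norm1 u
      dot-pres   : ∀ u v → dot (f u) (f v) ≡ dot u v
      adj-pres   : ∀ u v → Adj u v → Adj (f u) (f v)

  Improvable : Vertex → Vertex → Set
  Improvable t u = Σ Vertex λ v → norm1 v ≡ norm1 u × Adj u v × Better t v u

  -- Sign changes and transpositions are their own inverses, so a neighbour found for the images is
  -- brought back by the same map.
  transport : ∀ {f} → Isometry f → ∀ t u → Improvable (f t) (f u) → Improvable t u
  transport {f} iso t u (v , nv , adj , bet) = f v , trans (norm-pres v) (trans nv (norm-pres u)) ,
      subst (λ w → Adj w (f v)) (involutive u) (adj-pres (f u) v adj) ,
      subst₂ _<_ (cong₂ (λ p q → sq± p * q) (dot-pres u t) (sym (dot-pres v v)))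
                 (cong₂ (λ p q → sq± p * q) (trans (cong (λ w → dot w (f t)) (sym (involutive v))) (dot-pres (f v) t)) (dot-pres u u)) bet
    where open Isometry iso

  neg₁ neg₂ neg₃ swap₁₂ swap₂₃ : Vertex → Vertex
  neg₁ (a , b , c) = - a , b , c
  neg₂ (a , b , c) = a , - b , c
  neg₃ (a , b , c) = a , b , - c
  swap₁₂ (a , b , c) = b , a , c
  swap₂₃ (a , b , c) = a , c , b

  ≢-inv : ∀ {f : Vertex → Vertex} → (∀ u → f (f u) ≡ u) → ∀ {u v} → ¬ u ≡ v → ¬ f u ≡ f v
  ≢-inv {f} invo u≢v eq = u≢v (trans (sym (invo _)) (trans (cong f eq) (invo _)))

  ∣neg-neg∣ : ∀ a d → ∣ - a - - d ∣ ≡ ∣ a - d ∣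
  ∣neg-neg∣ a d = trans (cong ∣_∣ (l a d)) (∣-i∣≡∣i∣ (a - d))
    where l : ∀ a d → - a - - d ≡ - (a - d)
          l = solve-∀

  neg*neg : ∀ a d → - a * - d ≡ a * d
  neg*neg = solve-∀

  neg₁-iso : Isometry neg₁
  neg₁-iso = record
    { involutive = invo
    ; norm-pres = λ { (a , b , c) → cong (λ k → k ℕ.+ ∣ b ∣ ℕ.+ ∣ c ∣) (∣-i∣≡∣i∣ a) }
    ; dot-pres = λ { (a , b , c) (d , e , f) → cong (λ k → k + b * e + c * f) (neg*neg a d) }
    ; adj-pres = λ { u@(a , b , c) v@(d , e , f) (ne , p , q , r) → ≢-inv invo {u} {v} ne , subst (ℕ._≤ 1) (sym (∣neg-neg∣ a d)) p , q , r } }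
    where invo : ∀ u → neg₁ (neg₁ u) ≡ u
          invo (a , b , c) = cong (_, b , c) (neg-involutive a)

  neg₂-iso : Isometry neg₂
  neg₂-iso = record
    { involutive = invo
    ; norm-pres = λ { (a , b , c) → cong (λ k → ∣ a ∣ ℕ.+ k ℕ.+ ∣ c ∣) (∣-i∣≡∣i∣ b) }
    ; dot-pres = λ { (a , b , c) (d , e , f) → cong (λ k → a * d + k + c * f) (neg*neg b e) }
    ; adj-pres = λ { u@(a , b , c) v@(d , e , f) (ne , p , q , r) → ≢-inv invo {u} {v} ne , p , subst (ℕ._≤ 1) (sym (∣neg-neg∣ b e)) q , r } }
    where invo : ∀ u → neg₂ (neg₂ u) ≡ u
          invo (a , b , c) = cong (λ k → a , k , c) (neg-involutive b)

  neg₃-iso : Isometry neg₃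
  neg₃-iso = record
    { involutive = invo
    ; norm-pres = λ { (a , b , c) → cong (λ k → ∣ a ∣ ℕ.+ ∣ b ∣ ℕ.+ k) (∣-i∣≡∣i∣ c) }
    ; dot-pres = λ { (a , b , c) (d , e , f) → cong (λ k → a * d + b * e + k) (neg*neg c f) }
    ; adj-pres = λ { u@(a , b , c) v@(d , e , f) (ne , p , q , r) → ≢-inv invo {u} {v} ne , p , q , subst (ℕ._≤ 1) (sym (∣neg-neg∣ c f)) r } }
    where invo : ∀ u → neg₃ (neg₃ u) ≡ u
          invo (a , b , c) = cong (λ k → a , b , k) (neg-involutive c)

  swap₁₂-iso : Isometry swap₁₂
  swap₁₂-iso = record
    { involutive = λ _ → refl
    ; norm-pres = λ { (a , b , c) → cong (ℕ._+ ∣ c ∣) (ℕ.+-comm ∣ b ∣ ∣ a ∣) }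
    ; dot-pres = λ { (a , b , c) (d , e , f) → cong (_+ c * f) (+-comm (b * e) (a * d)) }
    ; adj-pres = λ { u@(a , b , c) v@(d , e , f) (ne , p , q , r) → ≢-inv {swap₁₂} (λ _ → refl) {u} {v} ne , q , p , r } }

  swap₂₃-iso : Isometry swap₂₃
  swap₂₃-iso = record
    { involutive = λ _ → refl
    ; norm-pres = λ { (a , b , c) → trans (ℕ.+-assoc (∣ a ∣) (∣ c ∣) (∣ b ∣)) (trans (cong (∣ a ∣ ℕ.+_) (ℕ.+-comm ∣ c ∣ ∣ b ∣)) (sym (ℕ.+-assoc (∣ a ∣) (∣ b ∣) (∣ c ∣)))) }
    ; dot-pres = λ { (a , b , c) (d , e , f) → trans (+-assoc (a * d) (c * f) (b * e)) (trans (cong (_+_ (a * d)) (+-comm (c * f) (b * e))) (sym (+-assoc (a * d) (b * e) (c * f)))) }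
    ; adj-pres = λ { u@(a , b , c) v@(d , e , f) (ne , p , q , r) → ≢-inv {swap₂₃} (λ _ → refl) {u} {v} ne , p , r , q } }

  -- Single transfers that decrease the angle.

  ∣i-i∣≤1 : ∀ i → ∣ i - i ∣ ℕ.≤ 1
  ∣i-i∣≤1 i = subst (λ k → ∣ k ∣ ℕ.≤ 1) (sym (+-inverseʳ i)) ℕ.z≤n

  ∣up∣≤1 : ∀ k → ∣ + k - + ℕ.suc k ∣ ℕ.≤ 1
  ∣up∣≤1 k = ℕ.≤-reflexive (cong ∣_∣ (l (+ k)))
    where l : ∀ k → k - (+ 1 + k) ≡ -1ℤ
          l = solve-∀

  ∣down∣≤1 : ∀ k → ∣ + ℕ.suc k - + k ∣ ℕ.≤ 1
  ∣down∣≤1 k = ℕ.≤-reflexive (cong ∣_∣ (l (+ k)))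
    where l : ∀ k → (+ 1 + k) - k ≡ 1ℤ
          l = solve-∀

  adj-move : ∀ a b c → Adj (+ a , + ℕ.suc b , + c) (+ ℕ.suc a , + b , + c)
  adj-move a b c = (λ eq → ℕ.1+n≢n (sym (+-injective (cong proj₁ eq)))) , ∣up∣≤1 a , ∣down∣≤1 b , ∣i-i∣≤1 (+ c)

  norm-move : ∀ a b c → norm1 (+ ℕ.suc a , + b , + c) ≡ norm1 (+ a , + ℕ.suc b , + c)
  norm-move a b c = cong (ℕ._+ c) (sym (ℕ.+-suc a b))

  -- A move (+1, -1, 0) within the octant: with h = a - (b + 1) and γ = x - y, this is the linear
  -- criterion (h + 1)(u·t) < γ|u|² behind better-acute.
  move-acute : ∀ a b c t → 0ℤ ≤ dot (+ a , + ℕ.suc b , + c) t →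
    let u = (+ a , + ℕ.suc b , + c) in
    (+ a - + b) * dot u t < (proj₁ t - proj₁ (proj₂ t)) * dot u u → Improvable t u
  move-acute a b c t@(x , y , z) 0≤β lt = v , norm-move a b c , adj-move a b c ,
      better-acute u v t (0<dot u (subst (1 ℕ.≤_) (norm-move a b c) (ℕ.s≤s ℕ.z≤n))) 0≤β
        (by< (0<* {+ 2} (+<+ (ℕ.s≤s ℕ.z≤n)) (<⇒0< lt)) (l (+ a) (+ b) (+ c) x y z))
    where
    u v : Vertex
    u = (+ a , + ℕ.suc b , + c)
    v = (+ ℕ.suc a , + b , + c)
    W≡ : ∀ a b c → (+ 1 + a) * (+ 1 + a) + b * b + c * c ≡ (a * a + (+ 1 + b) * (+ 1 + b) + c * c) + + 2 * (a - b)
    W≡ = solve-∀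
    δ≡ : ∀ a b c x y z → (+ 1 + a) * x + b * y + c * z ≡ (a * x + (+ 1 + b) * y + c * z) + (x - y)
    δ≡ = solve-∀
    scal : ∀ U β h γ → + 2 * ((β + γ) * U) ≡ (U + + 2 * h + U) * β + + 2 * (γ * U - h * β)
    scal = solve-∀
    l : ∀ a b c x y z → let U = a * a + (+ 1 + b) * (+ 1 + b) + c * c ; β = a * x + (+ 1 + b) * y + c * z in
        + 2 * (((+ 1 + a) * x + b * y + c * z) * U) ≡ ((+ 1 + a) * (+ 1 + a) + b * b + c * c + U) * β + + 2 * ((x - y) * U - (a - b) * β)
    l a b c x y z = subst₂ (λ δ W → + 2 * (δ * U) ≡ (W + U) * β + + 2 * ((x - y) * U - (a - b) * β)) (sym (δ≡ a b c x y z)) (sym (W≡ a b c)) (scal U β (a - b) (x - y))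
      where U = a * a + (+ 1 + b) * (+ 1 + b) + c * c
            β = a * x + (+ 1 + b) * y + c * z

  -- The unit goes from a coordinate in excess to one in deficit. Splitting on the sign of z - c
  -- lets t be expressed through u and nonnegative parameters p and q, for which the criterion of
  -- `move-acute` has an explicit certificate.
  same-octant : ∀ a b c x y z → a ℕ.< x → y ℕ.< b → a ℕ.+ b ℕ.+ c ≡ x ℕ.+ y ℕ.+ z →
    Improvable (+ x , + y , + z) (+ a , + b , + c)
  same-octant a (ℕ.suc b) c x y z a<x y<b eq = move-acute a b c (+ x , + y , + z) (0≤+ (0≤+ (0≤* {+ a} {+ x} 0≤+n 0≤+n) (0≤* {+ ℕ.suc b} {+ y} 0≤+n 0≤+n)) (0≤* {+ c} {+ z} 0≤+n 0≤+n)) (main (0≤-cases (+ z - + c)))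
    where
    eqℤ : + a + (+ 1 + + b) + + c ≡ + x + + y + + z
    eqℤ = cong +_ eq
    -- In `poly₁`, p = x - a and q = z - c, and the second coordinate balances both; in `poly₂`, p
    -- is the excess of the second coordinate and q = c - z, balanced by the first. In both, p ≥ 1
    -- makes the middle summand of the certificate positive.
    poly₁ : ∀ a b c p q → let U = a * a + (+ 1 + b) * (+ 1 + b) + c * c in
      ((a + p) - ((+ 1 + b) - p - q)) * U ≡ (a - b) * (a * (a + p) + (+ 1 + b) * ((+ 1 + b) - p - q) + c * (c + q)) +
         ((p - + 1) * U + p * (+ 2 * (a * b) + + 1 + b + a + c * c) + q * (U - (a - b) * (c - (+ 1 + b))))
    poly₁ = solve-∀
    poly₂ : ∀ a b c p q → let U = a * a + (+ 1 + b) * (+ 1 + b) + c * c in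
      ((a + p + q) - ((+ 1 + b) - p)) * U ≡ (a - b) * (a * (a + p + q) + (+ 1 + b) * ((+ 1 + b) - p) + c * (c - q)) +
         ((p - + 1) * U + p * (+ 2 * (a * b) + + 1 + b + a + c * c) + q * (U - (a - b) * (a - c)))
    poly₂ = solve-∀
    -- Doubling exposes squares plus products of nonnegative numbers, which the undoubled factor of
    -- q hides.
    sq₁ : ∀ a b c → + 2 * ((a * a + (+ 1 + b) * (+ 1 + b) + c * c) - (a - b) * (c - (+ 1 + b))) ≡
          + 2 * + 0 + ((a - c) * (a - c) + a * a + c * c + + 2 * (a + a * b + b * c + + 1 + b))
    sq₁ = solve-∀
    sq₂ : ∀ a b c → + 2 * ((a * a + (+ 1 + b) * (+ 1 + b) + c * c) - (a - b) * (a - c)) ≡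
          + 2 * + 0 + ((b - c) * (b - c) + b * b + c * c + + 2 * (+ 1 + b + b + a * c + a * b))
    sq₂ = solve-∀
    ab : ∀ {m k} → 0ℤ ≤ + m * + k
    ab {m} {k} = 0≤* {+ m} {+ k} 0≤+n 0≤+n
    U = + a * + a + (+ 1 + + b) * (+ 1 + + b) + + c * + c
    0≤X₁ : 0ℤ ≤ U - (+ a - + b) * (+ c - (+ 1 + + b))
    0≤X₁ = cancel≤ {+ 2} (+<+ (ℕ.s≤s ℕ.z≤n)) (by≤ (0≤+ (0≤+ (0≤+ (0≤sq (+ a - + c)) (0≤sq (+ a))) (0≤sq (+ c)))
      (0≤* {+ 2} 0≤+n (0≤+ (0≤+ (0≤+ (0≤+ {+ a} 0≤+n (ab {a} {b})) (ab {b} {c})) (0≤+n {1})) (0≤+n {b})))) (sq₁ (+ a) (+ b) (+ c)))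
    0≤X₂ : 0ℤ ≤ U - (+ a - + b) * (+ a - + c)
    0≤X₂ = cancel≤ {+ 2} (+<+ (ℕ.s≤s ℕ.z≤n)) (by≤ (0≤+ (0≤+ (0≤+ (0≤sq (+ b - + c)) (0≤sq (+ b))) (0≤sq (+ c)))
      (0≤* {+ 2} 0≤+n (0≤+ (0≤+ (0≤+ (0≤+ {+ 1} 0≤+n (0≤+n {b})) (0≤+n {b})) (ab {a} {c})) (ab {a} {b})))) (sq₂ (+ a) (+ b) (+ c)))
    0≤U : 0ℤ ≤ U
    0≤U = 0≤+ (0≤+ (0≤sq (+ a)) (0≤sq (+ 1 + + b))) (0≤sq (+ c))
    0<Y : 0ℤ < + 2 * (+ a * + b) + + 1 + + b + + a + + c * + c
    0<Y = 0<+ (0<+ (0<+ (0≤+< (0≤* {+ 2} 0≤+n (ab {a} {b})) (+<+ (ℕ.s≤s ℕ.z≤n))) (0≤+n {b})) (0≤+n {a})) (0≤sq (+ c))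
    e₁ : ∀ x a → x ≡ a + (x - a)
    e₁ = solve-∀
    0<Q : ∀ {p q Y X} → 0ℤ < p → 0ℤ ≤ q → 0ℤ < Y → 0ℤ ≤ X → 0ℤ < (p - + 1) * U + p * Y + q * X
    0<Q {p} 0<p 0≤q 0<Y 0≤X = 0<+ (0≤+< (0≤* (≤⇒0≤ (i<j⇒suc[i]≤j 0<p)) 0≤U) (0<* 0<p 0<Y)) (0≤* 0≤q 0≤X)
    Goal : ℤ → ℤ → ℤ → Set
    Goal x y z = (+ a - + b) * (+ a * x + (+ 1 + + b) * y + + c * z) < (x - y) * U
    main : (0ℤ ≤ + z - + c) ⊎ (0ℤ < - (+ z - + c)) → Goal (+ x) (+ y) (+ z)
    main (inj₁ 0≤q) = subst (λ f → f (+ y)) (cong₂ (λ x z y → Goal x y z) (sym (e₁ (+ x) (+ a))) (sym (e₁ (+ z) (+ c))))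
        (subst (λ y → Goal (+ a + p) y (+ c + q)) (trans (l₁ (+ a) (+ b) (+ c) (+ x) (+ z)) (trans (cong (λ s → s - + x - + z) eqℤ) (l₂ (+ x) (+ y) (+ z))))
        (by< (0<Q {p} {q} (<⇒0< (+<+ a<x)) 0≤q 0<Y 0≤X₁) (poly₁ (+ a) (+ b) (+ c) p q)))
      where
      p = + x - + a
      q = + z - + c
      l₁ : ∀ a b c x z → (+ 1 + b) - (x - a) - (z - c) ≡ (a + (+ 1 + b) + c) - x - z
      l₁ = solve-∀
      l₂ : ∀ x y z → (x + y + z) - x - z ≡ y
      l₂ = solve-∀
    main (inj₂ 0<-q) = subst (λ f → f (+ x)) (cong₂ (λ y z x → Goal x y z) (l₃ (+ y) (+ b)) (l₄ (+ z) (+ c)))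
        (subst (λ x → Goal x ((+ 1 + + b) - p) (+ c - q)) (trans (l₁ (+ a) (+ b) (+ c) (+ y) (+ z)) (trans (cong (λ s → s - + y - + z) eqℤ) (l₂ (+ x) (+ y) (+ z))))
        (by< (0<Q {p} {q} (<⇒0< (+<+ y<b)) (<⇒≤ 0<-q) 0<Y 0≤X₂) (poly₂ (+ a) (+ b) (+ c) p q)))
      where
      p = (+ 1 + + b) - + y
      q = - (+ z - + c)
      l₁ : ∀ a b c y z → a + ((+ 1 + b) - y) + (- (z - c)) ≡ (a + (+ 1 + b) + c) - y - z
      l₁ = solve-∀
      l₂ : ∀ x y z → (x + y + z) - y - z ≡ x
      l₂ = solve-∀
      l₃ : ∀ y b → (+ 1 + b) - ((+ 1 + b) - y) ≡ y
      l₃ = solve-∀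
      l₄ : ∀ z c → c - (- (z - c)) ≡ z
      l₄ = solve-∀

  -- The unit leaves the first coordinate, where t has the opposite sign, for the second. The sign
  -- of y c - z b tells on which side of `(y , z)` the pair `(b , c)` lies; `H` asks for the side
  -- from which raising b is the right turn.
  move-out : ∀ a b c x y z → x < 0ℤ → 0ℤ < y → 0ℤ ≤ + c * (y * + c - z * + b) →
    0ℤ ≤ dot (+ ℕ.suc a , + b , + c) (x , y , z) → Improvable (x , y , z) (+ ℕ.suc a , + b , + c)
  move-out a b c x y z x<0 0<y H 0≤β = transport swap₁₂-iso (x , y , z) (+ ℕ.suc a , + b , + c) (move-acute b a c (y , x , z) 0≤β′
      (by< (0<+ (0<+ (0<+ (0<+ (0<* (neg-pos x<0) (0<dot u (subst (1 ℕ.≤_) (cong (ℕ._+ c) (sym (ℕ.+-suc b a))) (ℕ.s≤s ℕ.z≤n))))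
              (0≤* (0≤* (<⇒≤ (neg-pos x<0)) (0≤+n {ℕ.suc a})) (0≤+n {b}))) (0≤* (<⇒≤ 0<y) (0≤sq (+ ℕ.suc a)))) H) (0≤* {+ a} 0≤+n 0≤β′))
           (l (+ a) (+ b) (+ c) x y z)))
    where
    u = (+ b , + ℕ.suc a , + c)
    0≤β′ : 0ℤ ≤ dot u (y , x , z)
    0≤β′ = subst (0ℤ ≤_) (Isometry.dot-pres swap₁₂-iso u (y , x , z)) 0≤β
    l : ∀ a b c x y z → let U = b * b + (+ 1 + a) * (+ 1 + a) + c * c ; β = b * y + (+ 1 + a) * x + c * z in
      (y - x) * U ≡ (b - a) * β + (- x * U + - x * (+ 1 + a) * b + y * ((+ 1 + a) * (+ 1 + a)) + c * (y * c - z * b) + a * β)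
    l = solve-∀

  -- The last hypothesis is the first inequality of `better-obtuse` for v = u + d with d = (1, -1,
  -- 0): as u·d = a - b and t·d = x - y, the terms (u·t)|u|² cancel.
  move-obtuse : ∀ a b c x y z → let u = (+ ℕ.suc a , + ℕ.suc b , + c) ; t = (x , y , z) in
    0ℤ < - dot u t → 0ℤ ≤ (x - y) * dot u u - dot u t * (+ a - + b) → Improvable t u
  move-obtuse a b c x y z 0<-β H = v , norm-move (ℕ.suc a) b c , adj-move (ℕ.suc a) b c ,
      better-obtuse u v t (0<dot u (ℕ.s≤s ℕ.z≤n)) (0<dot v (ℕ.s≤s ℕ.z≤n)) 0<-β
        (by≤ H (trans (cong (_* U) (δ≡ (+ a) (+ b) (+ c) x y z)) (trans (scal₁ U β (+ a - + b) (x - y)) (cong (λ κ → β * κ + ((x - y) * U - β * (+ a - + b))) (sym (κ≡ (+ a) (+ b) (+ c)))))))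
        (subst₂ (λ κ W → κ * κ < U * W) (sym (κ≡ (+ a) (+ b) (+ c))) (sym (W≡ (+ a) (+ b) (+ c)))
          (by< {e = + 2 * U - h * h} (subst (0ℤ <_) (sym (poly₃ (+ a) (+ b) (+ c))) (0<+ (0≤+< (0≤+ (0≤+ (0≤sq (+ a + + b)) (0≤* {+ 4} 0≤+n (0≤+n {a}))) (0≤* {+ 4} 0≤+n (0≤+n {b}))) (+<+ (ℕ.s≤s (ℕ.z≤n {3})))) (0≤* {+ 2} 0≤+n (0≤sq (+ c))))) (scal₂ U h)))
    where
    u v t : Vertex
    u = (+ ℕ.suc a , + ℕ.suc b , + c)
    v = (+ ℕ.suc (ℕ.suc a) , + b , + c)
    t = (x , y , z)
    U = dot u u
    β = dot u t
    h = + a - + b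
    δ≡ : ∀ a b c x y z → (+ 2 + a) * x + b * y + c * z ≡ ((+ 1 + a) * x + (+ 1 + b) * y + c * z) + (x - y)
    δ≡ = solve-∀
    κ≡ : ∀ a b c → (+ 1 + a) * (+ 2 + a) + (+ 1 + b) * b + c * c ≡ ((+ 1 + a) * (+ 1 + a) + (+ 1 + b) * (+ 1 + b) + c * c) + (a - b)
    κ≡ = solve-∀
    W≡ : ∀ a b c → (+ 2 + a) * (+ 2 + a) + b * b + c * c ≡ ((+ 1 + a) * (+ 1 + a) + (+ 1 + b) * (+ 1 + b) + c * c) + + 2 * (a - b) + + 2
    W≡ = solve-∀
    scal₁ : ∀ U β h γ → (β + γ) * U ≡ β * (U + h) + (γ * U - β * h)
    scal₁ = solve-∀
    scal₂ : ∀ U h → U * (U + + 2 * h + + 2) ≡ (U + h) * (U + h) + (+ 2 * U - h * h)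
    scal₂ = solve-∀
    -- This is 2|u|² - (u·d)², the Gram determinant of u and d; its positivity is the strict Cauchy
    -- inequality for u and v.
    poly₃ : ∀ a b c → + 2 * ((+ 1 + a) * (+ 1 + a) + (+ 1 + b) * (+ 1 + b) + c * c) - (a - b) * (a - b) ≡
      ((a + b) * (a + b) + + 4 * a + + 4 * b + + 4) + + 2 * (c * c)
    poly₃ = solve-∀

  -- On an axis every move leaves the axis, and the sign of y selects the side. The other side
  -- follows by `neg₂`, which fixes u.
  corner-obtuse : ∀ a x y z → 0ℤ ≤ y → let u = (+ ℕ.suc a , + 0 , + 0) in 0ℤ < - dot u (x , y , z) → Improvable (x , y , z) u
  corner-obtuse a x y z 0≤y 0<-β = v , l₀ , adj ,
      better-obtuse u v t (0<dot u (ℕ.s≤s ℕ.z≤n)) (0<dot v (subst (1 ℕ.≤_) (sym l₀) (ℕ.s≤s ℕ.z≤n))) 0<-β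
        (by≤ (0≤* 0≤y (0≤dot u)) (l₁ (+ a) x y z))
        (by< (0<* {+ ℕ.suc a} {+ ℕ.suc a} (+<+ (ℕ.s≤s ℕ.z≤n)) (+<+ (ℕ.s≤s ℕ.z≤n))) (l₂ (+ a)))
    where
    u v t : Vertex
    u = (+ ℕ.suc a , + 0 , + 0)
    v = (+ a , + 1 , + 0)
    t = (x , y , z)
    l₀ : a ℕ.+ 1 ℕ.+ 0 ≡ ℕ.suc a ℕ.+ 0 ℕ.+ 0
    l₀ = cong (ℕ._+ 0) (trans (ℕ.+-suc a 0) refl)
    adj : Adj u v
    adj = (λ ()) , ∣down∣≤1 a , ℕ.s≤s ℕ.z≤n , ℕ.z≤n
    l₁ : ∀ a x y z → let U = (+ 1 + a) * (+ 1 + a) + + 0 * + 0 + + 0 * + 0 in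
      (a * x + + 1 * y + + 0 * z) * U ≡ ((+ 1 + a) * x + + 0 * y + + 0 * z) * ((+ 1 + a) * a + + 0 * + 1 + + 0 * + 0) + y * U
    l₁ = solve-∀
    l₂ : ∀ a → ((+ 1 + a) * (+ 1 + a) + + 0 * + 0 + + 0 * + 0) * (a * a + + 1 * + 1 + + 0 * + 0) ≡
       ((+ 1 + a) * a + + 0 * + 1 + + 0 * + 0) * ((+ 1 + a) * a + + 0 * + 1 + + 0 * + 0) + (+ 1 + a) * (+ 1 + a)
    l₂ = solve-∀

  module _ {t u : Vertex} where
    by₁₂ : Improvable (swap₁₂ t) (swap₁₂ u) → Improvable t u
    by₁₂ = transport swap₁₂-iso t u
    by₂₃ : Improvable (swap₂₃ t) (swap₂₃ u) → Improvable t u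
    by₂₃ = transport swap₂₃-iso t u

  -- Choice of the transfer by cases.

  data Imbalance (a b c x y z : ℕ.ℕ) : Set where
    ↑₁↓₂ : a ℕ.< x → y ℕ.< b → Imbalance a b c x y z
    ↑₁↓₃ : a ℕ.< x → z ℕ.< c → Imbalance a b c x y z
    ↑₂↓₁ : b ℕ.< y → x ℕ.< a → Imbalance a b c x y z
    ↑₂↓₃ : b ℕ.< y → z ℕ.< c → Imbalance a b c x y z
    ↑₃↓₁ : c ℕ.< z → x ℕ.< a → Imbalance a b c x y z
    ↑₃↓₂ : c ℕ.< z → y ℕ.< b → Imbalance a b c x y z

  -- Otherwise all coordinate differences would have the same weak sign, not all zero, and the two
  -- sums could not agree.
  imbalance : ∀ a b c x y z → a ℕ.+ b ℕ.+ c ≡ x ℕ.+ y ℕ.+ z → ¬ (_≡_ {A = Vertex} (+ a , + b , + c) (+ x , + y , + z)) →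
    Imbalance a b c x y z
  imbalance a b c x y z eq ne with ℕ.<-cmp a x | ℕ.<-cmp b y | ℕ.<-cmp c z
  ... | tri< a<x _ _ | tri> _ _ y<b | _ = ↑₁↓₂ a<x y<b
  ... | tri< a<x _ _ | _ | tri> _ _ z<c = ↑₁↓₃ a<x z<c
  ... | tri> _ _ x<a | tri< b<y _ _ | _ = ↑₂↓₁ b<y x<a
  ... | tri> _ _ x<a | _ | tri< c<z _ _ = ↑₃↓₁ c<z x<a
  ... | _ | tri< b<y _ _ | tri> _ _ z<c = ↑₂↓₃ b<y z<c
  ... | _ | tri> _ _ y<b | tri< c<z _ _ = ↑₃↓₂ c<z y<b
  ... | tri≈ _ refl _ | tri≈ _ refl _ | tri≈ _ refl _ = ⊥-elim (ne refl)
  ... | tri< p _ _ | tri< q _ _ | tri< r _ _ = ⊥-elim (ℕ.<-irrefl eq (ℕ.+-mono-< (ℕ.+-mono-< p q) r))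
  ... | tri< p _ _ | tri< q _ _ | tri≈ _ refl _ = ⊥-elim (ℕ.<-irrefl eq (ℕ.+-monoˡ-< c (ℕ.+-mono-< p q)))
  ... | tri< p _ _ | tri≈ _ refl _ | tri< r _ _ = ⊥-elim (ℕ.<-irrefl eq (ℕ.+-mono-< (ℕ.+-monoˡ-< b p) r))
  ... | tri< p _ _ | tri≈ _ refl _ | tri≈ _ refl _ = ⊥-elim (ℕ.<-irrefl eq (ℕ.+-monoˡ-< c (ℕ.+-monoˡ-< b p)))
  ... | tri≈ _ refl _ | tri< q _ _ | tri< r _ _ = ⊥-elim (ℕ.<-irrefl eq (ℕ.+-mono-< (ℕ.+-monoʳ-< a q) r))
  ... | tri≈ _ refl _ | tri< q _ _ | tri≈ _ refl _ = ⊥-elim (ℕ.<-irrefl eq (ℕ.+-monoˡ-< c (ℕ.+-monoʳ-< a q)))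
  ... | tri≈ _ refl _ | tri≈ _ refl _ | tri< r _ _ = ⊥-elim (ℕ.<-irrefl eq (ℕ.+-monoʳ-< (a ℕ.+ b) r))
  ... | tri≈ _ refl _ | tri≈ _ refl _ | tri> _ _ r = ⊥-elim (ℕ.<-irrefl (sym eq) (ℕ.+-monoʳ-< (a ℕ.+ b) r))
  ... | tri≈ _ refl _ | tri> _ _ q | tri≈ _ refl _ = ⊥-elim (ℕ.<-irrefl (sym eq) (ℕ.+-monoˡ-< c (ℕ.+-monoʳ-< a q)))
  ... | tri≈ _ refl _ | tri> _ _ q | tri> _ _ r = ⊥-elim (ℕ.<-irrefl (sym eq) (ℕ.+-mono-< (ℕ.+-monoʳ-< a q) r))
  ... | tri> _ _ p | tri≈ _ refl _ | tri≈ _ refl _ = ⊥-elim (ℕ.<-irrefl (sym eq) (ℕ.+-monoˡ-< c (ℕ.+-monoˡ-< b p)))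
  ... | tri> _ _ p | tri≈ _ refl _ | tri> _ _ r = ⊥-elim (ℕ.<-irrefl (sym eq) (ℕ.+-mono-< (ℕ.+-monoˡ-< b p) r))
  ... | tri> _ _ p | tri> _ _ q | tri≈ _ refl _ = ⊥-elim (ℕ.<-irrefl (sym eq) (ℕ.+-monoˡ-< c (ℕ.+-mono-< p q)))
  ... | tri> _ _ p | tri> _ _ q | tri> _ _ r = ⊥-elim (ℕ.<-irrefl (sym eq) (ℕ.+-mono-< (ℕ.+-mono-< p q) r))

  octant-case : ∀ a b c x y z → a ℕ.+ b ℕ.+ c ≡ x ℕ.+ y ℕ.+ z → ¬ (_≡_ {A = Vertex} (+ a , + b , + c) (+ x , + y , + z)) →
    Improvable (+ x , + y , + z) (+ a , + b , + c)
  octant-case a b c x y z eq ne with imbalance a b c x y z eq ne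
  ... | ↑₁↓₂ p q = same-octant a b c x y z p q eq
  ... | ↑₁↓₃ p q = by₂₃ (same-octant a c b x z y p q (trans (perm a c b) (trans eq (perm x y z))))
    where perm : ∀ a b c → a ℕ.+ b ℕ.+ c ≡ a ℕ.+ c ℕ.+ b
          perm a b c = trans (ℕ.+-assoc a b c) (trans (cong (a ℕ.+_) (ℕ.+-comm b c)) (sym (ℕ.+-assoc a c b)))
  ... | ↑₂↓₁ p q = by₁₂ (same-octant b a c y x z p q (trans (cong (ℕ._+ c) (ℕ.+-comm b a)) (trans eq (cong (ℕ._+ z) (ℕ.+-comm x y)))))
  ... | ↑₃↓₁ p q = by₂₃ (by₁₂ (same-octant c a b z x y p q (trans (rot c a b) (trans eq (sym (rot z x y))))))
    where rot : ∀ c a b → c ℕ.+ a ℕ.+ b ≡ a ℕ.+ b ℕ.+ c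
          rot c a b = trans (ℕ.+-assoc c a b) (ℕ.+-comm c (a ℕ.+ b))
  ... | ↑₂↓₃ p q = by₁₂ (by₂₃ (same-octant b c a y z x p q (trans (rot b c a) (trans eq (sym (rot y z x))))))
    where rot : ∀ b c a → b ℕ.+ c ℕ.+ a ≡ a ℕ.+ b ℕ.+ c
          rot b c a = trans (ℕ.+-comm (b ℕ.+ c) a) (sym (ℕ.+-assoc a b c))
  ... | ↑₃↓₂ p q = by₁₂ (by₂₃ (by₁₂ (same-octant c b a z y x p q (trans (rev c b a) (trans eq (sym (rev z y x)))))))
    where rev : ∀ c b a → c ℕ.+ b ℕ.+ a ≡ a ℕ.+ b ℕ.+ c
          rev c b a = trans (ℕ.+-comm (c ℕ.+ b) a) (trans (cong (a ℕ.+_) (ℕ.+-comm c b)) (sym (ℕ.+-assoc a b c)))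

  -- The condition on a guarantees a unit to take away. Since the first product is negative, u·t ≥ 0
  -- forces y or z to be positive. If both are, the conditions `H` for the second and the third
  -- coordinate involve opposite quantities, so one of the two transfers is available.
  mixed-case : ∀ a b c x y z → (a ≡ 0 → 0ℤ ≤ x) → x < 0ℤ → 0ℤ ≤ dot (+ a , + b , + c) (x , y , z) →
    Improvable (x , y , z) (+ a , + b , + c)
  mixed-case ℕ.zero b c x y z a₀ x<0 0≤β = ⊥-elim (<-irrefl refl (<-≤-trans x<0 (a₀ refl)))
  mixed-case (ℕ.suc a) b c x y z _ x<0 0≤β = go (<-≤-connex 0ℤ y) (<-≤-connex 0ℤ z)
    where
    t = (x , y , z)
    u = (+ ℕ.suc a , + b , + c)
    via-y : 0ℤ < y → 0ℤ ≤ + c * (y * + c - z * + b) → Improvable t u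
    via-y 0<y H = move-out a b c x y z x<0 0<y H 0≤β
    via-z : 0ℤ < z → 0ℤ ≤ + b * (z * + b - y * + c) → Improvable t u
    via-z 0<z H = by₂₃ (move-out a c b x z y x<0 0<z H (subst (0ℤ ≤_) (sym (Isometry.dot-pres swap₂₃-iso u t)) 0≤β))
    nonpos* : ∀ {k} y → y ≤ 0ℤ → 0ℤ ≤ - (y * + k)
    nonpos* {k} y y≤0 = subst (0ℤ ≤_) (l y (+ k)) (0≤* {(- y)} {+ k} (neg-mono-≤ y≤0) 0≤+n)
      where l : ∀ y k → (- y) * k ≡ - (y * k)
            l = solve-∀
    <-≤-connex : ∀ i j → (i < j) ⊎ (j ≤ i)
    <-≤-connex i j with <-cmp i j
    ... | tri< p _ _ = inj₁ p
    ... | tri≈ _ p _ = inj₂ (≤-reflexive (sym p))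
    ... | tri> _ _ p = inj₂ (<⇒≤ p)
    flip : ∀ p q → - (p - q) ≡ q - p
    flip = solve-∀
    go : (0ℤ < y) ⊎ (y ≤ 0ℤ) → (0ℤ < z) ⊎ (z ≤ 0ℤ) → Improvable t u
    go (inj₁ 0<y) (inj₂ z≤0) = via-y 0<y (0≤* {+ c} 0≤+n (0≤+ (0≤* (<⇒≤ 0<y) (0≤+n {c})) (nonpos* {b} z z≤0)))
    go (inj₂ y≤0) (inj₁ 0<z) = via-z 0<z (0≤* {+ b} 0≤+n (0≤+ (0≤* (<⇒≤ 0<z) (0≤+n {b})) (nonpos* {c} y y≤0)))
    go (inj₁ 0<y) (inj₁ 0<z) with 0≤-cases (y * + c - z * + b)
    ... | inj₁ p = via-y 0<y (0≤* {+ c} 0≤+n p)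
    ... | inj₂ p = via-z 0<z (0≤* {+ b} 0≤+n (subst (0ℤ ≤_) (flip (y * + c) (z * + b)) (<⇒≤ p)))
    go (inj₂ y≤0) (inj₂ z≤0) = ⊥-elim (0<⇒¬≤0 (0<+ (0<+ (0<* {+ ℕ.suc a} (+<+ (ℕ.s≤s ℕ.z≤n)) (neg-pos x<0)) (nonpos* {b} y y≤0)) (nonpos* {c} z z≤0))
         (subst (_≤ 0ℤ) (l (+ ℕ.suc a) (+ b) (+ c) x y z) (neg-mono-≤ 0≤β)))
      where l : ∀ a b c x y z → - (a * x + b * y + c * z) ≡ a * (- x) + - (y * b) + - (z * c)
            l = solve-∀

  -- The quantity required by `move-obtuse` changes sign when the two coordinates are exchanged, so
  -- one of the directions (1, -1, 0) and (-1, 1, 0) works.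
  obtuse-pair : ∀ a b c x y z → 0ℤ < - dot (+ ℕ.suc a , + ℕ.suc b , + c) (x , y , z) →
    Improvable (x , y , z) (+ ℕ.suc a , + ℕ.suc b , + c)
  obtuse-pair a b c x y z 0<-β with 0≤-cases ((x - y) * dot u u - dot u t * (+ a - + b))
    where u = (+ ℕ.suc a , + ℕ.suc b , + c)
          t = (x , y , z)
  ... | inj₁ H = move-obtuse a b c x y z 0<-β H
  ... | inj₂ H = by₁₂ (move-obtuse b a c y x z (subst (λ s → 0ℤ < - s) (sym (Isometry.dot-pres swap₁₂-iso u t)) 0<-β)
       (subst₂ (λ U β → 0ℤ ≤ (y - x) * U - β * (+ b - + a)) (sym (Isometry.dot-pres swap₁₂-iso u u)) (sym (Isometry.dot-pres swap₁₂-iso u t))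
         (subst (0ℤ ≤_) (l x y (dot u u) (dot u t) (+ a) (+ b)) (<⇒≤ H))))
    where u = (+ ℕ.suc a , + ℕ.suc b , + c)
          t = (x , y , z)
          l : ∀ x y U β a b → - ((x - y) * U - β * (a - b)) ≡ (y - x) * U - β * (b - a)
          l = solve-∀

  obtuse-corner : ∀ a x y z → let u = (+ ℕ.suc a , + 0 , + 0) in 0ℤ < - dot u (x , y , z) → Improvable (x , y , z) u
  obtuse-corner a x y z 0<-β with 0≤-cases y
  ... | inj₁ p = corner-obtuse a x y z p 0<-β
  ... | inj₂ p = transport neg₂-iso (x , y , z) (+ ℕ.suc a , + 0 , + 0) (corner-obtuse a x (- y) z (<⇒≤ p) (subst (λ s → 0ℤ < - s) (sym (Isometry.dot-pres neg₂-iso (+ ℕ.suc a , + 0 , + 0) (x , y , z))) 0<-β))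

  obtuse-case : ∀ a b c x y z → 1 ℕ.≤ a ℕ.+ b ℕ.+ c → 0ℤ < - dot (+ a , + b , + c) (x , y , z) →
    Improvable (x , y , z) (+ a , + b , + c)
  obtuse-case (ℕ.suc a) (ℕ.suc b) c x y z _ 0<-β = obtuse-pair a b c x y z 0<-β
  obtuse-case (ℕ.suc a) ℕ.zero (ℕ.suc c) x y z _ 0<-β = by₂₃ (obtuse-pair a c 0 x z y (subst (λ s → 0ℤ < - s) (sym (Isometry.dot-pres swap₂₃-iso u (x , y , z))) 0<-β))
    where u = (+ ℕ.suc a , + 0 , + ℕ.suc c)
  obtuse-case ℕ.zero (ℕ.suc b) (ℕ.suc c) x y z _ 0<-β = by₁₂ (by₂₃ (obtuse-pair b c 0 y z x (subst (λ s → 0ℤ < - s)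
      (sym (trans (Isometry.dot-pres swap₂₃-iso (swap₁₂ u) (swap₁₂ (x , y , z))) (Isometry.dot-pres swap₁₂-iso u (x , y , z)))) 0<-β)))
    where u = (+ 0 , + ℕ.suc b , + ℕ.suc c)
  obtuse-case (ℕ.suc a) ℕ.zero ℕ.zero x y z _ 0<-β = obtuse-corner a x y z 0<-β
  obtuse-case ℕ.zero (ℕ.suc b) ℕ.zero x y z _ 0<-β = by₁₂ (obtuse-corner b y x z (subst (λ s → 0ℤ < - s) (sym (Isometry.dot-pres swap₁₂-iso u (x , y , z))) 0<-β))
    where u = (+ 0 , + ℕ.suc b , + 0)
  obtuse-case ℕ.zero ℕ.zero (ℕ.suc c) x y z _ 0<-β = by₂₃ (by₁₂ (obtuse-corner c z x y (subst (λ s → 0ℤ < - s)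
      (sym (trans (Isometry.dot-pres swap₁₂-iso (swap₂₃ u) (swap₂₃ (x , y , z))) (Isometry.dot-pres swap₂₃-iso u (x , y , z)))) 0<-β)))
    where u = (+ 0 , + 0 , + ℕ.suc c)
  obtuse-case ℕ.zero ℕ.zero ℕ.zero x y z () 0<-β

  nonneg-case : ∀ a b c t → (a ≡ 0 → 0ℤ ≤ proj₁ t) → (b ≡ 0 → 0ℤ ≤ proj₁ (proj₂ t)) → (c ≡ 0 → 0ℤ ≤ proj₂ (proj₂ t)) →
    let u = (+ a , + b , + c) in 1 ℕ.≤ norm1 u → norm1 u ≡ norm1 t → ¬ u ≡ t → Improvable t u
  nonneg-case a b c t@(x , y , z) a₀ b₀ c₀ 1≤n eq ne with 0≤-cases (dot (+ a , + b , + c) t)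
  ... | inj₂ 0<-β = obtuse-case a b c x y z 1≤n 0<-β
  nonneg-case a b c (+ x , + y , + z) a₀ b₀ c₀ 1≤n eq ne | inj₁ 0≤β = octant-case a b c x y z eq ne
  nonneg-case a b c (-[1+ x ] , y , z) a₀ b₀ c₀ 1≤n eq ne | inj₁ 0≤β = mixed-case a b c -[1+ x ] y z a₀ -<+ 0≤β
  nonneg-case a b c t@(+ x , -[1+ y ] , z) a₀ b₀ c₀ 1≤n eq ne | inj₁ 0≤β =
    by₁₂ (mixed-case b a c -[1+ y ] (+ x) z b₀ -<+ (subst (0ℤ ≤_) (sym (Isometry.dot-pres swap₁₂-iso (+ a , + b , + c) t)) 0≤β))
  nonneg-case a b c t@(+ x , + y , -[1+ z ]) a₀ b₀ c₀ 1≤n eq ne | inj₁ 0≤β =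
    by₂₃ (by₁₂ (mixed-case c a b -[1+ z ] (+ x) (+ y) c₀ -<+ (subst (0ℤ ≤_)
      (sym (trans (Isometry.dot-pres swap₁₂-iso (swap₂₃ u) (swap₂₃ t)) (Isometry.dot-pres swap₂₃-iso u t))) 0≤β)))
    where u = (+ a , + b , + c)

  -- A zero coordinate carries no sign of its own and takes that of the target. After normalisation,
  -- u is therefore strictly positive wherever t is negative.
  sign-split : ∀ a x → (Σ ℕ.ℕ λ k → a ≡ + k × (k ≡ 0 → 0ℤ ≤ x)) ⊎ (Σ ℕ.ℕ λ k → - a ≡ + k × (k ≡ 0 → 0ℤ ≤ - x))
  sign-split (+ ℕ.suc k) x = inj₁ (ℕ.suc k , refl , λ ())
  sign-split -[1+ k ] x = inj₂ (ℕ.suc k , refl , λ ())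
  sign-split (+ ℕ.zero) x with 0≤-cases x
  ... | inj₁ p = inj₁ (0 , refl , λ _ → p)
  ... | inj₂ p = inj₂ (0 , refl , λ _ → <⇒≤ p)

  -- Kept general in `P` because it serves three reductions: improving neighbours, paths in the
  -- graph, and clusters around t.
  sign-normalise : ∀ {P : Vertex → Vertex → Set} →
    (∀ t u → P (neg₁ t) (neg₁ u) → P t u) → (∀ t u → P (neg₂ t) (neg₂ u) → P t u) → (∀ t u → P (neg₃ t) (neg₃ u) → P t u) →
    (∀ a b c t → (a ≡ 0 → 0ℤ ≤ proj₁ t) → (b ≡ 0 → 0ℤ ≤ proj₁ (proj₂ t)) → (c ≡ 0 → 0ℤ ≤ proj₂ (proj₂ t)) → P t (+ a , + b , + c)) →
    ∀ t u → P t u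
  sign-normalise {P} r₁ r₂ r₃ base = octant₁
    where
    octant₃ : ∀ a b c t → (a ≡ 0 → 0ℤ ≤ proj₁ t) → (b ≡ 0 → 0ℤ ≤ proj₁ (proj₂ t)) → P t (+ a , + b , c)
    octant₃ a b c t@(x , y , z) a₀ b₀ with sign-split c z
    ... | inj₁ (k , refl , c₀) = base a b k t a₀ b₀ c₀
    ... | inj₂ (k , eq , c₀) = r₃ t (+ a , + b , c) (subst (λ s → P (neg₃ t) (+ a , + b , s)) (sym eq) (base a b k (neg₃ t) a₀ b₀ c₀))
    octant₂ : ∀ a b c t → (a ≡ 0 → 0ℤ ≤ proj₁ t) → P t (+ a , b , c)
    octant₂ a b c t@(x , y , z) a₀ with sign-split b y
    ... | inj₁ (k , refl , b₀) = octant₃ a k c t a₀ b₀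
    ... | inj₂ (k , eq , b₀) = r₂ t (+ a , b , c) (subst (λ s → P (neg₂ t) (+ a , s , c)) (sym eq) (octant₃ a k c (neg₂ t) a₀ b₀))
    octant₁ : ∀ t u → P t u
    octant₁ t@(x , y , z) u@(a , b , c) with sign-split a x
    ... | inj₁ (k , refl , a₀) = octant₂ k b c t a₀
    ... | inj₂ (k , eq , a₀) = r₁ t u (subst (λ s → P (neg₁ t) (s , b , c)) (sym eq) (octant₂ k b c (neg₁ t) a₀))

  improvable : ∀ t u → 1 ℕ.≤ norm1 u → norm1 u ≡ norm1 t → ¬ u ≡ t → Improvable t u
  improvable = sign-normalise {Claim} (reflect neg₁-iso) (reflect neg₂-iso) (reflect neg₃-iso) nonneg-case
    where
    Claim : Vertex → Vertex → Set
    Claim t u = 1 ℕ.≤ norm1 u → norm1 u ≡ norm1 t → ¬ u ≡ t → Improvable t u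
    reflect : ∀ {f} → Isometry f → ∀ t u → Claim (f t) (f u) → Claim t u
    reflect {f} iso t u claim p q r = transport iso t u
      (claim (subst (1 ℕ.≤_) (sym (norm-pres u)) p) (trans (norm-pres u) (trans q (sym (norm-pres t)))) (≢-inv {f} involutive {u} {t} r))
      where open Isometry iso

-- A descent function for paths in the graph.

module Transfers where
  open import Defs
  open Angles using (_⊖_)
  open Improvement using (Isometry; neg₁; neg₂; neg₃; neg₁-iso; neg₂-iso; neg₃-iso; swap₁₂-iso; swap₂₃-iso; sign-normalise; Imbalance; ↑₁↓₂; ↑₁↓₃; ↑₂↓₁; ↑₂↓₃; ↑₃↓₁; ↑₃↓₂; imbalance; adj-move; norm-move; ≢-inv)
  open import Data.Nat
  open import Data.Nat.Properties
  open import Data.Integer as ℤ using (ℤ; +_; -[1+_]; ∣_∣; 0ℤ)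
  import Data.Integer.Properties as ℤ
  open import Data.Nat.Tactic.RingSolver using (solve-∀)
  open import Data.Product using (Σ; _×_; _,_; proj₁; proj₂)
  open import Relation.Nullary using (¬_)
  open import Relation.Binary.PropositionalEquality

  -- A discrepancy in a coordinate of opposite sign counts m times: such mass has to be moved
  -- through coordinate hyperplanes.
  ψ : ℕ → ℕ → ℤ → ℕ
  ψ m a (+ x) = ∣ a - x ∣
  ψ m a -[1+ x ] = m * a + suc x

  ψℤ : ℕ → ℤ → ℤ → ℕ
  ψℤ m (+ a) x = ψ m a x
  ψℤ m -[1+ a ] x = ψ m (suc a) (ℤ.- x)

  -- The increasing multiplicities make a transfer from coordinate j to coordinate i < j profitable
  -- when both have the wrong sign.
  Ψ : Vertex → Vertex → ℕ
  Ψ (x , y , z) (a , b , c) = ψℤ 2 a x + ψℤ 3 b y + ψℤ 4 c z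

  ψℤ-neg : ∀ m a x → ψℤ m (ℤ.- a) (ℤ.- x) ≡ ψℤ m a x
  ψℤ-neg m (+ suc a) x = cong (ψ m (suc a)) (ℤ.neg-involutive x)
  ψℤ-neg m -[1+ a ] x = refl
  ψℤ-neg m (+ zero) (+ zero) = refl
  ψℤ-neg m (+ zero) (+ suc x) = cong (_+ suc x) (*-zeroʳ m)
  ψℤ-neg m (+ zero) -[1+ x ] = sym (cong (_+ suc x) (*-zeroʳ m))

  ∣+-+∣ : ∀ a x → ∣ + a ℤ.- + x ∣ ≡ ∣ a - x ∣
  ∣+-+∣ a x = trans (cong ∣_∣ (ℤ.m-n≡m⊖n a x)) (go a x)
    where go : ∀ a x → ∣ a ℤ.⊖ x ∣ ≡ ∣ a - x ∣
          go zero zero = refl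
          go zero (suc x) = refl
          go (suc a) zero = refl
          go (suc a) (suc x) = trans (cong ∣_∣ (ℤ.[1+m]⊖[1+n]≡m⊖n a x)) (go a x)

  ψ≤ : ∀ m a x → 1 ≤ m → ψ m a x ≤ m * ∣ + a ℤ.- x ∣
  ψ≤ m a (+ x) 1≤m = ≤-trans (≤-reflexive (sym (∣+-+∣ a x))) (m≤n*m _ m {{>-nonZero 1≤m}})
  ψ≤ m a -[1+ x ] 1≤m = ≤-trans (+-monoʳ-≤ (m * a) (m≤n*m (suc x) m {{>-nonZero 1≤m}})) (≤-reflexive (sym (*-distribˡ-+ m a (suc x))))

  ψℤ≤ : ∀ m a x → 1 ≤ m → ψℤ m a x ≤ m * ∣ a ℤ.- x ∣
  ψℤ≤ m (+ a) x = ψ≤ m a x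
  ψℤ≤ m -[1+ a ] x 1≤m = ≤-trans (ψ≤ m (suc a) (ℤ.- x) 1≤m) (≤-reflexive (cong (m *_) (trans (sym (ℤ.∣-i∣≡∣i∣ (+ suc a ℤ.- ℤ.- x))) (cong ∣_∣ (trans (ℤ.neg-distrib-+ (+ suc a) (ℤ.- (ℤ.- x))) (cong (ℤ._+_ -[1+ a ]) (ℤ.neg-involutive (ℤ.- x))))))))

  Ψ≤ : ∀ t u → Ψ t u ≤ 4 * norm1 (u ⊖ t)
  Ψ≤ (x , y , z) (a , b , c) = ≤-trans
    (+-mono-≤ (+-mono-≤ (up 2 a x (s≤s z≤n) (s≤s (s≤s z≤n))) (up 3 b y (s≤s z≤n) (s≤s (s≤s (s≤s z≤n))))) (up 4 c z (s≤s z≤n) ≤-refl))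
    (≤-reflexive (l (∣ a ℤ.- x ∣) (∣ b ℤ.- y ∣) (∣ c ℤ.- z ∣)))
    where
    up : ∀ m a x → 1 ≤ m → m ≤ 4 → ψℤ m a x ≤ 4 * ∣ a ℤ.- x ∣
    up m a x 1≤m m≤4 = ≤-trans (ψℤ≤ m a x 1≤m) (*-monoˡ-≤ _ m≤4)
    l : ∀ p q r → 4 * p + 4 * q + 4 * r ≡ 4 * (p + q + r)
    l = solve-∀

  ψ-down-mixed : ∀ m a x → ψ m a -[1+ x ] + m ≡ ψ m (suc a) -[1+ x ]
  ψ-down-mixed = l where
    l : ∀ m a x → m * a + (1 + x) + m ≡ m * (1 + a) + (1 + x)
    l = solve-∀

  ψ-up-mixed : ∀ m a x → ψ m (suc a) -[1+ x ] ≡ ψ m a -[1+ x ] + m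
  ψ-up-mixed m a x = sym (ψ-down-mixed m a x)

  ψ-up≤ : ∀ m a x → 1 ≤ m → ψ m (suc a) x ≤ ψ m a x + m
  ψ-up≤ m a -[1+ x ] _ = ≤-reflexive (ψ-up-mixed m a x)
  ψ-up≤ m a (+ x) 1≤m = ≤-trans (go a x) (+-monoʳ-≤ ∣ a - x ∣ 1≤m)
    where go : ∀ a x → ∣ suc a - x ∣ ≤ ∣ a - x ∣ + 1
          go a zero = ≤-reflexive (trans (cong suc (sym (∣-∣-identityʳ a))) (+-comm 1 _))
          go zero (suc x) = ≤-trans (n≤1+n x) (≤-trans (n≤1+n (suc x)) (≤-reflexive (+-comm 1 (suc x))))
          go (suc a) (suc x) = go a x

  ψ-up-nonneg : ∀ m a x → ψ m (suc a) (+ x) ≤ ψ m a (+ x) + 1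
  ψ-up-nonneg m a x = ψ-up≤ 1 a (+ x) ≤-refl

  ψ-up< : ∀ a x → a < x → suc ∣ suc a - x ∣ ≡ ∣ a - x ∣
  ψ-up< zero (suc x) _ = refl
  ψ-up< (suc a) (suc x) (s≤s p) = ψ-up< a x p

  ψ-down< : ∀ a x → x ≤ a → suc ∣ a - x ∣ ≡ ∣ suc a - x ∣
  ψ-down< a zero _ = cong suc (∣-∣-identityʳ a)
  ψ-down< (suc a) (suc x) (s≤s p) = ψ-down< a x p

  -- The l¹ distance could not replace `Ψ` here: from (n, 0, 0) towards (-n, 0, 0), no neighbour
  -- lowers it.
  Approachable : Vertex → Vertex → Set
  Approachable t u = Σ Vertex λ v → norm1 v ≡ norm1 u × Adj u v × Ψ t v < Ψ t u

  approach-reflect : ∀ {f} → Isometry f → (∀ t u → Ψ (f t) (f u) ≡ Ψ t u) → ∀ t u → Approachable (f t) (f u) → Approachable t u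
  approach-reflect {f} iso inv t u (v , nv , adj , lt) = f v , trans (norm-pres v) (trans nv (norm-pres u)) ,
     subst (λ w → Adj w (f v)) (involutive u) (adj-pres (f u) v adj) ,
     subst₂ _<_ (trans (cong (Ψ (f t)) (sym (involutive v))) (inv t (f v))) (inv t u) lt
    where open Isometry iso

  Moves : Vertex → Vertex → Set
  Moves u v = norm1 v ≡ norm1 u × Adj u v

  moves-sym : ∀ {u v} → Moves u v → Moves v u
  moves-sym {a , b , c} {d , e , f} (p , ne , q , r , s) = sym p , (λ eq → ne (sym eq)) ,
    subst (_≤ 1) (ℤ.∣i-j∣≡∣j-i∣ a d) q , subst (_≤ 1) (ℤ.∣i-j∣≡∣j-i∣ b e) r , subst (_≤ 1) (ℤ.∣i-j∣≡∣j-i∣ c f) s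

  moves-iso : ∀ {f} → Isometry f → ∀ {u v} → Moves u v → Moves (f u) (f v)
  moves-iso iso {u} {v} (p , q) = trans (norm-pres v) (trans p (sym (norm-pres u))) , adj-pres u v q
    where open Isometry iso

  move₁₂ : ∀ a b c → Moves (+ a , + suc b , + c) (+ suc a , + b , + c)
  move₁₂ a b c = norm-move a b c , adj-move a b c

  move₂₁ : ∀ a b c → Moves (+ suc a , + b , + c) (+ a , + suc b , + c)
  move₂₁ a b c = moves-sym (move₁₂ a b c)

  move₁₃ : ∀ a b c → Moves (+ a , + b , + suc c) (+ suc a , + b , + c)
  move₁₃ a b c = moves-iso swap₂₃-iso (move₁₂ a c b)

  move₃₁ : ∀ a b c → Moves (+ suc a , + b , + c) (+ a , + b , + suc c)
  move₃₁ a b c = moves-sym (move₁₃ a b c)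

  move₂₃ : ∀ a b c → Moves (+ a , + b , + suc c) (+ a , + suc b , + c)
  move₂₃ a b c = moves-iso swap₁₂-iso (move₁₃ b a c)

  move₃₂ : ∀ a b c → Moves (+ a , + suc b , + c) (+ a , + b , + suc c)
  move₃₂ a b c = moves-sym (move₂₃ a b c)

  lower : ∀ {p p′ q q′ k l} → p + k ≡ p′ → q′ ≤ q + l → l < k → p + q′ < p′ + q
  lower {p} {p′} {q} {q′} {k} {l} refl le lt = begin-strict
    p + q′       ≤⟨ +-monoʳ-≤ p le ⟩
    p + (q + l)  <⟨ +-monoʳ-< p (+-monoʳ-< q lt) ⟩
    p + (q + k)  ≡⟨ trans (cong (λ s → p + s) (+-comm q k)) (sym (+-assoc p k q)) ⟩
    p + k + q ∎
    where open ≤-Reasoning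

  lower₀ : ∀ {p p′ q q′} → suc p ≡ p′ → suc q ≡ q′ → p + q < p′ + q′
  lower₀ {p} {p′} {q} refl refl = s≤s (+-monoʳ-≤ p (n≤1+n q))

  private
    perm₂ : ∀ p q r → p + q + r ≡ p + r + q
    perm₂ = solve-∀
    perm₄ : ∀ p q r → p + q + r ≡ (r + p) + q
    perm₄ = solve-∀
    perm₅ : ∀ p q r → p + q + r ≡ (q + r) + p
    perm₅ = solve-∀

  approach : ∀ a b c t → (a ≡ 0 → 0ℤ ℤ.≤ proj₁ t) → (b ≡ 0 → 0ℤ ℤ.≤ proj₁ (proj₂ t)) → (c ≡ 0 → 0ℤ ℤ.≤ proj₂ (proj₂ t)) →
    let u = (+ a , + b , + c) in norm1 u ≡ norm1 t → ¬ u ≡ t → Approachable t u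
  approach a b zero (x , y , -[1+ z ]) a₀ b₀ c₀ eq ne with c₀ refl
  ... | ()
  -- Coordinates of the wrong sign are emptied from the last to the first. This transfer gains 4 and
  -- costs at most 2; the next one gains 3 and costs at most 2.
  approach a b (suc c) (x , y , -[1+ z ]) a₀ b₀ c₀ eq ne = v , proj₁ m , proj₂ m ,
      subst₂ _<_ (sym (perm₄ (ψ 2 (suc a) x) _ _)) (sym (perm₄ (ψ 2 a x) _ _))
        (+-monoˡ-< (ψ 3 b y) (lower (ψ-down-mixed 4 c z) (ψ-up≤ 2 a x (s≤s z≤n)) (s≤s (s≤s (s≤s z≤n)))))
    where v = (+ suc a , + b , + c)
          m = move₁₃ a b c
  approach a zero c (x , -[1+ y ] , + z) a₀ b₀ c₀ eq ne with b₀ refl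
  ... | ()
  approach a (suc b) c (x , -[1+ y ] , + z) a₀ b₀ c₀ eq ne = v , proj₁ m , proj₂ m ,
      +-monoˡ-< (ψ 4 c (+ z)) (subst₂ _<_ (+-comm _ (ψ 2 (suc a) x)) (+-comm _ (ψ 2 a x)) (lower (ψ-down-mixed 3 b y) (ψ-up≤ 2 a x (s≤s z≤n)) (s≤s (s≤s (s≤s z≤n)))))
    where v = (+ suc a , + b , + c)
          m = move₁₂ a b c
  approach zero b c (-[1+ x ] , + y , + z) a₀ b₀ c₀ eq ne with a₀ refl
  ... | ()
  -- The receiving coordinate now has the right sign and costs at most 1. A gain of 2 suffices, and
  -- multiplicity 1 would not.
  approach (suc a) b c (-[1+ x ] , + y , + z) a₀ b₀ c₀ eq ne = v , proj₁ m , proj₂ m ,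
      +-monoˡ-< (ψ 4 c (+ z)) (lower (ψ-down-mixed 2 a x) (ψ-up-nonneg 3 b y) (s≤s (s≤s z≤n)))
    where v = (+ a , + suc b , + c)
          m = move₂₁ a b c
  approach a b c (+ x , + y , + z) a₀ b₀ c₀ eq ne with imbalance a b c x y z eq ne
  approach a (suc b) c (+ x , + y , + z) a₀ b₀ c₀ eq ne | ↑₁↓₂ p (s≤s q) =
    (+ suc a , + b , + c) , proj₁ (move₁₂ a b c) , proj₂ (move₁₂ a b c) , +-monoˡ-< ∣ c - z ∣ (lower₀ (ψ-up< a x p) (ψ-down< b y q))
  approach a b (suc c) (+ x , + y , + z) a₀ b₀ c₀ eq ne | ↑₁↓₃ p (s≤s q) =
    (+ suc a , + b , + c) , proj₁ (move₁₃ a b c) , proj₂ (move₁₃ a b c) , subst₂ _<_ (sym (perm₂ ∣ suc a - x ∣ _ _)) (sym (perm₂ ∣ a - x ∣ _ _))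
       (+-monoˡ-< ∣ b - y ∣ (lower₀ (ψ-up< a x p) (ψ-down< c z q)))
  approach (suc a) b c (+ x , + y , + z) a₀ b₀ c₀ eq ne | ↑₂↓₁ p (s≤s q) =
    (+ a , + suc b , + c) , proj₁ (move₂₁ a b c) , proj₂ (move₂₁ a b c) , +-monoˡ-< ∣ c - z ∣ (lower₀ (ψ-down< a x q) (ψ-up< b y p))
  approach a b (suc c) (+ x , + y , + z) a₀ b₀ c₀ eq ne | ↑₂↓₃ p (s≤s q) =
    (+ a , + suc b , + c) , proj₁ (move₂₃ a b c) , proj₂ (move₂₃ a b c) , subst₂ _<_ (sym (perm₅ ∣ a - x ∣ _ _)) (sym (perm₅ ∣ a - x ∣ _ _))
       (+-monoˡ-< ∣ a - x ∣ (lower₀ (ψ-up< b y p) (ψ-down< c z q)))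
  approach (suc a) b c (+ x , + y , + z) a₀ b₀ c₀ eq ne | ↑₃↓₁ p (s≤s q) =
    (+ a , + b , + suc c) , proj₁ (move₃₁ a b c) , proj₂ (move₃₁ a b c) , subst₂ _<_ (sym (perm₂ ∣ a - x ∣ _ _)) (sym (perm₂ ∣ suc a - x ∣ _ _))
       (+-monoˡ-< ∣ b - y ∣ (lower₀ (ψ-down< a x q) (ψ-up< c z p)))
  approach a (suc b) c (+ x , + y , + z) a₀ b₀ c₀ eq ne | ↑₃↓₂ p (s≤s q) =
    (+ a , + b , + suc c) , proj₁ (move₃₂ a b c) , proj₂ (move₃₂ a b c) , subst₂ _<_ (sym (perm₅ ∣ a - x ∣ _ _)) (sym (perm₅ ∣ a - x ∣ _ _))
       (+-monoˡ-< ∣ a - x ∣ (lower₀ (ψ-down< b y q) (ψ-up< c z p)))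

  approachable : ∀ t u → norm1 u ≡ norm1 t → ¬ u ≡ t → Approachable t u
  approachable = sign-normalise {Claim}
    (reflect neg₁-iso (λ { (x , y , z) (a , b , c) → cong (λ k → k + ψℤ 3 b y + ψℤ 4 c z) (ψℤ-neg 2 a x) }))
    (reflect neg₂-iso (λ { (x , y , z) (a , b , c) → cong (λ k → ψℤ 2 a x + k + ψℤ 4 c z) (ψℤ-neg 3 b y) }))
    (reflect neg₃-iso (λ { (x , y , z) (a , b , c) → cong (λ k → ψℤ 2 a x + ψℤ 3 b y + k) (ψℤ-neg 4 c z) }))
    approach
    where
    Claim : Vertex → Vertex → Set
    Claim t u = norm1 u ≡ norm1 t → ¬ u ≡ t → Approachable t u
    reflect : ∀ {f} → Isometry f → (∀ t u → Ψ (f t) (f u) ≡ Ψ t u) → ∀ t u → Claim (f t) (f u) → Claim t u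
    reflect {f} iso inv t u claim q r = approach-reflect iso inv t u
      (claim (trans (norm-pres u) (trans q (sym (norm-pres t)))) (≢-inv {f} involutive {u} {t} r))
      where open Isometry iso

-- Two-sided control of the searched distance.

module Balls where
  open import Defs
  open Angles using (_⊖_)
  open Transfers using (Ψ; Ψ≤; approachable; Approachable)
  open import Data.Nat
  open import Data.Nat.Properties
  open import Data.Integer as ℤ using (ℤ; +_; -[1+_]; ∣_∣)
  import Data.Integer.Properties as ℤ
  open import Data.List using (List; map; concatMap; length)
  open import Data.List.Relation.Unary.Any as Any using (Any; here)
  import Data.List.Membership.Propositional as L
  open import Data.List.Membership.Propositional.Properties using (∈-map⁺; ∈-concatMap⁺; ∈-concatMap⁻; ∈-filter⁺; ∈-filter⁻; ∈-upTo⁺; ∈-++⁺ˡ; ∈-++⁺ʳ; ∈-++⁻)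
  open import Data.Product using (Σ; _×_; _,_; proj₂)
  open import Data.Sum using (_⊎_; inj₁; inj₂)
  open import Data.Empty using (⊥-elim)
  open import Relation.Nullary using (yes; no)
  open import Relation.Binary.PropositionalEquality

  ∈-concatMap : ∀ {A B : Set} (f : A → List B) {xs : List A} {x y} → x L.∈ xs → y L.∈ f x → y L.∈ concatMap f xs
  ∈-concatMap f x∈ y∈ = ∈-concatMap⁺ f (Any.map (λ { refl → y∈ }) x∈)

  ∈-concatMap′ : ∀ {A B : Set} (f : A → List B) {xs : List A} {y} → y L.∈ concatMap f xs → Σ A λ x → x L.∈ xs × y L.∈ f x
  ∈-concatMap′ f y∈ = L.find (∈-concatMap⁻ f y∈)

  ∈-range : ∀ n x → ∣ x ∣ ≤ n → x L.∈ range n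
  ∈-range n (+ k) k≤n = subst (L._∈ range n) (eq n k) (∈-map⁺ (λ i → + i ℤ.- + n) (∈-upTo⁺ (s≤s (≤-trans (+-monoʳ-≤ n k≤n) (≤-reflexive (cong (λ s → n + s) (sym (+-identityʳ n))))))))
    where eq : ∀ n k → + (n + k) ℤ.- + n ≡ + k
          eq n k = trans (ℤ.m-n≡m⊖n (n + k) n) (trans (ℤ.⊖-≥ (m≤m+n n k)) (cong +_ (m+n∸m≡n n k)))
  ∈-range n -[1+ k ] k<n = subst (L._∈ range n) (trans (ℤ.m-n≡m⊖n (n ∸ suc k) n) (trans (ℤ.⊖-≤ (m∸n≤m n (suc k))) (cong (λ s → ℤ.- (+ s)) (m∸[m∸n]≡n k<n))))
    (∈-map⁺ (λ i → + i ℤ.- + n) (∈-upTo⁺ (s≤s (≤-trans (m∸n≤m n (suc k)) (m≤m+n n _)))))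

  ∈V⁺ : ∀ {n u} → norm1 u ≡ n → u ∈ V n
  ∈V⁺ {n} {u@(a , b , c)} refl = ∈-filter⁺ (λ u → norm1 u ≟ n)
    (∈-concatMap (λ x → concatMap (λ y → map (λ z → (x , y , z)) (range n)) (range n)) (∈-range n a (≤-trans (m≤m+n ∣ a ∣ ∣ b ∣) (m≤m+n (∣ a ∣ + ∣ b ∣) ∣ c ∣)))
      (∈-concatMap (λ y → map (λ z → (a , y , z)) (range n)) (∈-range n b (≤-trans (m≤n+m ∣ b ∣ ∣ a ∣) (m≤m+n (∣ a ∣ + ∣ b ∣) ∣ c ∣)))
        (∈-map⁺ (λ z → (a , b , z)) (∈-range n c (m≤n+m ∣ c ∣ (∣ a ∣ + ∣ b ∣))))))
    refl

  ∈V⁻ : ∀ {n u} → u ∈ V n → norm1 u ≡ n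
  ∈V⁻ {n} u∈ = proj₂ (∈-filter⁻ (λ u → norm1 u ≟ n) {xs = concatMap (λ x → concatMap (λ y → map (λ z → (x , y , z)) (range n)) (range n)) (range n)} u∈)

  ∈nbrs⁺ : ∀ {n u v} → norm1 v ≡ n → Adj u v → v ∈ nbrs n u
  ∈nbrs⁺ {n} {u} nv adj = ∈-filter⁺ (adj? u) (∈V⁺ nv) adj

  ball-step : ∀ {n} k {u v w} → v ∈ ball n k u → w ∈ nbrs n v → w ∈ ball n (suc k) u
  ball-step {n} k {u} v∈ w∈ = ∈-++⁺ʳ (ball n k u) (∈-concatMap (nbrs n) v∈ w∈)

  ball-trans : ∀ {n} k l {u v w} → v ∈ ball n k u → w ∈ ball n l v → w ∈ ball n (l + k) u
  ball-trans k zero v∈ (here refl) = v∈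
  ball-trans {n} k (suc l) {u} {v} v∈ w∈ with ∈-++⁻ (ball n l v) w∈
  ... | inj₁ p = ∈-++⁺ˡ (ball-trans k l v∈ p)
  ... | inj₂ p with ∈-concatMap′ (nbrs n) p
  ... | x , x∈ , w∈nbrs = ball-step {n} (l + k) (ball-trans {n} k l v∈ x∈) w∈nbrs

  ball-centre : ∀ n k u → u ∈ ball n k u
  ball-centre n zero u = here refl
  ball-centre n (suc k) u = ∈-++⁺ˡ (ball-centre n k u)

  ball-cons : ∀ {n} k {u v w} → v ∈ nbrs n u → w ∈ ball n k v → w ∈ ball n (suc k) u
  ball-cons {n} k {u} {v} {w} v∈ w∈ = subst (λ m → w ∈ ball n m u) (+-comm k 1) (ball-trans {n} 1 k {u} {v} {w} (ball-step {n} 0 {u} {u} {v} (here refl) v∈) w∈)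

  -- Each approaching neighbour lowers `Ψ t`, so its value bounds the length of a path to t.
  ball-reach : ∀ {n} k t u → norm1 t ≡ n → norm1 u ≡ n → Ψ t u ≤ k → t ∈ ball n k u
  ball-reach-step : ∀ {n} k t u → norm1 t ≡ n → norm1 u ≡ n → Ψ t u ≤ k → Approachable t u → t ∈ ball n k u
  ball-reach {n} k t u nt nu le with u ≟V t
  ... | yes refl = ball-centre n k u
  ... | no u≢t = ball-reach-step k t u nt nu le (approachable t u (trans nu (sym nt)) u≢t)
  ball-reach-step zero t u nt nu le (v , nv , adj , lt) = ⊥-elim (n≮0 (<-≤-trans lt le))
  ball-reach-step {n} (suc k) t u nt nu le (v , nv , adj , lt) =
    ball-cons {n} k (∈nbrs⁺ {n} {u} {v} (trans nv nu) adj) (ball-reach k t v nt (trans nv nu) (s≤s⁻¹ (<-≤-trans lt le)))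

  -- Valid for every amount of fuel: a search cut short returns its current radius, which has not
  -- yet passed m.
  distSearch≤ : ∀ n f k {m} u v → k ≤ m → v ∈ ball n m u → distSearch n f k u v ≤ m
  distSearch≤ n zero k u v k≤m v∈ = k≤m
  distSearch≤ n (suc f) k {m} u v k≤m v∈ with v ∈? ball n k u
  ... | yes _ = k≤m
  ... | no v∉ = distSearch≤ n f (suc k) u v (≤∧≢⇒< k≤m (λ { refl → v∉ v∈ })) v∈

  dist≤ : ∀ {n} u v → norm1 u ≡ n → norm1 v ≡ n → dist n u v ≤ 4 * norm1 (u ⊖ v)
  dist≤ {n} u v nu nv = ≤-trans (distSearch≤ n (length (V n)) 0 u v z≤n (ball-reach (Ψ v u) v u nv nu ≤-refl)) (Ψ≤ v u)

  Within : ℕ → Vertex → Vertex → Set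
  Within k (a , b , c) (d , e , f) = ∣ a ℤ.- d ∣ ≤ k × ∣ b ℤ.- e ∣ ≤ k × ∣ c ℤ.- f ∣ ≤ k

  ball-within : ∀ n k u w → w ∈ ball n k u → Within k u w
  ball-within n zero (a , b , c) w (here refl) = self a , self b , self c
    where self : ∀ i → ∣ i ℤ.- i ∣ ≤ 0
          self i = ≤-reflexive (cong ∣_∣ (ℤ.+-inverseʳ i))
  ball-within n (suc k) u@(a , b , c) w@(d , e , f) w∈ with ∈-++⁻ (ball n k u) w∈
  ... | inj₁ p = let (x , y , z) = ball-within n k u w p in m≤n⇒m≤1+n x , m≤n⇒m≤1+n y , m≤n⇒m≤1+n z
  ... | inj₂ p with ∈-concatMap′ (nbrs n) p
  ... | v@(x , y , z) , v∈ , w∈nbrs with ball-within n k u v v∈ | proj₂ (∈-filter⁻ (adj? v) {xs = V n} w∈nbrs)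
  ... | (p₁ , p₂ , p₃) | (_ , q₁ , q₂ , q₃) = tri a x d p₁ q₁ , tri b y e p₂ q₂ , tri c z f p₃ q₃
    where
    tri : ∀ a x d → ∣ a ℤ.- x ∣ ≤ k → ∣ x ℤ.- d ∣ ≤ 1 → ∣ a ℤ.- d ∣ ≤ suc k
    tri a x d p q = ≤-trans (≤-reflexive (cong ∣_∣ (eq a x d))) (≤-trans (ℤ.∣i+j∣≤∣i∣+∣j∣ (a ℤ.- x) (x ℤ.- d)) (≤-trans (+-mono-≤ p q) (≤-reflexive (+-comm k 1))))
      where open import Data.Integer.Tactic.RingSolver
            eq : ∀ a x d → a ℤ.- d ≡ (a ℤ.- x) ℤ.+ (x ℤ.- d)
            eq = solve-∀

  -- Exhausted fuel is kept as a second outcome; the value is then at least the initial fuel, which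
  -- is large enough for lower bounds on `dist`.
  distSearch-result : ∀ n f k u v → v ∈ ball n (distSearch n f k u v) u ⊎ f + k ≤ distSearch n f k u v
  distSearch-result n zero k u v = inj₂ ≤-refl
  distSearch-result n (suc f) k u v with v ∈? ball n k u
  ... | yes v∈ = inj₁ v∈
  ... | no _ with distSearch-result n f (suc k) u v
  ... | inj₁ p = inj₁ p
  ... | inj₂ p = inj₂ (≤-trans (≤-reflexive (sym (+-suc f k))) p)

-- Natural numbers and their reciprocals in ℚ.

module Rationals where
  open import Defs using (recipℕ; inv)
  open import Data.Nat as ℕ using (ℕ; zero; suc; z≤n)
  import Data.Nat.Properties as ℕ
  open import Data.Integer as ℤ using (ℤ; +_; -[1+_])
  import Data.Integer.Properties as ℤ
  open import Data.Rational
  open import Data.Rational.Properties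
  open import Data.Rational.Unnormalised as ℚᵘ using (ℚᵘ; mkℚᵘ)
  import Data.Rational.Unnormalised.Properties as ℚᵘ
  open import Data.Rational.Solver using (module +-*-Solver)
  open +-*-Solver using (solve; _:+_; _:*_; _:=_)
  open import Relation.Binary.PropositionalEquality

  q : ℕ → ℚ
  q k = + k / 1

  *≤ : ∀ {k x y} → 0ℚ ≤ k → x ≤ y → k * x ≤ k * y
  *≤ {k} 0≤k le = *-monoˡ-≤-nonNeg k {{nonNegative 0≤k}} le

  *≤ʳ : ∀ {k x y} → 0ℚ ≤ k → x ≤ y → x * k ≤ y * k
  *≤ʳ {k} 0≤k le = *-monoʳ-≤-nonNeg k {{nonNegative 0≤k}} le

  0≤* : ∀ {x y} → 0ℚ ≤ x → 0ℚ ≤ y → 0ℚ ≤ x * y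
  0≤* {x} {y} p r = subst (_≤ x * y) (*-zeroʳ x) (*≤ p r)

  0≤+ : ∀ {x y} → 0ℚ ≤ x → 0ℚ ≤ y → 0ℚ ≤ x + y
  0≤+ p r = +-mono-≤ p r

  private
    qᵘ : ℕ → ℚᵘ
    qᵘ k = mkℚᵘ (+ k) 0

    to-q : ∀ k → toℚᵘ (q k) ℚᵘ.≃ qᵘ k
    to-q k = toℚᵘ-fromℚᵘ (qᵘ k)

  -- Normalisation of fractions blocks computation on variables, so the identity is checked on
  -- unnormalised representatives.
  q-+ : ∀ a b → q (a ℕ.+ b) ≡ q a + q b
  q-+ a b = toℚᵘ-injective (ℚᵘ.≃-trans (to-q (a ℕ.+ b)) (ℚᵘ.≃-trans (ℚᵘ.*≡* (cong (ℤ._* + 1) (sym (cong₂ ℤ._+_ (ℤ.*-identityʳ (+ a)) (ℤ.*-identityʳ (+ b)))))) (ℚᵘ.≃-sym (ℚᵘ.≃-trans (toℚᵘ-homo-+ (q a) (q b)) (ℚᵘ.+-cong (to-q a) (to-q b))))))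

  q-* : ∀ a b → q (a ℕ.* b) ≡ q a * q b
  q-* a b = toℚᵘ-injective (ℚᵘ.≃-trans (to-q (a ℕ.* b)) (ℚᵘ.≃-trans (ℚᵘ.*≡* (cong (ℤ._* + 1) (ℤ.pos-* a b))) (ℚᵘ.≃-sym (ℚᵘ.≃-trans (toℚᵘ-homo-* (q a) (q b)) (ℚᵘ.*-cong (to-q a) (to-q b))))))

  q-mono : ∀ {a b} → a ℕ.≤ b → q a ≤ q b
  q-mono {a} {b} le = toℚᵘ-cancel-≤ (ℚᵘ.≤-respˡ-≃ (ℚᵘ.≃-sym (to-q a)) (ℚᵘ.≤-respʳ-≃ (ℚᵘ.≃-sym (to-q b)) (ℚᵘ.*≤* (ℤ.*-monoʳ-≤-nonNeg (+ 1) (ℤ.+≤+ le)))))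

  0≤q : ∀ k → 0ℚ ≤ q k
  0≤q k = q-mono {0} {k} z≤n

  q*recip : ∀ k → q (suc k) * recipℕ (suc k) ≡ 1ℚ
  q*recip k = toℚᵘ-injective (ℚᵘ.≃-trans (toℚᵘ-homo-* (q (suc k)) (recipℕ (suc k))) (ℚᵘ.≃-trans (ℚᵘ.*-cong (to-q (suc k)) (toℚᵘ-fromℚᵘ (mkℚᵘ (+ 1) k)))
     (ℚᵘ.*≡* (trans (ℤ.*-identityʳ (+ suc k ℤ.* + 1)) (trans (ℤ.*-identityʳ (+ suc k)) (trans (cong (λ s → + suc s) (sym (ℕ.+-identityʳ k))) (sym (ℤ.*-identityˡ (+ (suc (k ℕ.+ 0)))))))))))

  0≤recip : ∀ k → 0ℚ ≤ recipℕ k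
  0≤recip zero = ≤-refl
  0≤recip (suc k) = nonNegative⁻¹ (recipℕ (suc k)) {{normalize-nonNeg 1 (suc k)}}

  recip-unique : ∀ k {s} → q (suc k) * s ≡ 1ℚ → s ≡ recipℕ (suc k)
  recip-unique k {s} eq = begin
    s                              ≡⟨ sym (*-identityʳ s) ⟩
    s * 1ℚ                         ≡⟨ cong (s *_) (sym (q*recip k)) ⟩
    s * (q (suc k) * recipℕ (suc k)) ≡⟨ solve 3 (λ s x r → s :* (x :* r) := (x :* s) :* r) refl s (q (suc k)) (recipℕ (suc k)) ⟩
    (q (suc k) * s) * recipℕ (suc k) ≡⟨ cong (_* recipℕ (suc k)) eq ⟩
    1ℚ * recipℕ (suc k)             ≡⟨ *-identityˡ _ ⟩
    recipℕ (suc k) ∎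
    where open ≡-Reasoning

  recip-* : ∀ a b → recipℕ (suc a ℕ.* suc b) ≡ recipℕ (suc a) * recipℕ (suc b)
  recip-* a b = sym (recip-unique (b ℕ.+ a ℕ.* suc b) (begin
    q (suc a ℕ.* suc b) * (recipℕ (suc a) * recipℕ (suc b))    ≡⟨ cong (_* (recipℕ (suc a) * recipℕ (suc b))) (q-* (suc a) (suc b)) ⟩
    (x * y) * (r * s)                                           ≡⟨ solve 4 (λ x y r s → (x :* y) :* (r :* s) := (x :* r) :* (y :* s)) refl x y r s ⟩
    (x * r) * (y * s)                                           ≡⟨ cong₂ _*_ (q*recip a) (q*recip b) ⟩
    1ℚ ∎))
    where
    open ≡-Reasoning
    x = q (suc a)
    y = q (suc b)
    r = recipℕ (suc a)
    s = recipℕ (suc b)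

  recip-telescope : ∀ m → recipℕ (suc m) ≡ recipℕ (suc (suc m)) + recipℕ (suc m ℕ.* suc (suc m))
  recip-telescope m = begin
    r                       ≡⟨ sym (*-identityʳ r) ⟩
    r * 1ℚ                  ≡⟨ cong (r *_) (sym (q*recip (suc m))) ⟩
    r * (q (2 ℕ.+ m) * s)   ≡⟨ cong (λ z → r * (z * s)) (q-+ 1 (suc m)) ⟩
    r * ((1ℚ + x) * s)      ≡⟨ solve 4 (λ r x s o → r :* ((o :+ x) :* s) := (x :* r) :* s :+ o :* (r :* s)) refl r x s 1ℚ ⟩
    (x * r) * s + 1ℚ * (r * s)   ≡⟨ cong₂ _+_ (trans (cong (_* s) (q*recip m)) (*-identityˡ s)) (trans (*-identityˡ _) (sym (recip-* m (suc m)))) ⟩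
    s + recipℕ (suc m ℕ.* suc (suc m)) ∎
    where
    open ≡-Reasoning
    x = q (suc m)
    r = recipℕ (suc m)
    s = recipℕ (suc (suc m))

  recip≤ : ∀ k a b → 1 ℕ.≤ a → 1 ℕ.≤ b → a ℕ.≤ k ℕ.* b → recipℕ b ≤ q k * recipℕ a
  recip≤ k (suc a) (suc b) _ _ le = begin
    s                 ≡⟨ sym (*-identityʳ s) ⟩
    s * 1ℚ            ≡⟨ cong (s *_) (sym (q*recip a)) ⟩
    s * (q (suc a) * r)   ≤⟨ *≤ (0≤recip (suc b)) (*≤ʳ (0≤recip (suc a)) (q-mono le)) ⟩
    s * (q (k ℕ.* suc b) * r) ≡⟨ cong (λ z → s * (z * r)) (q-* k (suc b)) ⟩
    s * ((q k * q (suc b)) * r)  ≡⟨ solve 4 (λ s k b r → s :* ((k :* b) :* r) := (b :* s) :* (k :* r)) refl s (q k) (q (suc b)) r ⟩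
    (q (suc b) * s) * (q k * r)  ≡⟨ trans (cong (_* (q k * r)) (q*recip b)) (*-identityˡ _) ⟩
    q k * r ∎
    where
    open ≤-Reasoning
    r = recipℕ (suc a)
    s = recipℕ (suc b)

  0<recip : ∀ k → 0ℚ < recipℕ (suc k)
  0<recip k = positive⁻¹ (recipℕ (suc k)) {{normalize-pos 1 (suc k)}}

  inv*self : ∀ p → 0ℚ < p → inv p * p ≡ 1ℚ
  inv*self p@(mkℚ (+ suc _) _ _) _ = *-inverseˡ p
  inv*self (mkℚ (+ zero) _ _) (*<* (ℤ.+<+ ()))
  inv*self (mkℚ -[1+ _ ] _ _) (*<* ())

  0≤inv : ∀ p → 0ℚ < p → 0ℚ ≤ inv p
  0≤inv p@(mkℚ (+ suc _) _ _) _ = nonNegative⁻¹ (1/ p) {{pos⇒nonNeg (1/ p) {{1/pos⇒pos p}}}}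
  0≤inv (mkℚ (+ zero) _ _) (*<* (ℤ.+<+ ()))
  0≤inv (mkℚ -[1+ _ ] _ _) (*<* ())

-- Finite sums, telescoping and harmonic bounds.

module Sums where
  open import Defs using (sumℚ; recipℕ)
  open Rationals
  open import Data.Nat as ℕ using (ℕ; zero; suc; s≤s; z≤n; ∣_-_∣)
  import Data.Nat.Properties as ℕ
  open import Data.Rational hiding (∣_∣; _-_; -_)
  open import Data.Rational.Properties
  open import Data.Rational.Solver using (module +-*-Solver)
  open +-*-Solver using (solve; _:+_; _:=_)
  open import Data.List using (List; []; _∷_; map; concatMap; upTo; applyUpTo; _++_)
  open import Data.List.Relation.Unary.Any using (here; there)
  import Data.List.Relation.Unary.All as All
  open import Data.List.Relation.Unary.All using (All; []; _∷_)
  open import Data.List.Relation.Unary.AllPairs using ([]; _∷_)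
  open import Data.List.Relation.Unary.Unique.Propositional using (Unique)
  open import Data.List.Membership.Propositional
  open import Data.List.Membership.Propositional.Properties using (∈-∃++; ∈-++⁻; ∈-++⁺ˡ; ∈-++⁺ʳ)
  open import Data.Product using (_,_)
  open import Data.Sum using (inj₁; inj₂)
  open import Data.Empty using (⊥-elim)
  open import Function using (_∘_; id)
  open import Relation.Binary.PropositionalEquality

  ∑ : ∀ {A : Set} → List A → (A → ℚ) → ℚ
  ∑ xs f = sumℚ (map f xs)

  module _ {A : Set} where
    ∑-mono : ∀ (xs : List A) {f g} → (∀ x → x ∈ xs → f x ≤ g x) → ∑ xs f ≤ ∑ xs g
    ∑-mono [] h = ≤-refl
    ∑-mono (x ∷ xs) h = +-mono-≤ (h x (here refl)) (∑-mono xs (λ y y∈ → h y (there y∈)))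

    ∑-cong : ∀ (xs : List A) {f g} → (∀ x → f x ≡ g x) → ∑ xs f ≡ ∑ xs g
    ∑-cong [] h = refl
    ∑-cong (x ∷ xs) h = cong₂ _+_ (h x) (∑-cong xs h)

    ∑-+ : ∀ (xs : List A) f g → ∑ xs (λ x → f x + g x) ≡ ∑ xs f + ∑ xs g
    ∑-+ [] f g = refl
    ∑-+ (x ∷ xs) f g = trans (cong ((f x + g x) +_) (∑-+ xs f g))
      (solve 4 (λ a b c d → (a :+ b) :+ (c :+ d) := (a :+ c) :+ (b :+ d)) refl (f x) (g x) (∑ xs f) (∑ xs g))

    ∑-*ˡ : ∀ (xs : List A) k f → ∑ xs (λ x → k * f x) ≡ k * ∑ xs f
    ∑-*ˡ [] k f = sym (*-zeroʳ k)
    ∑-*ˡ (x ∷ xs) k f = trans (cong (k * f x +_) (∑-*ˡ xs k f)) (sym (*-distribˡ-+ k (f x) (∑ xs f)))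

    ∑-*ʳ : ∀ (xs : List A) k f → ∑ xs (λ x → f x * k) ≡ ∑ xs f * k
    ∑-*ʳ xs k f = trans (∑-cong xs (λ x → *-comm (f x) k)) (trans (∑-*ˡ xs k f) (*-comm k (∑ xs f)))

    ∑-++ : ∀ (xs ys : List A) f → ∑ (xs ++ ys) f ≡ ∑ xs f + ∑ ys f
    ∑-++ [] ys f = sym (+-identityˡ (∑ ys f))
    ∑-++ (x ∷ xs) ys f = trans (cong (f x +_) (∑-++ xs ys f)) (sym (+-assoc (f x) (∑ xs f) (∑ ys f)))

    0≤∑ : ∀ (xs : List A) {f} → (∀ x → 0ℚ ≤ f x) → 0ℚ ≤ ∑ xs f
    0≤∑ [] h = ≤-refl
    0≤∑ (x ∷ xs) h = 0≤+ (h x) (0≤∑ xs h)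

    ∑-⊆ : ∀ {xs ys : List A} {f} → (∀ x → 0ℚ ≤ f x) → Unique xs → (∀ {x} → x ∈ xs → x ∈ ys) → ∑ xs f ≤ ∑ ys f
    ∑-⊆ {[]} {ys} h _ _ = 0≤∑ ys h
    ∑-⊆ {x ∷ xs} {ys} {f} h (x∉ ∷ uniq) sub with ∈-∃++ (sub (here refl))
    ... | as , bs , refl = begin
        f x + ∑ xs f             ≤⟨ +-monoʳ-≤ (f x) (∑-⊆ h uniq sub′) ⟩
        f x + ∑ (as ++ bs) f     ≡⟨ cong (f x +_) (∑-++ as bs f) ⟩
        f x + (∑ as f + ∑ bs f)  ≡⟨ solve 3 (λ a b c → a :+ (b :+ c) := b :+ (a :+ c)) refl (f x) (∑ as f) (∑ bs f) ⟩
        ∑ as f + (f x + ∑ bs f)  ≡⟨ sym (∑-++ as (x ∷ bs) f) ⟩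
        ∑ (as ++ x ∷ bs) f ∎
      where
      open ≤-Reasoning
      sub′ : ∀ {y} → y ∈ xs → y ∈ as ++ bs
      sub′ {y} y∈ with ∈-++⁻ as (sub (there y∈))
      ... | inj₁ p = ∈-++⁺ˡ p
      ... | inj₂ (here refl) = ⊥-elim (All.lookup x∉ y∈ refl)
      ... | inj₂ (there p) = ∈-++⁺ʳ as p

  ∑-map : ∀ {A B : Set} (xs : List A) (h : A → B) f → ∑ (map h xs) f ≡ ∑ xs (f ∘ h)
  ∑-map [] h f = refl
  ∑-map (x ∷ xs) h f = cong (f (h x) +_) (∑-map xs h f)

  ∑-concatMap : ∀ {A B : Set} (xs : List A) (h : A → List B) f → ∑ (concatMap h xs) f ≡ ∑ xs (λ x → ∑ (h x) f)
  ∑-concatMap [] h f = refl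
  ∑-concatMap (x ∷ xs) h f = trans (∑-++ (h x) (concatMap h xs) f) (cong (∑ (h x) f +_) (∑-concatMap xs h f))

  ∑< : ℕ → (ℕ → ℚ) → ℚ
  ∑< zero f = 0ℚ
  ∑< (suc m) f = f 0 + ∑< m (f ∘ suc)

  ∑-applyUpTo : ∀ m (h : ℕ → ℕ) f → ∑ (applyUpTo h m) f ≡ ∑< m (f ∘ h)
  ∑-applyUpTo zero h f = refl
  ∑-applyUpTo (suc m) h f = cong (f (h 0) +_) (∑-applyUpTo m (h ∘ suc) f)

  ∑-upTo : ∀ m f → ∑ (upTo m) f ≡ ∑< m f
  ∑-upTo m f = ∑-applyUpTo m id f

  ∑<-cong : ∀ m {f g} → (∀ i → f i ≡ g i) → ∑< m f ≡ ∑< m g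
  ∑<-cong zero h = refl
  ∑<-cong (suc m) h = cong₂ _+_ (h 0) (∑<-cong m (h ∘ suc))

  ∑<-mono : ∀ m {f g} → (∀ i → i ℕ.< m → f i ≤ g i) → ∑< m f ≤ ∑< m g
  ∑<-mono zero h = ≤-refl
  ∑<-mono (suc m) h = +-mono-≤ (h 0 (s≤s z≤n)) (∑<-mono m (λ i i<m → h (suc i) (s≤s i<m)))

  0≤∑< : ∀ m {f} → (∀ i → 0ℚ ≤ f i) → 0ℚ ≤ ∑< m f
  0≤∑< zero h = ≤-refl
  0≤∑< (suc m) h = 0≤+ (h 0) (0≤∑< m (h ∘ suc))

  ∑<-split : ∀ a b f → ∑< (a ℕ.+ b) f ≡ ∑< a f + ∑< b (λ i → f (a ℕ.+ i))
  ∑<-split zero b f = sym (+-identityˡ _)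
  ∑<-split (suc a) b f = trans (cong (f 0 +_) (∑<-split a b (f ∘ suc))) (sym (+-assoc (f 0) _ _))

  ∑<-*ˡ : ∀ m k f → ∑< m (λ i → k * f i) ≡ k * ∑< m f
  ∑<-*ˡ zero k f = sym (*-zeroʳ k)
  ∑<-*ˡ (suc m) k f = trans (cong (k * f 0 +_) (∑<-*ˡ m k (f ∘ suc))) (sym (*-distribˡ-+ k (f 0) _))

  ∑<-const : ∀ m c → ∑< m (λ _ → c) ≡ q m * c
  ∑<-const zero c = sym (*-zeroˡ c)
  ∑<-const (suc m) c = begin
    c + ∑< m (λ _ → c)    ≡⟨ cong₂ _+_ (sym (*-identityˡ c)) (∑<-const m c) ⟩
    1ℚ * c + q m * c      ≡⟨ sym (*-distribʳ-+ c 1ℚ (q m)) ⟩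
    (1ℚ + q m) * c        ≡⟨ cong (_* c) (sym (q-+ 1 m)) ⟩
    q (suc m) * c ∎
    where open ≡-Reasoning

  ∑<-snoc : ∀ m f → ∑< (suc m) f ≡ ∑< m f + f m
  ∑<-snoc m f = trans (cong (λ k → ∑< k f) (ℕ.+-comm 1 m)) (trans (∑<-split m 1 f) (cong (∑< m f +_) (trans (+-identityʳ _) (cong f (ℕ.+-identityʳ m)))))

  ∑<-mono-len : ∀ {a b} f → (∀ i → 0ℚ ≤ f i) → a ℕ.≤ b → ∑< a f ≤ ∑< b f
  ∑<-mono-len {zero} {b} f h z≤n = 0≤∑< b h
  ∑<-mono-len {suc a} {suc b} f h (s≤s le) = +-monoʳ-≤ (f 0) (∑<-mono-len (f ∘ suc) (h ∘ suc) le)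

  -- Offsets to the left of β lie among 1, ..., β and those from β onwards among 0, ..., m - 1.
  ∑<-reflect : ∀ m β f → (∀ i → 0ℚ ≤ f i) → ∑< m (λ i → f ∣ β - i ∣) ≤ ∑< β (f ∘ suc) + ∑< m f
  ∑<-reflect m zero f h = ≤-reflexive (sym (+-identityˡ (∑< m f)))
  ∑<-reflect zero (suc β) f h = 0≤+ (0≤∑< (suc β) (h ∘ suc)) ≤-refl
  ∑<-reflect (suc m) (suc β) f h = begin
    f (suc β) + ∑< m (λ i → f ∣ β - i ∣)             ≤⟨ +-monoʳ-≤ (f (suc β)) (∑<-reflect m β f h) ⟩
    f (suc β) + (∑< β (f ∘ suc) + ∑< m f)            ≡⟨ solve 3 (λ a b c → a :+ (b :+ c) := (b :+ a) :+ c) refl (f (suc β)) (∑< β (f ∘ suc)) (∑< m f) ⟩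
    (∑< β (f ∘ suc) + f (suc β)) + ∑< m f            ≡⟨ cong (_+ ∑< m f) (sym (∑<-snoc β (f ∘ suc))) ⟩
    ∑< (suc β) (f ∘ suc) + ∑< m f                    ≤⟨ +-monoʳ-≤ (∑< (suc β) (f ∘ suc)) (∑<-mono-len f h (ℕ.n≤1+n m)) ⟩
    ∑< (suc β) (f ∘ suc) + ∑< (suc m) f ∎
    where open ≤-Reasoning

  ∑<-∣-∣ : ∀ m β f → (∀ i → 0ℚ ≤ f i) → β ℕ.< m → ∑< m (λ i → f ∣ β - i ∣) ≤ ∑< m f + ∑< m f
  ∑<-∣-∣ m β f h β<m = ≤-trans (∑<-reflect m β f h) (+-monoˡ-≤ (∑< m f)
    (≤-trans (subst (_≤ f 0 + ∑< β (f ∘ suc)) (+-identityˡ (∑< β (f ∘ suc))) (+-monoˡ-≤ (∑< β (f ∘ suc)) (h 0))) (∑<-mono-len f h β<m)))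

  -- The products (s + 1)(s + 2) stand in for squares because their reciprocals telescope.
  ∑<-inverse-square : ∀ m p → ∑< m (λ i → recipℕ (suc (p ℕ.+ i) ℕ.* suc (suc (p ℕ.+ i)))) ≤ recipℕ (suc p)
  ∑<-inverse-square zero p = 0≤recip (suc p)
  ∑<-inverse-square (suc m) p = begin
    T (p ℕ.+ 0) + ∑< m (λ i → T (p ℕ.+ suc i))    ≡⟨ cong₂ _+_ (cong T (ℕ.+-identityʳ p)) (∑<-cong m (λ i → cong T (ℕ.+-suc p i))) ⟩
    T p + ∑< m (λ i → T (suc p ℕ.+ i))            ≤⟨ +-monoʳ-≤ (T p) (∑<-inverse-square m (suc p)) ⟩
    T p + recipℕ (suc (suc p))                     ≡⟨ +-comm (T p) _ ⟩
    recipℕ (suc (suc p)) + T p                     ≡⟨ sym (recip-telescope p) ⟩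
    recipℕ (suc p) ∎
    where
    open ≤-Reasoning
    T : ℕ → ℚ
    T s = recipℕ (suc s ℕ.* suc (suc s))

  -- Each doubling of the range from m to 2m adds m terms of size at most 1/m.
  harmonic : ∀ k → ∑< (2 ℕ.^ k) (λ i → recipℕ (suc i)) ≤ q (suc k)
  harmonic zero = ≤-refl
  harmonic (suc k) = begin
    ∑< (m ℕ.+ (m ℕ.+ 0)) r              ≡⟨ cong (λ z → ∑< (m ℕ.+ z) r) (ℕ.+-identityʳ m) ⟩
    ∑< (m ℕ.+ m) r                      ≡⟨ ∑<-split m m r ⟩
    ∑< m r + ∑< m (λ i → r (m ℕ.+ i))   ≤⟨ +-mono-≤ (harmonic k) (≤-trans (∑<-mono m (λ i _ → block i)) (≤-reflexive (trans (∑<-const m (recipℕ m)) m/m))) ⟩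
    q (suc k) + 1ℚ                       ≡⟨ +-comm (q (suc k)) 1ℚ ⟩
    1ℚ + q (suc k)                       ≡⟨ sym (q-+ 1 (suc k)) ⟩
    q (suc (suc k)) ∎
    where
    open ≤-Reasoning
    m = 2 ℕ.^ k
    r : ℕ → ℚ
    r i = recipℕ (suc i)
    1≤m : 1 ℕ.≤ m
    1≤m = ℕ.m^n>0 2 k
    m/m : q m * recipℕ m ≡ 1ℚ
    m/m with m | 1≤m
    ... | suc m′ | _ = q*recip m′
    block : ∀ i → r (m ℕ.+ i) ≤ recipℕ m
    block i = subst (r (m ℕ.+ i) ≤_) (*-identityˡ (recipℕ m)) (recip≤ 1 m (suc (m ℕ.+ i)) 1≤m (s≤s z≤n)
       (ℕ.≤-trans (ℕ.≤-trans (ℕ.m≤m+n m i) (ℕ.n≤1+n _)) (ℕ.≤-reflexive (sym (ℕ.+-identityʳ _)))))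

-- Upper bound for the normalising sum of inverse squares.

module Normalisation where
  open import Defs
  open Transfers using (∣+-+∣)
  open Balls
  open Rationals
  open Sums
  open import Data.Nat as ℕ using (ℕ; zero; suc; s≤s; z≤n; ∣_-_∣)
  import Data.Nat.Properties as ℕ
  open import Data.Nat.Tactic.RingSolver using (solve-∀)
  open import Data.Integer as ℤ using (ℤ; +_; -[1+_]; ∣_∣)
  import Data.Integer.Properties as ℤ
  open import Data.Rational using (ℚ; 0ℚ; _+_; _*_; _≤_)
  open import Data.Rational.Properties using (≤-trans; ≤-reflexive; +-mono-≤; module ≤-Reasoning; *-assoc; *-identityˡ; +-identityʳ; *-distribʳ-+)
  open import Data.List using (List; []; _∷_; map; concatMap; upTo; length; _++_)
  open import Data.List.Properties using (length-map; length-upTo; length-++)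
  open import Data.List.Relation.Unary.Any using (here; there)
  import Data.List.Relation.Unary.All as All
  open import Data.List.Relation.Unary.All using (All; []; _∷_)
  open import Data.List.Relation.Unary.AllPairs using ([]; _∷_)
  open import Data.List.Relation.Unary.Unique.Propositional using (Unique)
  import Data.List.Relation.Unary.Unique.Propositional.Properties as Uniq
  import Data.List.Membership.Propositional as L
  open import Data.List.Membership.Propositional.Properties using (∈-map⁻; ∈-filter⁻; ∈-filter⁺; ∈-∃++; ∈-++⁻; ∈-++⁺ˡ; ∈-++⁺ʳ; ∈-upTo⁻)
  open import Data.Product using (_×_; _,_; proj₁; proj₂)
  open import Data.Sum using (inj₁; inj₂)
  open import Data.Empty using (⊥-elim)
  open import Relation.Nullary using (¬_; ¬?)
  open import Relation.Binary.PropositionalEquality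

  -- The map π recovers the block to which an element belongs, so distinct blocks are disjoint.
  unique-concatMap : ∀ {A B : Set} (h : A → List B) (π : B → A) → (∀ {x y} → y L.∈ h x → π y ≡ x) → (∀ x → Unique (h x)) →
    ∀ {xs} → Unique xs → Unique (concatMap h xs)
  unique-concatMap h π fib uh {[]} _ = []
  unique-concatMap h π fib uh {x ∷ xs} (x∉ ∷ u) = Uniq.++⁺ (uh x) (unique-concatMap h π fib uh u)
    λ { (y∈ , y∈′) → let (x′ , x′∈ , y∈″) = ∈-concatMap′ h y∈′ in All.lookup x∉ x′∈ (trans (sym (fib y∈)) (fib y∈″)) }

  unique-length : ∀ {A : Set} {xs ys : List A} → Unique xs → (∀ {x} → x L.∈ xs → x L.∈ ys) → length xs ℕ.≤ length ys
  unique-length {xs = []} _ _ = z≤n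
  unique-length {xs = x ∷ xs} {ys} (x∉ ∷ uniq) sub with ∈-∃++ (sub (here refl))
  ... | as , bs , refl = ℕ.≤-trans (s≤s (unique-length uniq sub′))
        (ℕ.≤-reflexive (trans (cong suc (length-++ as)) (trans (sym (ℕ.+-suc (length as) (length bs))) (sym (length-++ as)))))
    where
    sub′ : ∀ {y} → y L.∈ xs → y L.∈ as ++ bs
    sub′ {y} y∈ with ∈-++⁻ as (sub (there y∈))
    ... | inj₁ p = ∈-++⁺ˡ p
    ... | inj₂ (here refl) = ⊥-elim (All.lookup x∉ y∈ refl)
    ... | inj₂ (there p) = ∈-++⁺ʳ as p

  unique-range : ∀ n → Unique (range n)
  unique-range n = Uniq.map⁺ (λ {i} {j} eq → ℤ.+-injective (trans (sym (cancel (+ i) (+ n))) (trans (cong (ℤ._+ + n) eq) (cancel (+ j) (+ n))))) (Uniq.upTo⁺ (suc (2 ℕ.* n)))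
    where cancel : ∀ i n → (i ℤ.- n) ℤ.+ n ≡ i
          cancel i n = trans (ℤ.+-assoc i (ℤ.- n) n) (trans (cong (λ z → i ℤ.+ z) (ℤ.+-inverseˡ n)) (ℤ.+-identityʳ i))

  unique-V : ∀ n → Unique (V n)
  unique-V n = Uniq.filter⁺ (λ u → norm1 u ℕ.≟ n)
    (unique-concatMap plane proj₁ (λ {x} p → let (y , _ , p′) = ∈-concatMap′ (line x) {range n} p ; (z , _ , eq) = ∈-map⁻ (λ z → (x , y , z)) p′ in cong proj₁ eq)
      (λ x → unique-concatMap (line x) (λ w → proj₁ (proj₂ w)) (λ {y} p → let (z , _ , eq) = ∈-map⁻ (λ z → (x , y , z)) p in cong (λ w → proj₁ (proj₂ w)) eq)
         (λ y → Uniq.map⁺ (λ eq → cong (λ w → proj₂ (proj₂ w)) eq) (unique-range n)) (unique-range n))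
      (unique-range n))
    where
    line : ℤ → ℤ → List Vertex
    line x y = map (λ z → (x , y , z)) (range n)
    plane : ℤ → List Vertex
    plane x = concatMap (line x) (range n)

  ∈others⁺ : ∀ {n u w} → norm1 w ≡ n → ¬ w ≡ u → w ∈ others n u
  ∈others⁺ {n} {u} nw ne = ∈-filter⁺ (λ w → ¬? (w ≟V u)) (∈V⁺ nw) ne

  ∈others⁻ : ∀ {n u w} → w ∈ others n u → norm1 w ≡ n × ¬ w ≡ u
  ∈others⁻ {n} {u} {w} w∈ = let (p , ne) = ∈-filter⁻ (λ w → ¬? (w ≟V u)) {xs = V n} w∈ in ∈V⁻ {n} {w} p , ne

  unique-others : ∀ n u → Unique (others n u)
  unique-others n u = Uniq.filter⁺ (λ w → ¬? (w ≟V u)) (unique-V n)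

  -- One edge of the octahedron already has n + 1 vertices. This measures the fuel of `dist` against
  -- coordinate differences.
  length-V : ∀ n → suc n ℕ.≤ length (V n)
  length-V n = subst (ℕ._≤ length (V n)) (trans (length-map edge (upTo (suc n))) (length-upTo (suc n)))
    (unique-length (Uniq.map⁺ (λ eq → ℤ.+-injective (cong proj₁ eq)) (Uniq.upTo⁺ (suc n)))
      (λ {w} w∈ → let (i , i∈ , eq) = ∈-map⁻ edge w∈ in subst (_∈ V n) (sym eq) (∈V⁺ (trans (ℕ.+-identityʳ _) (ℕ.m+[n∸m]≡n (ℕ.s≤s⁻¹ (∈-upTo⁻ i∈)))))))
    where
    edge : ℕ → Vertex
    edge i = (+ i , + (n ℕ.∸ i) , + 0)

  -- Two coordinates suffice, because they determine the third up to sign. A step changes each by at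
  -- most 1, which gives 2d; the factor 3 makes the bound strict.
  dist-lower : ∀ n u w → norm1 u ≡ n → norm1 w ≡ n → ¬ w ≡ u →
    ∣ proj₁ u ℤ.- proj₁ w ∣ ℕ.+ ∣ proj₁ (proj₂ u) ℤ.- proj₁ (proj₂ w) ∣ ℕ.< 3 ℕ.* dist n u w
  dist-lower n u@(a , b , c) w@(x , y , z) nu nw ne with distSearch-result n (length (V n)) 0 u w
  -- If the search ran out of fuel, the returned value exceeds n, while the two differences sum to
  -- at most 2n.
  ... | inj₂ far = begin-strict
      ∣ a ℤ.- x ∣ ℕ.+ ∣ b ℤ.- y ∣             ≤⟨ ℕ.+-mono-≤ (ℤ.∣i-j∣≤∣i∣+∣j∣ a x) (ℤ.∣i-j∣≤∣i∣+∣j∣ b y) ⟩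
      (∣ a ∣ ℕ.+ ∣ x ∣) ℕ.+ (∣ b ∣ ℕ.+ ∣ y ∣)  ≡⟨ rearr (∣ a ∣) (∣ x ∣) (∣ b ∣) (∣ y ∣) ⟩
      (∣ a ∣ ℕ.+ ∣ b ∣) ℕ.+ (∣ x ∣ ℕ.+ ∣ y ∣)  ≤⟨ ℕ.+-mono-≤ (ℕ.m≤m+n (∣ a ∣ ℕ.+ ∣ b ∣) ∣ c ∣) (ℕ.m≤m+n (∣ x ∣ ℕ.+ ∣ y ∣) ∣ z ∣) ⟩
      norm1 u ℕ.+ norm1 w                      ≡⟨ cong₂ ℕ._+_ nu nw ⟩
      n ℕ.+ n                                  <⟨ ℕ.+-mono-< (ℕ.n<1+n n) (ℕ.n<1+n n) ⟩
      suc n ℕ.+ suc n                          ≤⟨ ℕ.+-mono-≤ d≥ (ℕ.≤-trans d≥ (ℕ.m≤m+n _ _)) ⟩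
      3 ℕ.* dist n u w ∎
    where
    open ℕ.≤-Reasoning
    rearr : ∀ a x b y → (a ℕ.+ x) ℕ.+ (b ℕ.+ y) ≡ (a ℕ.+ b) ℕ.+ (x ℕ.+ y)
    rearr = solve-∀
    d≥ : suc n ℕ.≤ dist n u w
    d≥ = ℕ.≤-trans (length-V n) (ℕ.≤-trans (ℕ.≤-reflexive (sym (ℕ.+-identityʳ _))) far)
  ... | inj₁ near = bound (dist n u w) near
    where
    bound : ∀ d → w ∈ ball n d u → ∣ a ℤ.- x ∣ ℕ.+ ∣ b ℤ.- y ∣ ℕ.< 3 ℕ.* d
    bound zero (here eq) = ⊥-elim (ne eq)
    bound d@(suc d′) w∈ = let (p , r , _) = ball-within n d u w w∈ in
      ℕ.<-≤-trans (s≤s (ℕ.+-mono-≤ p r)) (ℕ.≤-trans (ℕ.≤-reflexive (ℕ.+-comm 1 (d ℕ.+ d))) (ℕ.≤-trans (ℕ.+-monoʳ-≤ (d ℕ.+ d) (s≤s (z≤n {d′}))) (ℕ.≤-reflexive (three d))))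
      where three : ∀ d → (d ℕ.+ d) ℕ.+ d ≡ 3 ℕ.* d
            three = solve-∀

  1≤dist : ∀ n u w → norm1 u ≡ n → norm1 w ≡ n → ¬ w ≡ u → 1 ℕ.≤ dist n u w
  1≤dist n u w nu nw ne = positive (dist n u w) (dist-lower n u w nu nw ne)
    where positive : ∀ d {k} → k ℕ.< 3 ℕ.* d → 1 ℕ.≤ d
          positive (suc d) _ = s≤s z≤n

  private
    T : ℕ → ℚ
    T s = recipℕ (suc s ℕ.* suc (suc s))

    0≤T : ∀ s → 0ℚ ≤ T s
    0≤T s = 0≤recip (suc s ℕ.* suc (suc s))

  -- The constant is 2 · 3²: 3 from `dist-lower` and 2 from (s + 1)(s + 2) ≤ 2(s + 1)².
  invSq≤ : ∀ n u w → norm1 u ≡ n → norm1 w ≡ n → ¬ w ≡ u →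
    invSq n u w ≤ q 18 * T (∣ proj₁ u ℤ.- proj₁ w ∣ ℕ.+ ∣ proj₁ (proj₂ u) ℤ.- proj₁ (proj₂ w) ∣)
  invSq≤ n u w nu nw ne = recip≤ 18 (suc s ℕ.* suc (suc s)) (d ℕ.* d) (s≤s z≤n) (ℕ.*-mono-≤ 1≤d 1≤d) (begin
      suc s ℕ.* suc (suc s)            ≤⟨ ℕ.*-monoʳ-≤ (suc s) (s≤s (ℕ.m≤m+n (suc s) s)) ⟩
      suc s ℕ.* suc (suc s ℕ.+ s)      ≡⟨ l₁ s ⟩
      2 ℕ.* (suc s ℕ.* suc s)          ≤⟨ ℕ.*-monoʳ-≤ 2 (ℕ.*-mono-≤ s<3d s<3d) ⟩
      2 ℕ.* ((3 ℕ.* d) ℕ.* (3 ℕ.* d))  ≡⟨ l₂ d ⟩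
      18 ℕ.* (d ℕ.* d) ∎)
    where
    open ℕ.≤-Reasoning
    d = dist n u w
    s = ∣ proj₁ u ℤ.- proj₁ w ∣ ℕ.+ ∣ proj₁ (proj₂ u) ℤ.- proj₁ (proj₂ w) ∣
    1≤d = 1≤dist n u w nu nw ne
    s<3d = dist-lower n u w nu nw ne
    l₁ : ∀ s → (1 ℕ.+ s) ℕ.* (1 ℕ.+ (1 ℕ.+ s ℕ.+ s)) ≡ 2 ℕ.* ((1 ℕ.+ s) ℕ.* (1 ℕ.+ s))
    l₁ = solve-∀
    l₂ : ∀ d → 2 ℕ.* ((3 ℕ.* d) ℕ.* (3 ℕ.* d)) ≡ 18 ℕ.* (d ℕ.* d)
    l₂ = solve-∀

  -- The factor 2 accounts for the two sides of b; shifting by n turns the interval from -n to n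
  -- into an initial segment of ℕ.
  ∑-range : ∀ n b f M → (∀ i → 0ℚ ≤ f i) → ∣ b ∣ ℕ.≤ n → ∑< (suc (2 ℕ.* n)) f ≤ M →
    ∑ (range n) (λ y → f ∣ b ℤ.- y ∣) ≤ q 2 * M
  ∑-range n b f M 0≤f b≤n le = begin
    ∑ (range n) (λ y → f ∣ b ℤ.- y ∣)                               ≡⟨ ∑-map (upTo m) (λ i → + i ℤ.- + n) (λ y → f ∣ b ℤ.- y ∣) ⟩
    ∑ (upTo m) (λ i → f ∣ b ℤ.- (+ i ℤ.- + n) ∣)                     ≡⟨ ∑-upTo m (λ i → f ∣ b ℤ.- (+ i ℤ.- + n) ∣) ⟩
    ∑< m (λ i → f ∣ b ℤ.- (+ i ℤ.- + n) ∣)                           ≡⟨ ∑<-cong m (λ i → cong f (shift i)) ⟩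
    ∑< m (λ i → f ∣ β - i ∣)                                         ≤⟨ ∑<-∣-∣ m β f 0≤f β<m ⟩
    ∑< m f + ∑< m f                                                  ≤⟨ +-mono-≤ le le ⟩
    M + M                                                            ≡⟨ cong₂ _+_ (sym (*-identityˡ M)) (sym (*-identityˡ M)) ⟩
    q 1 * M + q 1 * M                                                ≡⟨ sym (*-distribʳ-+ M (q 1) (q 1)) ⟩
    q 2 * M ∎
    where
    open ≤-Reasoning
    m = suc (2 ℕ.* n)
    β = ∣ b ℤ.+ + n ∣
    0≤b+n : + β ≡ b ℤ.+ + n
    0≤b+n = ℤ.0≤i⇒+∣i∣≡i (nonneg b b≤n)
      where nonneg : ∀ b → ∣ b ∣ ℕ.≤ n → ℤ.0ℤ ℤ.≤ b ℤ.+ + n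
            nonneg (+ k) _ = ℤ.+≤+ z≤n
            nonneg -[1+ k ] k<n = subst (ℤ.0ℤ ℤ.≤_) (sym (ℤ.⊖-≥ k<n)) (ℤ.+≤+ z≤n)
    β<m : β ℕ.< m
    β<m = s≤s (ℕ.≤-trans (ℤ.∣i+j∣≤∣i∣+∣j∣ b (+ n)) (ℕ.≤-trans (ℕ.+-monoˡ-≤ n b≤n) (ℕ.≤-reflexive (cong (n ℕ.+_) (sym (ℕ.+-identityʳ n))))))
    shift : ∀ i → ∣ b ℤ.- (+ i ℤ.- + n) ∣ ≡ ∣ β - i ∣
    shift i = trans (cong ∣_∣ (trans (regroup b (+ i) (+ n)) (cong (ℤ._- + i) (sym 0≤b+n)))) (∣+-+∣ β i)
      where open import Data.Integer.Tactic.RingSolver renaming (solve-∀ to ℤ-solve)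
            regroup : ∀ b i n → b ℤ.- (i ℤ.- n) ≡ (b ℤ.+ n) ℤ.- i
            regroup = ℤ-solve

  -- Summing over the second coordinate telescopes to a reciprocal, and the first coordinate then
  -- gives a harmonic sum. The constant is 144 = 18 · 2 · 2 · 2: `invSq≤`, two signs of the third
  -- coordinate, and two sides in each of the other coordinates.
  ∑-invSq≤ : ∀ n J u → norm1 u ≡ n → suc (2 ℕ.* n) ℕ.≤ 2 ℕ.^ J → ∑ (others n u) (invSq n u) ≤ q (144 ℕ.* suc J)
  ∑-invSq≤ n J u@(a , b , c) nu 2n<2^J = begin
    ∑ (others n u) (invSq n u)     ≤⟨ ∑-mono (others n u) (λ w w∈ → let (nw , ne) = ∈others⁻ {n} {u} {w} w∈ in invSq≤ n u w nu nw ne) ⟩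
    ∑ (others n u) g               ≤⟨ ∑-⊆ {ys = grid} (λ w → 0≤* (0≤q 18) (0≤T (∣ a ℤ.- proj₁ w ∣ ℕ.+ ∣ b ℤ.- proj₁ (proj₂ w) ∣))) (unique-others n u) in-grid ⟩
    ∑ grid g                       ≡⟨ ∑-concatMap (range n) plane g ⟩
    ∑ (range n) (λ x → ∑ (plane x) g)  ≤⟨ ∑-mono (range n) (λ x _ → plane≤ x) ⟩
    ∑ (range n) (λ x → q 72 * recipℕ (suc ∣ a ℤ.- x ∣))  ≡⟨ ∑-*ˡ (range n) (q 72) (λ x → recipℕ (suc ∣ a ℤ.- x ∣)) ⟩
    q 72 * ∑ (range n) (λ x → recipℕ (suc ∣ a ℤ.- x ∣))  ≤⟨ *≤ (0≤q 72) (∑-range n a (λ i → recipℕ (suc i)) (q (suc J)) (λ i → 0≤recip (suc i)) a≤n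
          (≤-trans (∑<-mono-len (λ i → recipℕ (suc i)) (λ i → 0≤recip (suc i)) 2n<2^J) (harmonic J))) ⟩
    q 72 * (q 2 * q (suc J))       ≡⟨ sym (*-assoc (q 72) (q 2) (q (suc J))) ⟩
    q 144 * q (suc J)              ≡⟨ sym (q-* 144 (suc J)) ⟩
    q (144 ℕ.* suc J) ∎
    where
    open ≤-Reasoning
    g : Vertex → ℚ
    g w = q 18 * T (∣ a ℤ.- proj₁ w ∣ ℕ.+ ∣ b ℤ.- proj₁ (proj₂ w) ∣)
    -- Truncated subtraction adds points off the sphere at height 0, and height 0 lists a point
    -- twice; both only enlarge a sum of nonnegative terms.
    height : ℤ → ℤ → ℕ
    height x y = n ℕ.∸ (∣ x ∣ ℕ.+ ∣ y ∣)
    column : ℤ → ℤ → List Vertex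
    column x y = (x , y , + height x y) ∷ (x , y , ℤ.- + height x y) ∷ []
    plane : ℤ → List Vertex
    plane x = concatMap (column x) (range n)
    grid : List Vertex
    grid = concatMap plane (range n)
    in-column : ∀ x y z h → h ≡ ∣ z ∣ → (x , y , z) ∈ ((x , y , + h) ∷ (x , y , ℤ.- + h) ∷ [])
    in-column x y (+ k) _ refl = here refl
    in-column x y -[1+ k ] _ refl = there (here refl)
    in-grid : ∀ {w} → w ∈ others n u → w ∈ grid
    in-grid {w@(x , y , z)} w∈ with proj₁ (∈others⁻ {n} {u} {w} w∈)
    ... | nw = ∈-concatMap plane (∈-range n x (ℕ.≤-trans (ℕ.m≤m+n ∣ x ∣ ∣ y ∣) xy≤n))
                 (∈-concatMap (column x) (∈-range n y (ℕ.≤-trans (ℕ.m≤n+m ∣ y ∣ ∣ x ∣) xy≤n))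
                   (in-column x y z (height x y) (trans (cong (ℕ._∸ (∣ x ∣ ℕ.+ ∣ y ∣)) (sym nw)) (ℕ.m+n∸m≡n (∣ x ∣ ℕ.+ ∣ y ∣) ∣ z ∣))))
      where xy≤n : ∣ x ∣ ℕ.+ ∣ y ∣ ℕ.≤ n
            xy≤n = subst (∣ x ∣ ℕ.+ ∣ y ∣ ℕ.≤_) nw (ℕ.m≤m+n _ ∣ z ∣)
    a≤n : ∣ a ∣ ℕ.≤ n
    a≤n = subst (∣ a ∣ ℕ.≤_) nu (ℕ.≤-trans (ℕ.m≤m+n ∣ a ∣ ∣ b ∣) (ℕ.m≤m+n _ ∣ c ∣))
    b≤n : ∣ b ∣ ℕ.≤ n
    b≤n = subst (∣ b ∣ ℕ.≤_) nu (ℕ.≤-trans (ℕ.m≤n+m ∣ b ∣ ∣ a ∣) (ℕ.m≤m+n _ ∣ c ∣))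
    plane≤ : ∀ x → ∑ (plane x) g ≤ q 72 * recipℕ (suc ∣ a ℤ.- x ∣)
    plane≤ x = begin
      ∑ (plane x) g                                      ≡⟨ ∑-concatMap (range n) (column x) g ⟩
      ∑ (range n) (λ y → k * G y + (k * G y + 0ℚ))       ≡⟨ ∑-cong (range n) (λ y → double (G y)) ⟩
      ∑ (range n) (λ y → q 36 * G y)                     ≡⟨ ∑-*ˡ (range n) (q 36) G ⟩
      q 36 * ∑ (range n) G                               ≤⟨ *≤ (0≤q 36) (∑-range n b (λ i → T (p ℕ.+ i)) (recipℕ (suc p)) (λ i → 0≤T (p ℕ.+ i)) b≤n (∑<-inverse-square (suc (2 ℕ.* n)) p)) ⟩
      q 36 * (q 2 * recipℕ (suc p))                      ≡⟨ sym (*-assoc (q 36) (q 2) (recipℕ (suc p))) ⟩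
      q 72 * recipℕ (suc p) ∎
      where
      k = q 18
      p = ∣ a ℤ.- x ∣
      G : ℤ → ℚ
      G y = T (p ℕ.+ ∣ b ℤ.- y ∣)
      double : ∀ z → k * z + (k * z + 0ℚ) ≡ q 36 * z
      double z = trans (cong (_+_ (k * z)) (+-identityʳ (k * z))) (sym (*-distribʳ-+ z k k))

-- Quadratically many vertices around t.

module Clusters where
  open import Defs
  open Angles using (_⊖_)
  open Transfers using (∣+-+∣)
  open Improvement
  open import Data.Nat
  open import Data.Nat.Properties
  open import Data.Nat.Tactic.RingSolver using (solve-∀)
  open import Data.Integer as ℤ using (ℤ; +_; ∣_∣)
  import Data.Integer.Properties as ℤ
  open import Data.Product using (_×_; _,_; proj₁; proj₂)
  open import Data.Empty using (⊥-elim)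
  open import Relation.Nullary using (yes; no)
  open import Relation.Binary.PropositionalEquality

  record Spread (m : ℕ) (t : Vertex) : Set where
    field
      point     : ℕ → ℕ → Vertex
      on-sphere : ∀ i j → i ≤ m → j ≤ m → norm1 (point i j) ≡ norm1 t
      near      : ∀ i j → i ≤ m → j ≤ m → norm1 (point i j ⊖ t) ≤ 4 * m
      distinct  : ∀ {i j i′ j′} → point i j ≡ point i′ j′ → i ≡ i′ × j ≡ j′

  spread-iso : ∀ {f} → Isometry f → (∀ p t → norm1 (f p ⊖ f t) ≡ norm1 (p ⊖ t)) → ∀ m t → Spread m (f t) → Spread m t
  spread-iso {f} iso ⊖-pres m t s = record
    { point = λ i j → f (point i j)
    ; on-sphere = λ i j p q → trans (norm-pres (point i j)) (trans (on-sphere i j p q) (norm-pres t))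
    ; near = λ i j p q → subst (_≤ 4 * m) (trans (sym (⊖-pres (point i j) (f t))) (cong (λ w → norm1 (f (point i j) ⊖ w)) (involutive t))) (near i j p q)
    ; distinct = λ {i} {j} {i′} {j′} eq → distinct (trans (sym (involutive (point i j))) (trans (cong f eq) (involutive (point i′ j′))))
    }
    where open Spread s
          open Isometry iso

  -- The large coordinate hands i units to the second and j to the third, hence the need for 2m.
  -- Every unit changes two coordinates, hence the l¹ distance 2(i + j) ≤ 4m.
  spread-first : ∀ m a b c → 2 * m ≤ a → Spread m (+ a , + b , + c)
  spread-first m a b c 2m≤a = record
    { point = λ i j → + (a ∸ (i + j)) , + (b + i) , + (c + j)
    ; on-sphere = λ i j p q → trans (regroup (a ∸ (i + j)) b i c j) (cong (λ s → s + b + c) (m∸n+n≡m (fits p q)))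
    ; near = λ i j p q → ≤-trans (≤-reflexive (cong₂ _+_ (cong₂ _+_ (shrink i j p q) (grow b i)) (grow c j)))
        (≤-trans (+-mono-≤ (+-mono-≤ (+-mono-≤ p q) p) q) (≤-reflexive (four m)))
    ; distinct = λ {i} {j} {i′} {j′} eq → +-cancelˡ-≡ b i i′ (ℤ.+-injective (cong (λ w → proj₁ (proj₂ w)) eq)) , +-cancelˡ-≡ c j j′ (ℤ.+-injective (cong (λ w → proj₂ (proj₂ w)) eq))
    }
    where
    fits : ∀ {i j} → i ≤ m → j ≤ m → i + j ≤ a
    fits p q = ≤-trans (+-mono-≤ p q) (≤-trans (≤-reflexive (cong (λ s → m + s) (sym (+-identityʳ m)))) 2m≤a)
    regroup : ∀ k b i c j → k + (b + i) + (c + j) ≡ k + (i + j) + b + c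
    regroup = solve-∀
    four : ∀ m → m + m + m + m ≡ 4 * m
    four = solve-∀
    shrink : ∀ i j → i ≤ m → j ≤ m → ∣ + (a ∸ (i + j)) ℤ.- + a ∣ ≡ i + j
    shrink i j p q = trans (∣+-+∣ (a ∸ (i + j)) a) (trans (m≤n⇒∣m-n∣≡n∸m (m∸n≤m a (i + j))) (m∸[m∸n]≡n (fits p q)))
    grow : ∀ b i → ∣ + (b + i) ℤ.- + b ∣ ≡ i
    grow b i = trans (∣+-+∣ (b + i) b) (∣m+n-m∣≡n b i)
      where ∣m+n-m∣≡n : ∀ b i → ∣ b + i - b ∣ ≡ i
            ∣m+n-m∣≡n zero i = ∣-∣-identityʳ i
            ∣m+n-m∣≡n (suc b) i = ∣m+n-m∣≡n b i

  swap₁₂-⊖ : ∀ p t → norm1 (swap₁₂ p ⊖ swap₁₂ t) ≡ norm1 (p ⊖ t)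
  swap₁₂-⊖ (a , b , c) (x , y , z) = Isometry.norm-pres swap₁₂-iso (a ℤ.- x , b ℤ.- y , c ℤ.- z)

  swap₂₃-⊖ : ∀ p t → norm1 (swap₂₃ p ⊖ swap₂₃ t) ≡ norm1 (p ⊖ t)
  swap₂₃-⊖ (a , b , c) (x , y , z) = Isometry.norm-pres swap₂₃-iso (a ℤ.- x , b ℤ.- y , c ℤ.- z)

  -- By pigeonhole, one of the three coordinates has absolute value at least 2m.
  spread : ∀ m t → 6 * m ≤ norm1 t → Spread m t
  spread m t = sign-normalise {λ _ u → 6 * m ≤ norm1 u → Spread m u}
    (λ _ → reflect neg₁-iso λ { (a , b , c) (x , y , z) → cong (λ k → k + ∣ b ℤ.- y ∣ + ∣ c ℤ.- z ∣) (∣neg-neg∣ a x) })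
    (λ _ → reflect neg₂-iso λ { (a , b , c) (x , y , z) → cong (λ k → ∣ a ℤ.- x ∣ + k + ∣ c ℤ.- z ∣) (∣neg-neg∣ b y) })
    (λ _ → reflect neg₃-iso λ { (a , b , c) (x , y , z) → cong (λ k → ∣ a ℤ.- x ∣ + ∣ b ℤ.- y ∣ + k) (∣neg-neg∣ c z) })
    (λ a b c _ _ _ _ → octant a b c) t t
    where
    reflect : ∀ {f} → Isometry f → (∀ p t → norm1 (f p ⊖ f t) ≡ norm1 (p ⊖ t)) → ∀ u →
      (6 * m ≤ norm1 (f u) → Spread m (f u)) → 6 * m ≤ norm1 u → Spread m u
    reflect iso pres u ih le = spread-iso iso pres m u (ih (subst (6 * m ≤_) (sym (Isometry.norm-pres iso u)) le))
    three : ∀ m → 2 * m + 2 * m + 2 * m ≡ 6 * m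
    three = solve-∀
    octant : ∀ a b c → 6 * m ≤ a + b + c → Spread m (+ a , + b , + c)
    octant a b c le with 2 * m ≤? a | 2 * m ≤? b | 2 * m ≤? c
    ... | yes p | _ | _ = spread-first m a b c p
    ... | no _ | yes p | _ = spread-iso swap₁₂-iso swap₁₂-⊖ m (+ a , + b , + c) (spread-first m b a c p)
    ... | no _ | no _ | yes p = spread-iso swap₂₃-iso swap₂₃-⊖ m (+ a , + b , + c)
                                 (spread-iso swap₁₂-iso swap₁₂-⊖ m (+ a , + c , + b) (spread-first m c a b p))
    ... | no p | no q | no r = ⊥-elim (<-irrefl refl (<-≤-trans (+-mono-< (+-mono-< (≰⇒> p) (≰⇒> q)) (≰⇒> r)) (≤-trans (≤-reflexive (three m)) le)))

-- Expectation over independent choices.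

module Independence where
  open import Defs
  open Rationals
  open Sums
  open import Data.Nat using (ℕ)
  open import Data.Rational using (ℚ; 0ℚ; 1ℚ; _+_; _*_; _≤_)
  open import Data.Rational.Properties
  open import Data.Rational.Solver using (module +-*-Solver)
  open +-*-Solver using (solve; _:*_; _:=_)
  open import Data.List using (List; []; _∷_)
  open import Data.List.Relation.Unary.Any using (here; there)
  open import Data.Empty using (⊥-elim)
  open import Relation.Nullary using (¬_; yes; no)
  open import Relation.Binary.PropositionalEquality

  update-same : ∀ c u w → update c u w u ≡ w
  update-same c u w with u ≟V u
  ... | yes _ = refl
  ... | no ne = ⊥-elim (ne refl)

  update-other : ∀ c u w x → ¬ x ≡ u → update c u w x ≡ c x
  update-other c u w x ne with x ≟V u
  ... | yes eq = ⊥-elim (ne eq)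
  ... | no _ = refl

  update-cong : ∀ {c c′ : Config} u w → (∀ x → c x ≡ c′ x) → ∀ x → update c u w x ≡ update c′ u w x
  update-cong u w h x with x ≟V u
  ... | yes _ = refl
  ... | no _ = h x

  update-swap : ∀ c u v w w′ → ¬ u ≡ v → ∀ x → update (update c u w) v w′ x ≡ update (update c v w′) u w x
  update-swap c u v w w′ u≢v x with x ≟V v | x ≟V u
  ... | yes refl | yes eq = ⊥-elim (u≢v (sym eq))
  ... | yes _ | no _ = refl
  ... | no _ | yes _ = refl
  ... | no _ | no _ = refl

  module _ (n : ℕ) (0≤Pr : ∀ u → norm1 u ≡ n → ∀ w → 0ℚ ≤ Pr n u w)
           (total : ∀ u → norm1 u ≡ n → ∑ (others n u) (Pr n u) ≡ 1ℚ) where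

    OnSphere : List Vertex → Set
    OnSphere us = ∀ {u} → u ∈ us → norm1 u ≡ n

    -- Updates at different vertices commute only pointwise, so invariance under pointwise equality
    -- is tracked in place of function extensionality.
    Respects : (Config → ℚ) → Set
    Respects f = ∀ {c c′ : Config} → (∀ x → c x ≡ c′ x) → f c ≡ f c′

    expect-cong : ∀ us {f g} → (∀ c → f c ≡ g c) → expectOver n us f ≡ expectOver n us g
    expect-cong [] h = h _
    expect-cong (u ∷ us) h = ∑-cong (others n u) (λ w → cong (Pr n u w *_) (expect-cong us (λ c → h (update c u w))))

    -- Off the list, configurations default to the identity, which is no legal choice; the
    -- comparison is therefore asked only of configurations legal on the list.
    expect-mono : ∀ us {f g} → OnSphere us →
      (∀ c → (∀ u → u ∈ us → c u ∈ others n u) → f c ≤ g c) → expectOver n us f ≤ expectOver n us g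
    expect-mono [] on h = h _ (λ u ())
    expect-mono (u ∷ us) {f} {g} on h = ∑-mono (others n u) λ w w∈ → *≤ (0≤Pr u (on (here refl)) w)
        (expect-mono us (λ p → on (there p)) (λ c valid → h (update c u w) (extend c w w∈ valid)))
      where
      extend : ∀ c w → w ∈ others n u → (∀ v → v ∈ us → c v ∈ others n v) → ∀ v → v ∈ u ∷ us → update c u w v ∈ others n v
      extend c w w∈ valid v v∈ with v ≟V u | v∈
      ... | yes refl | _ = w∈
      ... | no ne | here eq = ⊥-elim (ne eq)
      ... | no _ | there p = valid v p

    expect-const : ∀ us k → OnSphere us → expectOver n us (λ _ → k) ≡ k
    expect-const [] k on = refl
    expect-const (u ∷ us) k on = begin
      ∑ (others n u) (λ w → Pr n u w * expectOver n us (λ _ → k))  ≡⟨ ∑-*ʳ (others n u) (expectOver n us (λ _ → k)) (Pr n u) ⟩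
      ∑ (others n u) (Pr n u) * expectOver n us (λ _ → k)          ≡⟨ cong₂ _*_ (total u (on (here refl))) (expect-const us k (λ p → on (there p))) ⟩
      1ℚ * k                                                        ≡⟨ *-identityˡ k ⟩
      k ∎
      where open ≡-Reasoning

    expect-+ : ∀ us f g → expectOver n us (λ c → f c + g c) ≡ expectOver n us f + expectOver n us g
    expect-+ [] f g = refl
    expect-+ (u ∷ us) f g = trans (∑-cong (others n u) (λ w → trans (cong (Pr n u w *_) (expect-+ us (λ c → f (update c u w)) (λ c → g (update c u w)))) (*-distribˡ-+ (Pr n u w) _ _)))
      (∑-+ (others n u) (λ w → Pr n u w * expectOver n us (λ c → f (update c u w))) (λ w → Pr n u w * expectOver n us (λ c → g (update c u w))))

    ∑-swap : ∀ {A B : Set} (xs : List A) (ys : List B) (f : A → B → ℚ) → ∑ xs (λ x → ∑ ys (f x)) ≡ ∑ ys (λ y → ∑ xs (λ x → f x y))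
    ∑-swap [] ys f = sym (∑-zero ys)
      where ∑-zero : ∀ {B : Set} (ys : List B) → ∑ ys (λ _ → 0ℚ) ≡ 0ℚ
            ∑-zero [] = refl
            ∑-zero (_ ∷ ys) = trans (+-identityˡ _) (∑-zero ys)
    ∑-swap (x ∷ xs) ys f = trans (cong (∑ ys (f x) +_) (∑-swap xs ys f)) (sym (∑-+ ys (f x) (λ y → ∑ xs (λ x → f x y))))

    Ignores : Vertex → (Config → ℚ) → Set
    Ignores u f = ∀ c w → f (update c u w) ≡ f c

    -- The only place where the independence of the choices is used.
    expect-split : ∀ us u (G : Vertex → Config → ℚ) → OnSphere us → u ∈ us → (∀ w → Respects (G w)) → (∀ w → Ignores u (G w)) →
      expectOver n us (λ c → G (c u) c) ≡ ∑ (others n u) (λ w → Pr n u w * expectOver n us (G w))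
    expect-split (v ∷ us) u G on u∈ resp ign with v ≟V u
    ... | yes refl = ∑-cong (others n u) (λ w → cong (Pr n u w *_) (trans
            (expect-cong us (λ c → trans (cong (λ a → G a (update c u w)) (update-same c u w)) (ign w c w)))
            (sym (ignored w))))
      where
      -- The choice of u is averaged out: it does not affect `G w`, and its probabilities sum to 1.
      ignored : ∀ w → expectOver n (u ∷ us) (G w) ≡ expectOver n us (G w)
      ignored w = begin
        ∑ (others n u) (λ w′ → Pr n u w′ * expectOver n us (λ c → G w (update c u w′)))  ≡⟨ ∑-cong (others n u) (λ w′ → cong (Pr n u w′ *_) (expect-cong us (λ c → ign w c w′))) ⟩
        ∑ (others n u) (λ w′ → Pr n u w′ * expectOver n us (G w))                        ≡⟨ ∑-*ʳ (others n u) (expectOver n us (G w)) (Pr n u) ⟩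
        ∑ (others n u) (Pr n u) * expectOver n us (G w)                                  ≡⟨ cong (_* expectOver n us (G w)) (total u (on (here refl))) ⟩
        1ℚ * expectOver n us (G w)                                                        ≡⟨ *-identityˡ _ ⟩
        expectOver n us (G w) ∎
        where open ≡-Reasoning
    ... | no v≢u = begin
        ∑ (others n v) (λ x → Pr n v x * expectOver n us (λ c → G (update c v x u) (update c v x)))
          ≡⟨ ∑-cong (others n v) (λ x → cong (Pr n v x *_) (expect-cong us (λ c → cong (λ a → G a (update c v x)) (update-other c v x u (λ eq → v≢u (sym eq)))))) ⟩
        ∑ (others n v) (λ x → Pr n v x * expectOver n us (λ c → H x (c u) c))
          ≡⟨ ∑-cong (others n v) (λ x → cong (Pr n v x *_) (expect-split us u (H x) (λ p → on (there p)) (tail u∈) (respH x) (ignH x))) ⟩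
        ∑ (others n v) (λ x → Pr n v x * ∑ (others n u) (λ w → Pr n u w * expectOver n us (H x w)))
          ≡⟨ ∑-cong (others n v) (λ x → sym (∑-*ˡ (others n u) (Pr n v x) (λ w → Pr n u w * expectOver n us (H x w)))) ⟩
        ∑ (others n v) (λ x → ∑ (others n u) (λ w → Pr n v x * (Pr n u w * expectOver n us (H x w))))
          ≡⟨ ∑-swap (others n v) (others n u) (λ x w → Pr n v x * (Pr n u w * expectOver n us (H x w))) ⟩
        ∑ (others n u) (λ w → ∑ (others n v) (λ x → Pr n v x * (Pr n u w * expectOver n us (H x w))))
          ≡⟨ ∑-cong (others n u) (λ w → trans (∑-cong (others n v) (λ x → exchange (Pr n v x) (Pr n u w) (expectOver n us (H x w)))) (∑-*ˡ (others n v) (Pr n u w) (λ x → Pr n v x * expectOver n us (H x w)))) ⟩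
        ∑ (others n u) (λ w → Pr n u w * ∑ (others n v) (λ x → Pr n v x * expectOver n us (H x w))) ∎
      where
      open ≡-Reasoning
      -- The choice x of the head v is frozen, the induction hypothesis extracts u from the tail,
      -- and the two sums are exchanged.
      H : Vertex → Vertex → Config → ℚ
      H x w c = G w (update c v x)
      tail : u ∈ v ∷ us → u ∈ us
      tail (here eq) = ⊥-elim (v≢u (sym eq))
      tail (there p) = p
      respH : ∀ x w → Respects (H x w)
      respH x w h = resp w (update-cong v x h)
      ignH : ∀ x w → Ignores u (H x w)
      ignH x w c a = trans (resp w (λ y → update-swap c u v a x (λ eq → v≢u (sym eq)) y)) (ign w (update c v x) a)
      exchange : ∀ a b e → a * (b * e) ≡ b * (a * e)
      exchange = solve 3 (λ a b e → a :* (b :* e) := b :* (a :* e)) refl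

-- Scales, order of angles, and total probability.

module Levels where
  open import Defs
  open IntegerOrder using (cancel≤; cancel<) renaming (*≤ to ℤ*≤; *< to ℤ*<)
  open Angles
  open Improvement using (Better)
  open Normalisation
  open Rationals
  open Sums
  open import Data.Nat as ℕ using (ℕ; zero; suc; s≤s; z≤n; _≤_)
  import Data.Nat.Properties as ℕ
  open import Data.Nat.Tactic.RingSolver using (solve-∀)
  open import Data.Integer as ℤ using (ℤ; +_; ∣_∣; 0ℤ)
  import Data.Integer.Properties as ℤ
  open import Data.Rational as ℚ using (ℚ; 0ℚ; 1ℚ)
  import Data.Rational.Properties as ℚ
  open import Data.List using (List; []; _∷_; length)
  open import Data.List.Relation.Unary.Any using (here; there)
  open import Data.List.Relation.Unary.AllPairs using ([]; _∷_)
  open import Data.List.Relation.Unary.All using ([])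
  open import Data.Product using (_,_; proj₁; proj₂)
  open import Data.Empty using (⊥-elim)
  open import Function using (_∘_)
  open import Relation.Nullary using (¬_; Dec; yes; no)
  open import Relation.Binary.PropositionalEquality

  record Least (P : ℕ → Set) (J : ℕ) : Set where
    constructor least-at
    field
      index   : ℕ
      bounded : index ≤ J
      holds   : P index
      minimal : ∀ j → P j → index ≤ j

  least : ∀ {P : ℕ → Set} → (∀ j → Dec (P j)) → ∀ J → P J → Least P J
  least P? J pJ with P? 0
  least P? J pJ | yes p₀ = least-at 0 z≤n p₀ (λ _ _ → z≤n)
  least P? zero pJ | no ¬p₀ = ⊥-elim (¬p₀ pJ)
  least P? (suc J) pJ | no ¬p₀ with least (P? ∘ suc) J pJ
  ... | least-at k k≤J pk min = least-at (suc k) (s≤s k≤J) pk λ { zero p → ⊥-elim (¬p₀ p) ; (suc j) p → s≤s (min j p) }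

  -- This is 2^j - 1. Starting at 0 makes scale 0 consist of t alone.
  radius : ℕ → ℕ
  radius zero = 0
  radius (suc j) = suc (radius j ℕ.+ radius j)

  suc-radius : ∀ j → suc (radius j) ≡ 2 ℕ.^ j
  suc-radius zero = refl
  suc-radius (suc j) = trans (cong suc (sym (ℕ.+-suc (radius j) (radius j)))) (trans (cong₂ ℕ._+_ (suc-radius j) (suc-radius j)) (cong (2 ℕ.^ j ℕ.+_) (sym (ℕ.+-identityʳ (2 ℕ.^ j)))))

  ⊖-triangle : ∀ u w t → norm1 (u ⊖ w) ≤ norm1 (u ⊖ t) ℕ.+ norm1 (w ⊖ t)
  ⊖-triangle u@(a , b , c) w@(x , y , z) t@(d , e , f) = ℤ.drop‿+≤+ (subst (λ s → + norm1 s ℤ.≤ + norm1 (u ⊖ t) ℤ.+ + norm1 (w ⊖ t))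
      (cong₂ _,_ (l a x d) (cong₂ _,_ (l b y e) (l c z f))) (nrm-⊖≤ (u ⊖ t) (w ⊖ t)))
    where open import Data.Integer.Tactic.RingSolver renaming (solve-∀ to ℤ-solve)
          l : ∀ a x d → (a ℤ.- d) ℤ.- (x ℤ.- d) ≡ a ℤ.- x
          l = ℤ-solve

  ⊖-self : ∀ t → norm1 (t ⊖ t) ≡ 0
  ⊖-self (a , b , c) = cong₂ ℕ._+_ (cong₂ ℕ._+_ (z a) (z b)) (z c)
    where z : ∀ a → ∣ a ℤ.- a ∣ ≡ 0
          z a = cong ∣_∣ (ℤ.+-inverseʳ a)

  ⊖-zero : ∀ u t → norm1 (u ⊖ t) ≤ 0 → u ≡ t
  ⊖-zero (a , b , c) (x , y , z) le = cong₂ _,_ (eq a x (ℕ.≤-trans (ℕ.m≤m+n _ _) ab)) (cong₂ _,_ (eq b y (ℕ.≤-trans (ℕ.m≤n+m _ ∣ a ℤ.- x ∣) ab)) (eq c z (ℕ.≤-trans (ℕ.m≤n+m _ (∣ a ℤ.- x ∣ ℕ.+ ∣ b ℤ.- y ∣)) le)))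
    where ab : ∣ a ℤ.- x ∣ ℕ.+ ∣ b ℤ.- y ∣ ≤ 0
          ab = ℕ.≤-trans (ℕ.m≤m+n _ ∣ c ℤ.- z ∣) le
          eq : ∀ a x → ∣ a ℤ.- x ∣ ≤ 0 → a ≡ x
          eq a x le = ℤ.i-j≡0⇒i≡j a x (ℤ.∣i∣≡0⇒i≡0 (ℕ.n≤0⇒n≡0 le))

  private
    cross : ∀ b x a → b ℤ.* (x ℤ.* a) ≡ a ℤ.* (x ℤ.* b)
    cross = ℤ-solve
      where open import Data.Integer.Tactic.RingSolver renaming (solve-∀ to ℤ-solve)

  -- In cross-multiplied form the two inequalities are scaled by |x|² and |z|², and |y|² is
  -- cancelled at the end; this is why the middle vertex must be nonzero.
  cosGE-trans : ∀ t x y z → 0ℤ ℤ.≤ dot x x → 0ℤ ℤ.< dot y y → 0ℤ ℤ.≤ dot z z → CosGE t x y → CosGE t y z → CosGE t x z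
  cosGE-trans t x y z 0≤x 0<y 0≤z xy yz = cancel≤ 0<y (ℤ.≤-trans
    (subst₂ ℤ._≤_ (cross (dot x x) (sq± (dot z t)) (dot y y)) (cross (dot x x) (sq± (dot y t)) (dot z z)) (ℤ*≤ 0≤x yz))
    (subst (dot z z ℤ.* (sq± (dot y t) ℤ.* dot x x) ℤ.≤_) (cross (dot z z) (sq± (dot x t)) (dot y y)) (ℤ*≤ 0≤z xy)))

  better-trans : ∀ t x y z → 0ℤ ℤ.< dot x x → 0ℤ ℤ.≤ dot y y → 0ℤ ℤ.≤ dot z z → CosGE t x y → Better t y z → Better t x z
  better-trans t x y z 0<x 0≤y 0≤z xy yz = cancel< 0≤y (ℤ.<-≤-trans
    (subst₂ ℤ._<_ (cross (dot x x) (sq± (dot z t)) (dot y y)) (cross (dot x x) (sq± (dot y t)) (dot z z)) (ℤ*< 0<x yz))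
    (subst (dot z z ℤ.* (sq± (dot y t) ℤ.* dot x x) ℤ.≤_) (cross (dot z z) (sq± (dot x t)) (dot y y)) (ℤ*≤ 0≤z xy)))

  ∑-const : ∀ {A : Set} (xs : List A) c → ∑ xs (λ _ → c) ≡ q (length xs) ℚ.* c
  ∑-const [] c = sym (ℚ.*-zeroˡ c)
  ∑-const (x ∷ xs) c = trans (cong₂ ℚ._+_ (sym (ℚ.*-identityˡ c)) (∑-const xs c)) (trans (sym (ℚ.*-distribʳ-+ c 1ℚ (q (length xs)))) (cong (ℚ._* c) (sym (q-+ 1 (length xs)))))

  0≤invSq : ∀ n u w → 0ℚ ℚ.≤ invSq n u w
  0≤invSq n u w = 0≤recip (dist n u w ℕ.* dist n u w)

  module _ (n : ℕ) (1≤n : 1 ≤ n) where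

    -- The antipode -u is a vertex other than u, because n ≥ 1.
    0<∑-invSq : ∀ u → norm1 u ≡ n → 0ℚ ℚ.< ∑ (others n u) (invSq n u)
    0<∑-invSq u@(a , b , c) nu = ℚ.<-≤-trans (pos (dist n u w) (1≤dist n u w nu nw ne))
      (subst (ℚ._≤ ∑ (others n u) (invSq n u)) (ℚ.+-identityʳ (invSq n u w)) (∑-⊆ {xs = w ∷ []} {others n u} (0≤invSq n u) ([] ∷ []) (λ { (here refl) → ∈others⁺ {n} {u} {w} nw ne ; (there ()) })))
      where
      w : Vertex
      w = (ℤ.- a , ℤ.- b , ℤ.- c)
      nw : norm1 w ≡ n
      nw = trans (cong₂ ℕ._+_ (cong₂ ℕ._+_ (ℤ.∣-i∣≡∣i∣ a) (ℤ.∣-i∣≡∣i∣ b)) (ℤ.∣-i∣≡∣i∣ c)) nu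
      self-neg : ∀ a → ℤ.- a ≡ a → ∣ a ∣ ≡ 0
      self-neg (+ zero) _ = refl
      ne : ¬ w ≡ u
      ne eq = ℕ.1+n≰n (ℕ.≤-trans 1≤n (ℕ.≤-reflexive (trans (sym nu) (cong₂ ℕ._+_ (cong₂ ℕ._+_ (self-neg a (cong proj₁ eq)) (self-neg b (cong (proj₁ ∘ proj₂) eq))) (self-neg c (cong (proj₂ ∘ proj₂) eq))))))
      pos : ∀ d → 1 ≤ d → 0ℚ ℚ.< recipℕ (d ℕ.* d)
      pos (suc d) _ = 0<recip (d ℕ.+ d ℕ.* suc d)

    0≤Pr : ∀ u → norm1 u ≡ n → ∀ w → 0ℚ ℚ.≤ Pr n u w
    0≤Pr u nu w = 0≤* (0≤inv (∑ (others n u) (invSq n u)) (0<∑-invSq u nu)) (0≤invSq n u w)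

    total : ∀ u → norm1 u ≡ n → ∑ (others n u) (Pr n u) ≡ 1ℚ
    total u nu = trans (∑-*ˡ (others n u) (Z n u) (invSq n u)) (inv*self (∑ (others n u) (invSq n u)) (0<∑-invSq u nu))

    0<norm : ∀ u → norm1 u ≡ n → 0ℤ ℤ.< dot u u
    0<norm u nu = 0<dot u (subst (1 ≤_) (sym nu) 1≤n)

    norm-⊖≤ : ∀ u t → norm1 u ≡ n → norm1 t ≡ n → norm1 (u ⊖ t) ≤ 2 ℕ.* n
    norm-⊖≤ u t nu nt = ℕ.≤-trans (ℤ.drop‿+≤+ (nrm-⊖≤ u t)) (ℕ.≤-reflexive (trans (cong₂ ℕ._+_ nu nt) (cong (n ℕ.+_) (sym (ℕ.+-identityʳ n)))))

  -- With m = ⌊R / 12⌋, the left-hand side is the bound obtained for the graph distance from a vertex u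
  -- with |u - t|₁ ≤ 6 (2R + 1) to a vertex w with |w - t|₁ ≤ 4m.
  distance-constant : ∀ R m → R ℕ.≤ 11 ℕ.+ m ℕ.* 12 → 4 ℕ.* (6 ℕ.* suc (R ℕ.+ R) ℕ.+ 4 ℕ.* m) ≤ 592 ℕ.* suc m
  distance-constant R m le = ℕ.≤-trans (ℕ.*-monoʳ-≤ 4 (ℕ.+-monoˡ-≤ (4 ℕ.* m) (ℕ.*-monoʳ-≤ 6 (s≤s (ℕ.+-mono-≤ le le)))))
    (ℕ.≤-trans (ℕ.≤-reflexive (l m)) (ℕ.≤-trans (ℕ.+-monoʳ-≤ (592 ℕ.* m) (ℕ.m≤m+n 552 40)) (ℕ.≤-reflexive (l′ m))))
    where
    -- The slope 592 = 4 (6 · 24 + 4) is the constant K of the routing argument.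
    l : ∀ m → 4 ℕ.* (6 ℕ.* (1 ℕ.+ ((11 ℕ.+ m ℕ.* 12) ℕ.+ (11 ℕ.+ m ℕ.* 12))) ℕ.+ 4 ℕ.* m) ≡ 592 ℕ.* m ℕ.+ 552
    l = solve-∀
    l′ : ∀ m → 592 ℕ.* m ℕ.+ 592 ≡ 592 ℕ.* (1 ℕ.+ m)
    l′ = solve-∀

-- The potential argument along the greedy route.

module Routing where
  open import Defs
  open Angles
  open Improvement using (Better; improvable)
  open Balls using (∈V⁺; ∈V⁻; ∈nbrs⁺; dist≤)
  open Normalisation
  open Rationals
  open Sums
  open Clusters
  open Independence
  open Levels
  open import Data.Nat as ℕ using (ℕ; zero; suc; s≤s; z≤n; _≤_)
  import Data.Nat.Properties as ℕ
  open import Data.Nat.DivMod using (_/_; m≡m%n+[m/n]*n; m%n<n; m/n*n≤m)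
  open import Data.Nat.Tactic.RingSolver using (solve-∀)
  open import Data.Integer as ℤ using (ℤ; +_; 0ℤ)
  import Data.Integer.Properties as ℤ
  open import Data.Rational as ℚ using (ℚ; 0ℚ; 1ℚ)
  import Data.Rational.Properties as ℚ
  open import Data.List using (List; []; _∷_; map; upTo; length; cartesianProduct)
  open import Data.List.Properties using (length-map; length-upTo; length-++)
  open import Data.List.Relation.Unary.Any using (Any; here; there; any?)
  open import Data.List.Relation.Unary.Unique.Propositional using (Unique)
  import Data.List.Relation.Unary.Unique.Propositional.Properties as Uniq
  import Data.List.Membership.Propositional as L
  open import Data.List.Membership.Propositional.Properties using (∈-map⁻; ∈-upTo⁻; ∈-cartesianProduct⁻; ∈-filter⁻)
  open import Data.Product using (Σ; _×_; _,_; proj₁; proj₂)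
  open import Data.Sum using (_⊎_; inj₁; inj₂)
  open import Data.Empty using (⊥-elim)
  open import Relation.Nullary using (¬_; Dec; yes; no)
  open import Relation.Nullary.Decidable using (_×-dec_; _⊎-dec_)
  open import Relation.Binary.PropositionalEquality

  length-cartesianProduct : ∀ {A B : Set} (xs : List A) (ys : List B) → length (cartesianProduct xs ys) ≡ length xs ℕ.* length ys
  length-cartesianProduct [] ys = refl
  length-cartesianProduct (x ∷ xs) ys = trans (length-++ (map (x ,_) ys)) (cong₂ ℕ._+_ (length-map (x ,_) ys) (length-cartesianProduct xs ys))

  record Cluster (m : ℕ) (t : Vertex) : Set where
    field
      points  : List Vertex
      size    : length points ≡ suc m ℕ.* suc m
      unique  : Unique points
      members : ∀ {w} → w L.∈ points → norm1 w ≡ norm1 t × norm1 (w ⊖ t) ≤ 4 ℕ.* m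

  spread-cluster : ∀ {m t} → Spread m t → Cluster m t
  spread-cluster {m} {t} s = record
    { points = map at indices
    ; size = trans (length-map at indices) (trans (length-cartesianProduct (upTo (suc m)) (upTo (suc m))) (cong₂ ℕ._*_ (length-upTo (suc m)) (length-upTo (suc m))))
    ; unique = Uniq.map⁺ {f = at} at-injective {xs = indices} (Uniq.cartesianProduct⁺ (Uniq.upTo⁺ (suc m)) (Uniq.upTo⁺ (suc m)))
    ; members = λ w∈ → member (∈-map⁻ at w∈)
    }
    where
    open Clusters.Spread s
    indices : List (ℕ × ℕ)
    indices = cartesianProduct (upTo (suc m)) (upTo (suc m))
    at : ℕ × ℕ → Vertex
    at (i , j) = point i j
    at-injective : ∀ {x y} → at x ≡ at y → x ≡ y
    at-injective {i , j} {i′ , j′} eq = cong₂ _,_ (proj₁ (distinct {i} {j} {i′} {j′} eq)) (proj₂ (distinct {i} {j} {i′} {j′} eq))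
    member : ∀ {w} → (Σ (ℕ × ℕ) λ x → x L.∈ indices × w ≡ at x) → norm1 w ≡ norm1 t × norm1 (w ⊖ t) ≤ 4 ℕ.* m
    member ((i , j) , ij∈ , refl) = let (i∈ , j∈) = ∈-cartesianProduct⁻ (upTo (suc m)) (upTo (suc m)) ij∈
                                        i≤m = ℕ.s≤s⁻¹ (∈-upTo⁻ i∈)
                                        j≤m = ℕ.s≤s⁻¹ (∈-upTo⁻ j∈)
                                    in on-sphere i j i≤m j≤m , near i j i≤m j≤m

  -- K is the constant in d(u, w) ≤ K (m + 1), J the number of distance scales.
  module _ (n : ℕ) (1≤n : 1 ≤ n) (t : Vertex) (nt : norm1 t ≡ n) (r : Vertex → Vertex → Vertex) (valid : ValidRule n t r)
           (K : ℕ) (1≤K : 1 ≤ K) (distance-bound : ∀ R m → R ≤ 11 ℕ.+ m ℕ.* 12 → 4 ℕ.* (6 ℕ.* suc (R ℕ.+ R) ℕ.+ 4 ℕ.* m) ≤ K ℕ.* suc m)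
           (J : ℕ) (2n<2^J : suc (2 ℕ.* n) ≤ 2 ℕ.^ J) where

    private
      0<² : ∀ u → norm1 u ≡ n → 0ℤ ℤ.< dot u u
      0<² = 0<norm n 1≤n

      0≤² : ∀ u → norm1 u ≡ n → 0ℤ ℤ.≤ dot u u
      0≤² u nu = ℤ.<⇒≤ (0<norm n 1≤n u nu)

    -- r off its domain is redirected to t, so that its properties hold for all configurations.
    r′ : Vertex → Vertex → Vertex
    r′ u w with w ∈? others n u
    ... | yes _ = r u w
    ... | no _ = t

    r′≡r : ∀ u w → w ∈ others n u → r′ u w ≡ r u w
    r′≡r u w w∈ with w ∈? others n u
    ... | yes _ = refl
    ... | no w∉ = ⊥-elim (w∉ w∈)

    -- A failure would make u at least as good as t itself, and `cosGE⇒near` would then bound |u -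
    -- t|₁ by 6 · 0.
    target-best : ∀ u → norm1 u ≡ n → ¬ u ≡ t → Better t t u
    target-best u nu u≢t = ℤ.≰⇒> (λ ge → u≢t (⊖-zero u t (ℕ.≤-trans (cosGE⇒near t u t nt nu nt 1≤n ge) (ℕ.≤-reflexive (cong (6 ℕ.*_) (⊖-self t))))))

    r-on-sphere : ∀ u w → norm1 u ≡ n → w ∈ others n u → norm1 (r u w) ≡ n
    r-on-sphere u w nu w∈ with proj₁ (valid u w (∈V⁺ nu) w∈)
    ... | here eq = subst (λ v → norm1 v ≡ n) (sym eq) (proj₁ (∈others⁻ {n} {u} {w} w∈))
    ... | there p = ∈V⁻ {n} {r u w} (proj₁ (∈-filter⁻ (adj? u) {xs = V n} p))

    -- The improving neighbour is among the out-neighbours for every w, and the rule picks one at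
    -- least as good.
    r-better : ∀ u w → norm1 u ≡ n → ¬ u ≡ t → w ∈ others n u → Better t (r u w) u
    r-better u w nu u≢t w∈ = go (improvable t u (subst (1 ≤_) (sym nu) 1≤n) (trans nu (sym nt)) u≢t)
      where
      go : Improvement.Improvable t u → Better t (r u w) u
      go (v , nv , adj , bet) = better-trans t (r u w) v u (0<² (r u w) (r-on-sphere u w nu w∈)) (0≤² v (trans nv nu)) (0≤² u nu)
        (proj₂ (valid u w (∈V⁺ nu) w∈) v (there (∈nbrs⁺ {n} {u} {v} (trans nv nu) adj))) bet

    r′-on-sphere : ∀ u w → norm1 u ≡ n → norm1 (r′ u w) ≡ n
    r′-on-sphere u w nu with w ∈? others n u
    ... | yes w∈ = r-on-sphere u w nu w∈
    ... | no _ = nt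

    r′-better : ∀ u w → norm1 u ≡ n → ¬ u ≡ t → Better t (r′ u w) u
    r′-better u w nu u≢t with w ∈? others n u
    ... | yes w∈ = r-better u w nu u≢t w∈
    ... | no _ = target-best u nu u≢t

    forwards-cong : ∀ {c c′ : Config} F u → (∀ x → c x ≡ c′ x) → forwardsWithin t r′ c F u ≡ forwardsWithin t r′ c′ F u
    forwards-cong zero u h = refl
    forwards-cong {c} {c′} (suc F) u h with u ≟V t
    ... | yes _ = refl
    ... | no _ = cong suc (trans (forwards-cong F (r′ u (c u)) h) (cong (λ w → forwardsWithin t r′ c′ F (r′ u w)) (h u)))

    -- From v on, every vertex visited before t is strictly better than u, so the choice of u is
    -- never consulted.
    forwards-ignore : ∀ c u w F v → norm1 u ≡ n → norm1 v ≡ n → Better t v u →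
      forwardsWithin t r′ (update c u w) F v ≡ forwardsWithin t r′ c F v
    forwards-ignore c u w zero v nu nv bet = refl
    forwards-ignore c u w (suc F) v nu nv bet with v ≟V t
    ... | yes _ = refl
    ... | no v≢t = cong suc (trans (cong (λ x → forwardsWithin t r′ (update c u w) F (r′ v x)) (update-other c u w v v≢u))
          (forwards-ignore c u w F (r′ v (c v)) nu (r′-on-sphere v (c v) nv)
            (better-trans t (r′ v (c v)) v u (0<² (r′ v (c v)) (r′-on-sphere v (c v) nv)) (0≤² v nv) (0≤² u nu) (ℤ.<⇒≤ (r′-better v (c v) nv v≢t)) bet)))
      where v≢u : ¬ v ≡ u
            v≢u refl = ℤ.<-irrefl refl bet

    forwards-r′ : ∀ c F v → norm1 v ≡ n → (∀ u → u ∈ V n → c u ∈ others n u) → forwardsWithin t r c F v ≡ forwardsWithin t r′ c F v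
    forwards-r′ c zero v nv vc = refl
    forwards-r′ c (suc F) v nv vc with v ≟V t
    ... | yes _ = refl
    ... | no _ = cong suc (trans (forwards-r′ c F (r v (c v)) (r-on-sphere v (c v) nv (vc v (∈V⁺ nv))) vc)
                   (cong (forwardsWithin t r′ c F) (sym (r′≡r v (c v) (vc v (∈V⁺ nv))))))

    -- Unlike |u - t|₁, the level defined from Reached is monotone along the route; the disjunct J ≤ j
    -- makes it total.
    AsGoodAs : ℕ → Vertex → Vertex → Set
    AsGoodAs R u x = norm1 (x ⊖ t) ≤ R × CosGE t u x

    Reached : ℕ → Vertex → Set
    Reached j u = Any (AsGoodAs (radius j) u) (V n) ⊎ J ≤ j

    reached? : ∀ u j → Dec (Reached j u)
    reached? u j = any? (λ x → (norm1 (x ⊖ t) ℕ.≤? radius j) ×-dec (sq± (dot x t) ℤ.* dot u u ℤ.≤? sq± (dot u t) ℤ.* dot x x)) (V n) ⊎-dec (J ℕ.≤? j)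

    level-least : ∀ u → Least (λ j → Reached j u) J
    level-least u = least (reached? u) J (inj₂ ℕ.≤-refl)

    level : Vertex → ℕ
    level u = Least.index (level-least u)

    level≤ : ∀ u j → Reached j u → level u ≤ j
    level≤ u = Least.minimal (level-least u)

    reached-near : ∀ u w j → norm1 w ≡ n → norm1 (w ⊖ t) ≤ radius j → CosGE t u w → Reached j u
    reached-near u w j nw D ge = inj₁ (L.lose {P = AsGoodAs (radius j) u} {x = w} (∈V⁺ {n} {w} nw) (D , ge))

    2n≤radius : ∀ j → J ≤ j → 2 ℕ.* n ≤ radius j
    2n≤radius j J≤j = ℕ.s≤s⁻¹ (ℕ.≤-trans 2n<2^J (ℕ.≤-trans (ℕ.^-monoʳ-≤ 2 J≤j) (ℕ.≤-reflexive (sym (suc-radius j)))))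

    cosGE-refl : ∀ u → CosGE t u u
    cosGE-refl u = ℤ.≤-refl

    reached-witness : ∀ u j → norm1 u ≡ n → Reached j u → Σ Vertex λ x → norm1 x ≡ n × AsGoodAs (radius j) u x
    reached-witness u j nu (inj₁ p) = let (x , x∈ , good) = L.find p in x , ∈V⁻ {n} {x} x∈ , good
    reached-witness u j nu (inj₂ J≤j) = u , nu , ℕ.≤-trans (norm-⊖≤ n 1≤n u t nu nt) (2n≤radius j J≤j) , cosGE-refl u

    -- A witness for u is one for v, by transitivity.
    level-anti : ∀ u v → norm1 u ≡ n → norm1 v ≡ n → CosGE t v u → level v ≤ level u
    level-anti u v nu nv ge = go (reached-witness u (level u) nu (Least.holds (level-least u)))
      where
      go : (Σ Vertex λ x → norm1 x ≡ n × AsGoodAs (radius (level u)) u x) → level v ≤ level u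
      go (x , nx , D , ux) = level≤ v (level u) (reached-near v x (level u) nx D (cosGE-trans t v u x (0≤² v nv) (0<² u nu) (0≤² x nx) ge ux))

    near-level : ∀ u → norm1 u ≡ n → norm1 (u ⊖ t) ≤ 6 ℕ.* radius (level u)
    near-level u nu = go (reached-witness u (level u) nu (Least.holds (level-least u)))
      where
      go : (Σ Vertex λ x → norm1 x ≡ n × AsGoodAs (radius (level u)) u x) → norm1 (u ⊖ t) ≤ 6 ℕ.* radius (level u)
      go (x , nx , D , ux) = ℕ.≤-trans (cosGE⇒near x u t nx nu nt 1≤n ux) (ℕ.*-monoʳ-≤ 6 D)

    -- The reciprocal of a lower bound for the probability that one forward lowers the level: the
    -- ball around t has weight at least 1/K², out of a total of at most 144 (J + 1).
    A : ℕ
    A = (K ℕ.* K) ℕ.* (144 ℕ.* suc J)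

    potential : Vertex → ℕ
    potential u = A ℕ.* level u

    Ball : ℕ → Vertex → ℚ
    Ball R w with norm1 (w ⊖ t) ℕ.≤? R
    ... | yes _ = 1ℚ
    ... | no _ = 0ℚ

    0≤Ball : ∀ R w → 0ℚ ℚ.≤ Ball R w
    0≤Ball R w with norm1 (w ⊖ t) ℕ.≤? R
    ... | yes _ = 0≤q 1
    ... | no _ = ℚ.≤-refl

    Ball-in : ∀ R w → norm1 (w ⊖ t) ≤ R → Ball R w ≡ 1ℚ
    Ball-in R w le with norm1 (w ⊖ t) ℕ.≤? R
    ... | yes _ = refl
    ... | no p = ⊥-elim (p le)

    Ball-out : ∀ R w → ¬ norm1 (w ⊖ t) ≤ R → Ball R w ≡ 0ℚ
    Ball-out R w p with norm1 (w ⊖ t) ℕ.≤? R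
    ... | yes le = ⊥-elim (p le)
    ... | no _ = refl

    -- (m + 1)² vertices within K (m + 1) of u: their inverse squared distances sum to at least 1/K².
    ball-weight : ∀ u j → norm1 u ≡ n → ¬ Reached j u → norm1 (u ⊖ t) ≤ 6 ℕ.* radius (suc j) →
      recipℕ (K ℕ.* K) ℚ.≤ ∑ (others n u) (λ w → invSq n u w ℚ.* Ball (radius j) w)
    ball-weight u j nu unreached Du = begin
        recipℕ (K ℕ.* K)                                        ≤⟨ recip≤ (M ℕ.* M) (B ℕ.* B) (K ℕ.* K) (ℕ.*-mono-≤ 1≤B 1≤B) (ℕ.*-mono-≤ 1≤K 1≤K) (ℕ.≤-reflexive (l₁ K M)) ⟩
        q (M ℕ.* M) ℚ.* c                                       ≡⟨ cong (λ k → q k ℚ.* c) (sym (Cluster.size cluster)) ⟩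
        q (length points) ℚ.* c                                 ≡⟨ sym (∑-const points c) ⟩
        ∑ points (λ _ → c)                                      ≤⟨ ∑-mono points (λ w w∈ → heavy w (∈points w∈)) ⟩
        ∑ points (λ w → invSq n u w ℚ.* Ball (radius j) w)      ≤⟨ ∑-⊆ {ys = others n u} (λ w → 0≤* (0≤invSq n u w) (0≤Ball (radius j) w)) (Cluster.unique cluster) (λ {w} w∈ → other w (∈points w∈)) ⟩
        ∑ (others n u) (λ w → invSq n u w ℚ.* Ball (radius j) w) ∎
      where
      open ℚ.≤-Reasoning
      R = radius j
      -- The division by 12 meets two constraints: 4m ≤ R keeps the cluster in the ball, and 12m ≤ R
      -- ≤ 2n yields the 6m ≤ n required by `spread`. For R < 12 the cluster is t alone.
      m = R / 12
      M = suc m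
      B = K ℕ.* M
      c = recipℕ (B ℕ.* B)
      1≤B : 1 ≤ B
      1≤B = ℕ.*-mono-≤ 1≤K (s≤s (z≤n {m}))
      l₁ : ∀ K M → (K ℕ.* M) ℕ.* (K ℕ.* M) ≡ (M ℕ.* M) ℕ.* (K ℕ.* K)
      l₁ = solve-∀
      12m≤R : m ℕ.* 12 ≤ R
      12m≤R = m/n*n≤m R 12
      R≤ : R ≤ 11 ℕ.+ m ℕ.* 12
      R≤ = ℕ.≤-trans (ℕ.≤-reflexive (m≡m%n+[m/n]*n R 12)) (ℕ.+-monoˡ-≤ (m ℕ.* 12) (ℕ.s≤s⁻¹ (m%n<n R 12)))
      -- Were u within R of t, it would itself witness `Reached j u`.
      R<2n : R ≤ 2 ℕ.* n
      R<2n = ℕ.≤-trans (ℕ.<⇒≤ (ℕ.≰⇒> (λ le → unreached (reached-near u u j nu le (cosGE-refl u))))) (norm-⊖≤ n 1≤n u t nu nt)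
      6m≤n : 6 ℕ.* m ≤ norm1 t
      6m≤n = subst (6 ℕ.* m ≤_) (sym nt) (ℕ.*-cancelˡ-≤ 2 (ℕ.≤-trans (ℕ.≤-reflexive (l m)) (ℕ.≤-trans 12m≤R R<2n)))
        where l : ∀ m → 2 ℕ.* (6 ℕ.* m) ≡ m ℕ.* 12
              l = solve-∀
      Good : Vertex → Set
      Good w = norm1 w ≡ n × norm1 (w ⊖ t) ≤ 4 ℕ.* m
      cluster : Cluster m t
      cluster = spread-cluster (spread m t 6m≤n)
      points : List Vertex
      points = Cluster.points cluster
      ∈points : ∀ {w} → w L.∈ points → Good w
      ∈points w∈ = let (nw , D) = Cluster.members cluster w∈ in trans nw nt , D
      in-ball : ∀ w → Good w → norm1 (w ⊖ t) ≤ R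
      in-ball w (_ , D) = ℕ.≤-trans D (ℕ.≤-trans (ℕ.*-monoˡ-≤ m (ℕ.m≤m+n 4 8)) (ℕ.≤-trans (ℕ.≤-reflexive (ℕ.*-comm 12 m)) 12m≤R))
      w≢u : ∀ w → Good w → ¬ w ≡ u
      w≢u w g eq = unreached (reached-near u w j (proj₁ g) (in-ball w g) (subst (λ x → CosGE t x w) eq (cosGE-refl w)))
      other : ∀ w → Good w → w L.∈ others n u
      other w g = ∈others⁺ {n} {u} {w} (proj₁ g) (w≢u w g)
      heavy : ∀ w → Good w → c ℚ.≤ invSq n u w ℚ.* Ball R w
      heavy w g@(nw , D) = begin
        c                              ≤⟨ recip≤ 1 (d ℕ.* d) (B ℕ.* B) (ℕ.*-mono-≤ 1≤d 1≤d) (ℕ.*-mono-≤ 1≤B 1≤B) (ℕ.≤-trans (ℕ.*-mono-≤ d≤B d≤B) (ℕ.≤-reflexive (sym (ℕ.*-identityˡ (B ℕ.* B))))) ⟩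
        1ℚ ℚ.* invSq n u w             ≡⟨ ℚ.*-comm 1ℚ (invSq n u w) ⟩
        invSq n u w ℚ.* 1ℚ             ≡⟨ cong (invSq n u w ℚ.*_) (sym (Ball-in R w (in-ball w g))) ⟩
        invSq n u w ℚ.* Ball R w ∎
        where
        d = dist n u w
        1≤d : 1 ≤ d
        1≤d = 1≤dist n u w nu nw (w≢u w g)
        d≤B : d ≤ B
        d≤B = ℕ.≤-trans (dist≤ {n} u w nu nw) (ℕ.≤-trans (ℕ.*-monoʳ-≤ 4 (ℕ.≤-trans (⊖-triangle u w t) (ℕ.+-mono-≤ Du D))) (distance-bound R m R≤))

    -- Pointwise in the long-range choice: the rule does at least as well as w, so a w in the ball
    -- is a witness at scale j for the next vertex. Otherwise the level merely does not rise.
    potential-drop : ∀ u j → norm1 u ≡ n → ¬ u ≡ t → level u ≡ suc j → ∀ w → w ∈ others n u →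
      q (potential (r′ u w)) ℚ.+ q A ℚ.* Ball (radius j) w ℚ.≤ q (potential u)
    potential-drop u j nu u≢t lev w w∈ = go (norm1 (w ⊖ t) ℕ.≤? radius j)
      where
      open ℚ.≤-Reasoning
      nw : norm1 w ≡ n
      nw = proj₁ (∈others⁻ {n} {u} {w} w∈)
      ge : CosGE t (r′ u w) w
      ge = subst (λ v → CosGE t v w) (sym (r′≡r u w w∈)) (proj₂ (valid u w (∈V⁺ nu) w∈) w (here refl))
      drop : norm1 (w ⊖ t) ≤ radius j → level (r′ u w) ≤ j
      drop D = level≤ (r′ u w) j (reached-near (r′ u w) w j nw D ge)
      go : Dec (norm1 (w ⊖ t) ≤ radius j) → q (potential (r′ u w)) ℚ.+ q A ℚ.* Ball (radius j) w ℚ.≤ q (potential u)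
      go (no D) = begin
        q (potential (r′ u w)) ℚ.+ q A ℚ.* Ball (radius j) w   ≡⟨ cong (λ b → q (potential (r′ u w)) ℚ.+ q A ℚ.* b) (Ball-out (radius j) w D) ⟩
        q (potential (r′ u w)) ℚ.+ q A ℚ.* 0ℚ   ≡⟨ trans (cong (q (potential (r′ u w)) ℚ.+_) (ℚ.*-zeroʳ (q A))) (ℚ.+-identityʳ (q (potential (r′ u w)))) ⟩
        q (potential (r′ u w))                   ≤⟨ q-mono {potential (r′ u w)} {potential u} (ℕ.*-monoʳ-≤ A (level-anti u (r′ u w) nu (r′-on-sphere u w nu) (ℤ.<⇒≤ (r′-better u w nu u≢t)))) ⟩
        q (potential u) ∎
      go (yes D) = begin
        q (potential (r′ u w)) ℚ.+ q A ℚ.* Ball (radius j) w   ≡⟨ cong (λ b → q (potential (r′ u w)) ℚ.+ q A ℚ.* b) (Ball-in (radius j) w D) ⟩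
        q (potential (r′ u w)) ℚ.+ q A ℚ.* 1ℚ   ≡⟨ cong (q (potential (r′ u w)) ℚ.+_) (ℚ.*-identityʳ (q A)) ⟩
        q (potential (r′ u w)) ℚ.+ q A           ≡⟨ sym (q-+ (potential (r′ u w)) A) ⟩
        q (potential (r′ u w) ℕ.+ A)             ≤⟨ q-mono {potential (r′ u w) ℕ.+ A} {A ℕ.* suc j} (ℕ.≤-trans (ℕ.+-monoˡ-≤ A (ℕ.*-monoʳ-≤ A (drop D))) (ℕ.≤-reflexive (trans (ℕ.+-comm (A ℕ.* j) A) (sym (ℕ.*-suc A j))))) ⟩
        q (A ℕ.* suc j)                    ≡⟨ cong (λ k → q (A ℕ.* k)) (sym lev) ⟩
        q (potential u) ∎

    -- Averaging `potential-drop` leaves A times the probability of hitting the ball. This is at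
    -- least 1, because A/K² dominates the normalising sum.
    drift-at : ∀ u j → norm1 u ≡ n → ¬ u ≡ t → level u ≡ suc j →
      1ℚ ℚ.+ ∑ (others n u) (λ w → Pr n u w ℚ.* q (potential (r′ u w))) ℚ.≤ q (potential u)
    drift-at u j nu u≢t lev = begin
        1ℚ ℚ.+ ∑ (others n u) (λ w → p w ℚ.* h w)      ≤⟨ ℚ.+-monoˡ-≤ (∑ (others n u) (λ w → p w ℚ.* h w)) gain ⟩
        ∑ (others n u) (λ w → p w ℚ.* (q A ℚ.* b w)) ℚ.+ ∑ (others n u) (λ w → p w ℚ.* h w)  ≡⟨ ℚ.+-comm (∑ (others n u) (λ w → p w ℚ.* (q A ℚ.* b w))) (∑ (others n u) (λ w → p w ℚ.* h w)) ⟩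
        ∑ (others n u) (λ w → p w ℚ.* h w) ℚ.+ ∑ (others n u) (λ w → p w ℚ.* (q A ℚ.* b w))  ≡⟨ sym (∑-+ (others n u) (λ w → p w ℚ.* h w) (λ w → p w ℚ.* (q A ℚ.* b w))) ⟩
        ∑ (others n u) (λ w → p w ℚ.* h w ℚ.+ p w ℚ.* (q A ℚ.* b w))  ≤⟨ ∑-mono (others n u) (λ w w∈ → ℚ.≤-trans (ℚ.≤-reflexive (sym (ℚ.*-distribˡ-+ (p w) (h w) (q A ℚ.* b w)))) (*≤ (0≤Pr n 1≤n u nu w) (potential-drop u j nu u≢t lev w w∈))) ⟩
        ∑ (others n u) (λ w → p w ℚ.* q (potential u))  ≡⟨ ∑-*ʳ (others n u) (q (potential u)) p ⟩
        ∑ (others n u) p ℚ.* q (potential u)            ≡⟨ trans (cong (ℚ._* q (potential u)) (total n 1≤n u nu)) (ℚ.*-identityˡ _) ⟩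
        q (potential u) ∎
      where
      open ℚ.≤-Reasoning
      p h b : Vertex → ℚ
      p = Pr n u
      h w = q (potential (r′ u w))
      b = Ball (radius j)
      S = ∑ (others n u) (invSq n u)
      X = ∑ (others n u) (λ w → invSq n u w ℚ.* b w)
      unreached : ¬ Reached j u
      unreached re = ℕ.1+n≰n (ℕ.≤-trans (ℕ.≤-reflexive (sym lev)) (level≤ u j re))
      weight : recipℕ (K ℕ.* K) ℚ.≤ X
      weight = ball-weight u j nu unreached (subst (λ k → norm1 (u ⊖ t) ≤ 6 ℕ.* radius k) lev (near-level u nu))
      A-cancel : q A ℚ.* recipℕ (K ℕ.* K) ≡ q (144 ℕ.* suc J)
      A-cancel = trans (cong (ℚ._* recipℕ (K ℕ.* K)) (trans (q-* (K ℕ.* K) (144 ℕ.* suc J)) (ℚ.*-comm (q (K ℕ.* K)) (q (144 ℕ.* suc J)))))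
        (trans (ℚ.*-assoc (q (144 ℕ.* suc J)) (q (K ℕ.* K)) (recipℕ (K ℕ.* K))) (trans (cong (q (144 ℕ.* suc J) ℚ.*_) (unit (K ℕ.* K) (ℕ.*-mono-≤ 1≤K 1≤K))) (ℚ.*-identityʳ _)))
        where unit : ∀ k → 1 ≤ k → q k ℚ.* recipℕ k ≡ 1ℚ
              unit (suc k) _ = q*recip k
      0≤Z : 0ℚ ℚ.≤ Z n u
      0≤Z = 0≤inv S (0<∑-invSq n 1≤n u nu)
      gain : 1ℚ ℚ.≤ ∑ (others n u) (λ w → p w ℚ.* (q A ℚ.* b w))
      gain = begin
        1ℚ                                      ≡⟨ sym (inv*self S (0<∑-invSq n 1≤n u nu)) ⟩
        Z n u ℚ.* S                             ≤⟨ *≤ 0≤Z (∑-invSq≤ n J u nu 2n<2^J) ⟩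
        Z n u ℚ.* q (144 ℕ.* suc J)             ≡⟨ cong (Z n u ℚ.*_) (sym A-cancel) ⟩
        Z n u ℚ.* (q A ℚ.* recipℕ (K ℕ.* K))    ≤⟨ *≤ 0≤Z (*≤ (0≤q A) weight) ⟩
        Z n u ℚ.* (q A ℚ.* X)                   ≡⟨ sym (ℚ.*-assoc (Z n u) (q A) X) ⟩
        (Z n u ℚ.* q A) ℚ.* X                   ≡⟨ sym (∑-*ˡ (others n u) (Z n u ℚ.* q A) (λ w → invSq n u w ℚ.* b w)) ⟩
        ∑ (others n u) (λ w → (Z n u ℚ.* q A) ℚ.* (invSq n u w ℚ.* b w)) ≡⟨ ∑-cong (others n u) (λ w → shuffle (Z n u) (q A) (invSq n u w) (b w)) ⟩
        ∑ (others n u) (λ w → p w ℚ.* (q A ℚ.* b w)) ∎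
        where
        open import Data.Rational.Solver using (module +-*-Solver)
        open +-*-Solver using (solve; _:*_; _:=_)
        shuffle : ∀ z a i b → (z ℚ.* a) ℚ.* (i ℚ.* b) ≡ (z ℚ.* i) ℚ.* (a ℚ.* b)
        shuffle = solve 4 (λ z a i b → (z :* a) :* (i :* b) := (z :* i) :* (a :* b)) refl

    drift : ∀ u → norm1 u ≡ n → ¬ u ≡ t → 1ℚ ℚ.+ ∑ (others n u) (λ w → Pr n u w ℚ.* q (potential (r′ u w))) ℚ.≤ q (potential u)
    drift u nu u≢t = go (level u) refl
      where
      go : ∀ k → level u ≡ k → 1ℚ ℚ.+ ∑ (others n u) (λ w → Pr n u w ℚ.* q (potential (r′ u w))) ℚ.≤ q (potential u)
      -- Level 0 has radius 0, which forces u = t.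
      go zero lev = ⊥-elim (u≢t (⊖-zero u t (subst (λ k → norm1 (u ⊖ t) ≤ 6 ℕ.* radius k) lev (near-level u nu))))
      go (suc j) lev = drift-at u j nu u≢t lev

    private
      on-V : ∀ {u} → u ∈ V n → norm1 u ≡ n
      on-V {u} = ∈V⁻ {n} {u}

    forwards-done : ∀ c F v → v ≡ t → forwardsWithin t r′ c F v ≡ 0
    forwards-done c zero v eq = refl
    forwards-done c (suc F) v eq with v ≟V t
    ... | yes _ = refl
    ... | no ne = ⊥-elim (ne eq)

    forwards-suc : ∀ c F v → ¬ v ≡ t → forwardsWithin t r′ c (suc F) v ≡ suc (forwardsWithin t r′ c F (r′ v (c v)))
    forwards-suc c F v ne with v ≟V t
    ... | yes eq = ⊥-elim (ne eq)
    ... | no _ = refl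

    expectation-zero : ∀ F v → (∀ c → forwardsWithin t r′ c F v ≡ 0) → Expect n (λ c → q (forwardsWithin t r′ c F v)) ℚ.≤ q (potential v)
    expectation-zero F v h = begin
      Expect n (λ c → q (forwardsWithin t r′ c F v))   ≡⟨ expect-cong n (0≤Pr n 1≤n) (total n 1≤n) (V n) (λ c → cong q (h c)) ⟩
      Expect n (λ c → q 0)                             ≡⟨ expect-const n (0≤Pr n 1≤n) (total n 1≤n) (V n) (q 0) on-V ⟩
      q 0                                              ≤⟨ 0≤q (potential v) ⟩
      q (potential v) ∎
      where open ℚ.≤-Reasoning

    -- Once the choice of v is split off, the rest of the route never consults v, so the expectation
    -- restarts from the next vertex over all choices. The bound does not depend on F and hence
    -- passes to the full delivery time.
    expected-forwards : ∀ F v → norm1 v ≡ n → Expect n (λ c → q (forwardsWithin t r′ c F v)) ℚ.≤ q (potential v)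
    expected-forwards zero v nv = expectation-zero zero v (λ c → refl)
    expected-forwards (suc F) v nv = go (v ≟V t)
      where
      open ℚ.≤-Reasoning
      fw : Config → Vertex → ℕ
      fw c = forwardsWithin t r′ c F
      G : Vertex → Config → ℚ
      G w c = q (fw c (r′ v w))
      go : Dec (v ≡ t) → Expect n (λ c → q (forwardsWithin t r′ c (suc F) v)) ℚ.≤ q (potential v)
      go (yes eq) = expectation-zero (suc F) v (λ c → forwards-done c (suc F) v eq)
      go (no v≢t) = begin
        Expect n (λ c → q (forwardsWithin t r′ c (suc F) v))        ≡⟨ expect-cong n (0≤Pr n 1≤n) (total n 1≤n) (V n) (λ c → trans (cong q (forwards-suc c F v v≢t)) (q-+ 1 (fw c (r′ v (c v))))) ⟩
        expectOver n (V n) (λ c → 1ℚ ℚ.+ G (c v) c)                  ≡⟨ expect-+ n (0≤Pr n 1≤n) (total n 1≤n) (V n) (λ _ → 1ℚ) (λ c → G (c v) c) ⟩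
        expectOver n (V n) (λ _ → 1ℚ) ℚ.+ expectOver n (V n) (λ c → G (c v) c)  ≡⟨ cong₂ ℚ._+_ (expect-const n (0≤Pr n 1≤n) (total n 1≤n) (V n) 1ℚ on-V)
             (expect-split n (0≤Pr n 1≤n) (total n 1≤n) (V n) v G on-V (∈V⁺ nv) (λ w h → cong q (forwards-cong F (r′ v w) h))
                (λ w c a → cong q (forwards-ignore c v a F (r′ v w) nv (r′-on-sphere v w nv) (r′-better v w nv v≢t)))) ⟩
        1ℚ ℚ.+ ∑ (others n v) (λ w → Pr n v w ℚ.* expectOver n (V n) (G w))  ≤⟨ ℚ.+-monoʳ-≤ 1ℚ (∑-mono (others n v) (λ w _ → *≤ (0≤Pr n 1≤n v nv w) (expected-forwards F (r′ v w) (r′-on-sphere v w nv)))) ⟩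
        1ℚ ℚ.+ ∑ (others n v) (λ w → Pr n v w ℚ.* q (potential (r′ v w)))    ≤⟨ drift v nv v≢t ⟩
        q (potential v) ∎

    forwards-bound : ∀ F s → norm1 s ≡ n → Expect n (λ c → q (forwardsWithin t r c F s)) ℚ.≤ q (A ℕ.* J)
    forwards-bound F s ns = begin
      Expect n (λ c → q (forwardsWithin t r c F s))    ≤⟨ expect-mono n (0≤Pr n 1≤n) (total n 1≤n) (V n) on-V (λ c vc → ℚ.≤-reflexive (cong q (forwards-r′ c F s ns vc))) ⟩
      Expect n (λ c → q (forwardsWithin t r′ c F s))   ≤⟨ expected-forwards F s ns ⟩
      q (potential s)                                   ≤⟨ q-mono {potential s} {A ℕ.* J} (ℕ.*-monoʳ-≤ A (Least.bounded (level-least s))) ⟩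
      q (A ℕ.* J) ∎
      where open ℚ.≤-Reasoning

open import Defs
open import Data.Nat using (ℕ; _≤_; _*_)
open import Data.Nat.Logarithm using (⌊log₂_⌋)
open import Data.Integer using (+_)
open import Data.Rational as ℚ using (ℚ)
open import Data.Product using (Σ; _×_)

-- Conversion of the scale count to logarithms.

module Assembly where
  open Balls using (∈V⁻)
  open Rationals using (q-mono)
  open Routing using (forwards-bound)
  open import Data.Nat using (suc; _+_; _^_; _<_)
  open import Data.Nat.Properties
  open import Data.Nat.Logarithm using (⌊log₂⌋-mono-≤; ⌊log₂[2^n]⌋≡n)
  open import Data.Nat.Tactic.RingSolver using (solve-∀)
  open import Relation.Binary.PropositionalEquality using (_≡_; sym)

  n<2^[1+log] : ∀ n → n < 2 ^ suc ⌊log₂ n ⌋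
  n<2^[1+log] n = ≰⇒> λ le → 1+n≰n (≤-trans (≤-reflexive (sym (⌊log₂[2^n]⌋≡n (suc ⌊log₂ n ⌋)))) (⌊log₂⌋-mono-≤ le))

  scales : ∀ n → suc (2 * n) ≤ 2 ^ (2 + ⌊log₂ n ⌋)
  scales n = ≤-trans (≤-trans (n≤1+n (suc (2 * n))) (≤-reflexive (sym (*-suc 2 n)))) (*-monoʳ-≤ 2 (n<2^[1+log] n))

  -- With J = 2 + l and l ≥ 1, J + 1 ≤ 4l and J ≤ 3l, so 1728 = 144 · 4 · 3.
  collect : ∀ k l → 1 ≤ l → (k * (144 * suc (2 + l))) * (2 + l) ≤ (k * 1728) * l * l
  collect k l 1≤l = ≤-trans (*-mono-≤ (*-monoʳ-≤ k (*-monoʳ-≤ 144 (+-monoˡ-≤ l (*-monoʳ-≤ 3 1≤l)))) (+-monoˡ-≤ l (*-monoʳ-≤ 2 1≤l))) (≤-reflexive (expand k l))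
    where expand : ∀ k l → (k * (144 * (3 * l + l))) * (2 * l + l) ≡ (k * 1728) * l * l
          expand = solve-∀

  forwards-log² : ∀ K → 1 ≤ K → (∀ R m → R ≤ 11 + m * 12 → 4 * (6 * suc (R + R) + 4 * m) ≤ K * suc m) →
    ∀ n → 2 ≤ n → ∀ s t → s ∈ V n → t ∈ V n → ∀ r → ValidRule n t r → ∀ F →
    Expect n (λ c → (+ forwardsWithin t r c F s) ℚ./ 1) ℚ.≤ ((+ (K * K * 1728 * ⌊log₂ n ⌋ * ⌊log₂ n ⌋)) ℚ./ 1)
  forwards-log² K 1≤K distance-bound n 2≤n s t s∈ t∈ r valid F = ℚ.≤-trans
    (forwards-bound n (≤-trans (n≤1+n 1) 2≤n) t (∈V⁻ {n} {t} t∈) r valid K 1≤K distance-bound (2 + ⌊log₂ n ⌋) (scales n) F s (∈V⁻ {n} {s} s∈))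
    (q-mono {(K * K * (144 * suc (2 + ⌊log₂ n ⌋))) * (2 + ⌊log₂ n ⌋)} {K * K * 1728 * ⌊log₂ n ⌋ * ⌊log₂ n ⌋} (collect (K * K) ⌊log₂ n ⌋ (⌊log₂⌋-mono-≤ 2≤n)))
    where import Data.Rational.Properties as ℚ

theorem2 : Σ ℕ λ C → Σ ℕ λ N → ∀ n → N ≤ n → ∀ s t → s ∈ V n → t ∈ V n →
    ∀ r → ValidRule n t r → ∀ F →
    Expect n (λ c → (+ forwardsWithin t r c F s) ℚ./ 1)
    ℚ.≤ ((+ (C * ⌊log₂ n ⌋ * ⌊log₂ n ⌋)) ℚ./ 1)
-- The threshold 2 matters: for n = 1 the logarithm vanishes and the bound would allow no forward at
-- all.
theorem2 = 592 * 592 * 1728 , 2 , forwards-log² 592 (s≤s z≤n) distance-constant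
  where
  open import Data.Nat using (s≤s; z≤n)
  open import Data.Product using (_,_)
  open Levels using (distance-constant)
  open Assembly using (forwards-log²)
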